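{- There is a deterministic polynomial-time algorithm that, given an $n$-vertex graph $G=(V,E)$, an integer $f\ge 1$, an $f$-respecting-decomposition $(U,\Gamma)$ with respect to a (possibly implicit) set of tuples $\mathcal{Q}$, and an integer $\tau\ge 2$, computes an $f$-respecting-decomposition $(B,\Lambda)$ with respect to a set of tuples $\mathcal{Q}'$ which satisfies the following: 1. If $\langle s,t,F\rangle\in\mathcal{Q}$ is not captured by $(U,\Gamma)$, then $\langle a,b,F\rangle\in\mathcal{Q}'$ for every $\langle a,b\rangle\in U(s,F)\times U(t,F)$. 2. $|B|\le |U|/\tau$. 3. $\Delta(\Lambda)=\Delta(\Gamma)+O(\tau\cdot(f\log n)^{12})$.
   Context: For $u\in V$, $N^+(u)$ is the closed neighborhood of $u$ in $G$ (its neighbors together with $u$). For $F\subseteq V$, vertices $s,t\in V\setminus F$ are $F$-connected if they are connected in $G-F$. A decomposition $(U,\Gamma)$ consists of a vertex subset $U\subseteq V$ and a collection $\Gamma=\{\gamma_1,\dots,\gamma_k\}$ of mutually disjoint vertex subsets $\gamma_j\subseteq V$, each associated with a spanning tree $T(\gamma_j)$ of the induced graph $G[\gamma_j]$. $U$ may intersect $V(\Gamma)=\bigcup_j\gamma_j$. Its degree is $\Delta(\Gamma)=\max_j\Delta(T(\gamma_j))$, where $\Delta(T)$ denotes maximum degree (and $\Delta(\emptyset)=0$). A path $P$ in $G$ respects $(U,\Gamma)$ if for every segment (subpath) $P'$ of $P$ having no vertices of $U$ there is some $\gamma_j\in\Gamma$ with $V(P')\subseteq\gamma_j$. A triplet $\langle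 s,t,F\rangle$ respects $(U,\Gamma)$ if either $s,t$ are not $F$-connected, or $s,t$ are $F$-connected and there exists an $s$-$t$ path in $G-F$ that respects $(U,\Gamma)$. A triplet $\langle s,t,F\rangle$ is captured by $(U,\Gamma)$ if there is some $\gamma_j\in\Gamma$ such that $s,t$ are connected in $G[\gamma_j]-F$. For a set $\mathcal{Q}$ of triplets $\langle s,t,F\rangle$ with $F\subseteq V$, $|F|\le f$, $s,t\in V\setminus F$, the decomposition $(U,\Gamma)$ is an $f$-respecting-decomposition with respect to $\mathcal{Q}$ if every $\langle s,t,F\rangle\in\mathcal{Q}$ respects $(U,\Gamma)$. "Possibly implicit" means that $\mathcal{Q}$ need not be given to the algorithm (likewise $\mathcal{Q}'$ is not output). For a decomposition $(U,\Gamma)$, $F\subseteq V$ and $s\in V\setminus F$: if $s\in\gamma_j$ for some $\gamma_j\in\Gamma$, $U(s,F)$ is the set of all $u\in U-F$ such that $N^+(u)$ intersects the connected component of $s$ in $G[\gamma_j]-F$; if $s\in U-V(\Gamma)$, $U(s,F)=\{s\}$; otherwise $U(s,F)=\emptyset$. -}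

module Defs where

open import Data.Bool using (Bool; true; false; T)
open import Data.Fin using (Fin)
open import Data.Fin.Subset using (Subset; _∈_; _∉_; ∁; _∩_; _∪_; _─_; ⁅_⁆; ∣_∣; Nonempty; Empty; ⊤)
open import Data.List using (List; []; _∷_; _++_; map; head; last; length; allFin)
open import Data.List.Extrema.Nat using (max)
open import Data.List.Relation.Unary.All using (All)
open import Data.List.Relation.Unary.AllPairs using (AllPairs)
open import Data.List.Relation.Unary.Any using (Any)
open import Data.List.Relation.Unary.Linked using (Linked)
open import Data.List.Relation.Unary.Unique.Propositional using (Unique)
open import Data.Maybe using (just)
open import Data.Nat using (ℕ; suc; _+_; _*_; _^_; _≤_)
open import Data.Nat.Binary using (ℕᵇ; zero; 2[1+_]; 1+[2_]; fromℕ)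
open import Data.Product using (_×_; ∃; ∃-syntax)
open import Data.Sum using (_⊎_)
open import Data.Vec as Vec using (Vec; _[_]≔_; tabulate; toList; lookup; replicate)
open import Relation.Binary.PropositionalEquality using (_≡_; _≢_)
open import Relation.Nullary using (¬_)

------------------------------------------------------------------------
-- Finite simple graphs

record Graph (n : ℕ) : Set where
  field
    adj    : Fin n → Fin n → Bool
    sym    : ∀ u v → adj u v ≡ adj v u
    irrefl : ∀ v → adj v v ≡ false

  Adj : Fin n → Fin n → Set
  Adj u v = T (adj u v)

  neighbours : Fin n → Subset n
  neighbours u = tabulate (adj u)

  N⁺ : Fin n → Subset n
  N⁺ u = neighbours u ∪ ⁅ u ⁆

  degree : Fin n → ℕ
  degree u = ∣ neighbours u ∣

  maxDegree : ℕ
  maxDegree = max 0 (map degree (allFin n))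

open Graph public using (Adj; N⁺; maxDegree)

module _ {n : ℕ} (G : Graph n) where

  -- A simple s-t path of the induced subgraph G[S], as its list of vertices.
  -- The graph G - F is G[∁ F], and G[γ] - F is G[γ ─ F].
  record IsPath (S : Subset n) (s t : Fin n) (P : List (Fin n)) : Set where
    field
      first    : head P ≡ just s
      final    : last P ≡ just t
      adjacent : Linked (Adj G) P
      simple   : Unique P
      inside   : All (_∈ S) P

  Connected : Subset n → Fin n → Fin n → Set
  Connected S s t = ∃ (IsPath S s t)

  Acyclic : Set
  Acyclic = ∀ s t P → IsPath ⊤ s t P → 3 ≤ length P → ¬ Adj G t s

-- `tree` lives on all of Fin n; vertices outside γ are isolated in it and
-- do not count as vertices of the tree.
record IsSpanningTree {n : ℕ} (G : Graph n) (γ : Subset n) (tree : Graph n) : Set where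
  field
    subgraph  : ∀ u v → Adj tree u v → Adj G u v × u ∈ γ × v ∈ γ
    nonempty  : Nonempty γ
    connected : ∀ u v → u ∈ γ → v ∈ γ → Connected tree γ u v
    acyclic   : Acyclic tree

------------------------------------------------------------------------
-- Decompositions

record Cluster (n : ℕ) : Set where
  field
    vertices : Subset n
    tree     : Graph n

open Cluster public

record Decomposition {n : ℕ} (G : Graph n) : Set where
  field
    U        : Subset n
    Γ        : List (Cluster n)
    spanning : All (λ γ → IsSpanningTree G (vertices γ) (tree γ)) Γ
    disjoint : AllPairs (λ γ δ → Empty (vertices γ ∩ vertices δ)) Γ

  Δ : ℕ
  Δ = max 0 (map (λ γ → maxDegree (tree γ)) Γ)

  -- Segments are nonempty; otherwise no path would respect a decomposition
  -- with empty Γ.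
  PathRespects : List (Fin n) → Set
  PathRespects P =
    ∀ before v vs after → P ≡ before ++ (v ∷ vs) ++ after →
    All (_∉ U) (v ∷ vs) →
    Any (λ γ → All (_∈ vertices γ) (v ∷ vs)) Γ

  Respects : Fin n → Fin n → Subset n → Set
  Respects s t F =
    ¬ Connected G (∁ F) s t
    ⊎ Connected G (∁ F) s t × ∃[ P ] (IsPath G (∁ F) s t P × PathRespects P)

  Captured : Fin n → Fin n → Subset n → Set
  Captured s t F = Any (λ γ → Connected G (vertices γ ─ F) s t) Γ

  -- Membership of u in the set U(s,F); meant for s ∉ F.
  InU : Fin n → Subset n → Fin n → Set
  InU s F u =
    Any (λ γ → s ∈ vertices γ
             × u ∈ U ─ F
             × ∃[ v ] (v ∈ N⁺ G u × Connected G (vertices γ ─ F) s v)) Γ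
    ⊎ (s ∈ U × All (λ γ → s ∉ vertices γ) Γ × u ≡ s)

open Decomposition public

TripletSet : ℕ → Set₁
TripletSet n = Fin n → Fin n → Subset n → Set

Admissible : {n : ℕ} → ℕ → TripletSet n → Set
Admissible f Q = ∀ s t F → Q s t F → ∣ F ∣ ≤ f × s ∉ F × t ∉ F

IsRespectingDecomposition : {n : ℕ} {G : Graph n} → ℕ → TripletSet n → Decomposition G → Set
IsRespectingDecomposition f Q D =
  Admissible f Q × (∀ s t F → Q s t F → Respects D s t F)

------------------------------------------------------------------------
-- Deterministic computation: the WHILE language over binary trees (Jones,
-- "Computability and Complexity from a Programming Perspective"), with unit
-- cost per elementary operation.  Unit cost is justified by sharing: trees
-- are pointers, `_∙_` allocates one cell, and the only test is against nil.
-- Hence t steps are simulated in time polynomial in t and the input size on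
-- a Turing machine, up to writing out the result, which below always has
-- size polynomial in the number of vertices.

infixr 5 _∙_

data Tree : Set where
  nil : Tree
  _∙_ : Tree → Tree → Tree

size : Tree → ℕ
size nil     = 1
size (a ∙ b) = suc (size a + size b)

hd tl : Tree → Tree
hd nil     = nil
hd (a ∙ b) = a
tl nil     = nil
tl (a ∙ b) = b

data Expr (k : ℕ) : Set where
  var   : Fin k → Expr k
  `nil  : Expr k
  `cons : Expr k → Expr k → Expr k
  `hd   : Expr k → Expr k
  `tl   : Expr k → Expr k

infixr 4 _︔_
infix  5 _≔_

data Command (k : ℕ) : Set where
  skip          : Command k
  _≔_           : Fin k → Expr k → Command k
  _︔_           : Command k → Command k → Command k
  if_then_else_ : Expr k → Command k → Command k → Command k
  while_loop_     : Expr k → Command k → Command k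

Store : ℕ → Set
Store k = Vec Tree k

module _ {k : ℕ} where

  eval : Expr k → Store k → Tree
  eval (var x)     σ = lookup σ x
  eval `nil        σ = nil
  eval (`cons e g) σ = eval e σ ∙ eval g σ
  eval (`hd e)     σ = hd (eval e σ)
  eval (`tl e)     σ = tl (eval e σ)

  cost : Expr k → ℕ
  cost (var x)     = 1
  cost `nil        = 1
  cost (`cons e g) = suc (cost e + cost g)
  cost (`hd e)     = suc (cost e)
  cost (`tl e)     = suc (cost e)

  -- ⟨ c , σ ⟩⇓⟨ σ′ , t ⟩: c started in σ halts in σ′ after t steps.
  -- A guard is true when its value is not nil.
  data ⟨_,_⟩⇓⟨_,_⟩ : Command k → Store k → Store k → ℕ → Set where
    ⇓skip   : ∀ {σ} → ⟨ skip , σ ⟩⇓⟨ σ , 1 ⟩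
    ⇓assign : ∀ {x e σ} → ⟨ x ≔ e , σ ⟩⇓⟨ σ [ x ]≔ eval e σ , suc (cost e) ⟩
    ⇓seq    : ∀ {c d σ σ′ σ″ t u} →
              ⟨ c , σ ⟩⇓⟨ σ′ , t ⟩ → ⟨ d , σ′ ⟩⇓⟨ σ″ , u ⟩ →
              ⟨ c ︔ d , σ ⟩⇓⟨ σ″ , suc (t + u) ⟩
    ⇓then   : ∀ {e c d σ σ′ t} → eval e σ ≢ nil → ⟨ c , σ ⟩⇓⟨ σ′ , t ⟩ →
              ⟨ if e then c else d , σ ⟩⇓⟨ σ′ , suc (cost e + t) ⟩
    ⇓else   : ∀ {e c d σ σ′ t} → eval e σ ≡ nil → ⟨ d , σ ⟩⇓⟨ σ′ , t ⟩ →
              ⟨ if e then c else d , σ ⟩⇓⟨ σ′ , suc (cost e + t) ⟩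
    ⇓exit   : ∀ {e c σ} → eval e σ ≡ nil →
              ⟨ while e loop c , σ ⟩⇓⟨ σ , suc (cost e) ⟩
    ⇓loop   : ∀ {e c σ σ′ σ″ t u} → eval e σ ≢ nil →
              ⟨ c , σ ⟩⇓⟨ σ′ , t ⟩ → ⟨ while e loop c , σ′ ⟩⇓⟨ σ″ , u ⟩ →
              ⟨ while e loop c , σ ⟩⇓⟨ σ″ , suc (cost e + t + u) ⟩

-- Variable 0 holds both input and output; the others are initially nil.
record Program : Set where
  field
    extraVars : ℕ
    body      : Command (suc extraVars)

_computes_from_in-time_ : Program → Tree → Tree → ℕ → Set
p computes output from input in-time t =
  ∃[ σ ] ⟨ Program.body p , input Vec.∷ replicate _ nil ⟩⇓⟨ output Vec.∷ σ , t ⟩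

-- A program with a polynomial time budget; `input ⟶ output` asserts that the
-- program stays within the budget on this input.
record PolyClockedProgram : Set where
  field
    program     : Program
    coefficient : ℕ
    exponent    : ℕ

  _⟶_ : Tree → Tree → Set
  input ⟶ output = ∃[ t ]
    ( program computes output from input in-time t
    × t ≤ coefficient * size input ^ exponent )

------------------------------------------------------------------------
-- Encodings: graphs as adjacency matrices, numbers in (bijective) binary
-- with the least significant digit first

encodeBool : Bool → Tree
encodeBool false = nil
encodeBool true  = nil ∙ nil

encodeList : List Tree → Tree
encodeList []       = nil
encodeList (a ∷ as) = a ∙ encodeList as

encodeℕᵇ : ℕᵇ → Tree
encodeℕᵇ zero     = nil
encodeℕᵇ 2[1+ b ] = encodeBool true ∙ encodeℕᵇ b
encodeℕᵇ 1+[2 b ] = encodeBool false ∙ encodeℕᵇ b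

encodeℕ : ℕ → Tree
encodeℕ m = encodeℕᵇ (fromℕ m)

module _ {n : ℕ} where

  encodeSubset : Subset n → Tree
  encodeSubset S = encodeList (map encodeBool (toList S))

  encodeGraph : Graph n → Tree
  encodeGraph G = encodeList (map (λ u → encodeSubset (Graph.neighbours G u)) (allFin n))

  encodeCluster : Cluster n → Tree
  encodeCluster γ = encodeSubset (vertices γ) ∙ encodeGraph (tree γ)

  encodeDecomposition : {G : Graph n} → Decomposition G → Tree
  encodeDecomposition D = encodeSubset (U D) ∙ encodeList (map encodeCluster (Γ D))

  encodeInput : (G : Graph n) → ℕ → Decomposition G → ℕ → Tree
  encodeInput G f D τ =
    encodeGraph G ∙ encodeℕ f ∙ encodeDecomposition D ∙ encodeℕ τ

{-# OPTIONS --safe #-}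

-- Add the remaining vertices to Γ as singletons, so that its clusters partition V.
-- Fix moduli and residues below M = O(f log n); each choice of a modulus m and of
-- residues r₁, r₂, r₃ samples the vertices u ∈ U with residue r₁ or r₂ and the clusters
-- whose label has residue r₃.  Inside a sample, scan the clusters δ and keep those
-- that connect two sampled vertices adjacent to δ which the clusters kept before do not
-- connect; fewer than |U| are kept per sample.  For each kept δ, join all its sampled
-- neighbours to it greedily in a global forest that extends the trees of Γ, unless
-- both ends are already connected or one of them has received s new edges.  The
-- components of the forest form Λ and the vertices with s new edges form B.  Every
-- new edge but at most one per kept cluster lowers the number of components meeting U,
-- so |B| s ≤ 2 (1 + M⁴) |U|, and the degrees grow by at most s = 2 (1 + M⁴) τ.
--
-- Given F, vertices a, b of U adjacent to the same component of G[γ] - F and a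
-- modulus separating a, b, γ from the failed vertices and the other failed clusters,
-- consider the sample of a, b and γ.  If γ was kept, then a and b reach the component
-- by edges that meet B or stay inside a member of Λ.  Otherwise a and b are connected
-- by kept clusters other than γ, which F misses.  A separating modulus exists because a
-- common multiple of 1, …, M is at least 2^(M-1), hence too large to divide the product
-- of the 3 |F| differences in question.

module Submission where

open import Defs
open import Data.Fin.Subset using (∣_∣)
open import Data.Nat using (ℕ; _+_; _*_; _^_; _≤_)
open import Data.Nat.Logarithm using (⌈log₂_⌉)
open import Data.Product using (_×_; ∃-syntax; Σ-syntax)
open import Relation.Nullary using (¬_)

open import Data.Bool as Bool using (Bool; true; false; T; _∨_; _∧_; not)
open import Data.Bool.Properties using (T-≡; ∨-zeroʳ) renaming (_≟_ to _≟ᵇ_)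
open import Data.Empty using (⊥-elim)
open import Data.Fin as Fin using (Fin; zero; suc; toℕ; #_)
open import Data.Fin.Properties using (toℕ<n; toℕ-injective; any?)
open import Data.Fin.Subset as Subset using (Subset; _∪_; _∩_; _─_; ∁; ⁅_⁆; Empty)
open import Data.Fin.Subset.Properties
open import Data.List as List using (List; []; _∷_; _++_; allFin; applyUpTo; downFrom; filter; foldl; foldr; head; last; length; map; replicate; reverse; upTo)
open import Data.List.Extrema.Nat using (max; max≤v⁺; xs≤max)
open import Data.List.Membership.Propositional using (_∈_; _∉_; find; lose)
open import Data.List.Membership.Propositional.Properties using (∈-allFin; ∈-downFrom⁺; ∈-downFrom⁻; ∈-filter⁺; ∈-map⁺)
open import Data.List.Properties using (length-downFrom; length-map; length-replicate; length-reverse; length-tabulate; map-cong; map-id; map-tabulate; map-∘; reverse-foldl; reverse-map; reverse-upTo; tabulate-cong)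
open import Data.List.Relation.Unary.All as All using (All; []; _∷_)
import Data.List.Relation.Unary.All.Properties as AllP
open import Data.List.Relation.Unary.AllPairs as AllPairs using (AllPairs; []; _∷_)
import Data.List.Relation.Unary.AllPairs.Properties as AllPairsP
open import Data.List.Relation.Unary.Any as Any using (Any; here; there)
open import Data.List.Relation.Unary.Any.Properties using (reverse⁺)
open import Data.List.Relation.Unary.Linked as Linked using (Linked; []; [-]; _∷_)
open import Data.List.Relation.Unary.Unique.Propositional using (Unique)
open import Data.List.Relation.Unary.Unique.Propositional.Properties using (allFin⁺)
open import Data.Maybe using (just)
open import Data.Nat as ℕ using (zero; suc; pred; _∸_; _⊔_; _⊓_; _<_; ∣_-_∣; z≤n; s≤s)
open import Data.Nat.Binary as ℕᵇ using (ℕᵇ; zero; 1+[2_]; 2[1+_]; fromℕ)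
open import Data.Nat.Binary.Properties using (toℕ-fromℕ)
open import Data.Nat.Divisibility using (_∣_; _∤_; _∣?_; divides; m∣m*n; ∣m+n∣m⇒∣n; ∣m⇒∣m*n; ∣n⇒∣m*n; ∣⇒≤)
open import Data.Nat.ListAction using (product)
open import Data.Nat.Logarithm using (⌈log₂2^n⌉≡n; ⌈log₂⌉-mono-≤)
open import Data.Nat.Properties
open import Data.Nat.Solver using (module +-*-Solver)
open import Data.Product using (_,_; proj₁; proj₂)
open import Data.Sum using (_⊎_; inj₁; inj₂)
open import Data.Unit using (⊤; tt)
open import Data.Vec as Vec using (Vec; []; _∷_; lookup; tabulate; toList)
open import Data.Vec.Properties using ([]=⇒lookup; lookup-map; lookup∘tabulate; lookup⇒[]=; tabulate-∘; tabulate∘lookup)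
open import Function using (Equivalence; _∘_; case_of_; id)
open import Relation.Binary.Construct.Closure.ReflexiveTransitive as Star using (Star; ε; _◅_; _◅◅_)
open import Relation.Binary.PropositionalEquality hiding (J; resp)
open import Relation.Nullary using (Dec; does; no; yes)
open import Relation.Nullary.Decidable using (True; _×-dec_; dec-false; dec-true; decidable-stable; ¬?)

open import Algebra.Properties.CommutativeMonoid.Sum +-0-commutativeMonoid using (sum; sum-cong-≗; ∑-distrib-+)
open +-*-Solver using (solve; _:+_; _:*_; _:=_; con)

-- A first-order language over trees with bounded loops

-- An edge from a vertex of `U` to a cluster whose component contains no vertex of `U` does not
-- lower the number of components meeting `U`. Such an edge may occur once per cluster, and the
-- number of clusters is not bounded in terms of |U|; this is why the clusters of a sample are
-- thinned out before anything is joined. The thinning would be unsound if a failed cluster could be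
-- the reason for discarding another one; hence a sample that serves `F` may contain no failed
-- cluster except γ. The algorithm knows neither `F` nor `Q`, so all moduli and residues are tried
-- one after the other on the same forest. What one sample achieves must survive the others: it is
-- expressed by edges that have an end in `B` or both ends in one component, and both properties
-- persist while the forest grows. The degree increase obtained is O(τ (f log n)⁴). The program is a
-- term with bounded loops only, so that polynomial time follows by structural recursion from one
-- polynomial bound on the lengths of all loops.

data Tm (k : ℕ) : Set where
  get        : Fin k → Tm k
  null       : Tm k
  pair       : Tm k → Tm k → Tm k
  left right : Tm k → Tm k
  ite        : Tm k → Tm k → Tm k → Tm k
  bind       : Tm k → Tm (suc k) → Tm k
  -- The body of a loop sees the current list element and the current state
  -- as variables 0 and 1, and returns the next state.
  loop       : Tm k → Tm k → Tm (2 + k) → Tm k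
  call       : ∀ {j} → Vec (Fin k) j → Tm j → Tm k

extend : ∀ {k} → ℕ → (Fin k → ℕ) → Fin (suc k) → ℕ
extend p δ zero    = p
extend p δ (suc x) = δ x

stack : Expr 1
stack = var zero

access : ℕ → Expr 1 → Expr 1
access zero    e = `hd e
access (suc j) e = access j (`tl e)

push replaceTop : Expr 1 → Command 1
push e       = zero ≔ `cons e stack
replaceTop e = zero ≔ `cons e (`tl stack)

dropSecond pop makePair : Command 1
dropSecond = zero ≔ `cons (`hd stack) (`tl (`tl stack))
pop        = zero ≔ `tl stack
makePair   = zero ≔ `cons (`cons (access 1 stack) (access 0 stack)) (`tl (`tl stack))

remaining : Expr 1
remaining = access 1 stack

nextIteration : Command 1
nextIteration = zero ≔ `cons (access 0 stack)
                         (`cons (`tl (access 3 stack)) (`tl (`tl (`tl (`tl stack)))))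

-- `compile t δ` pushes the value of t on the stack kept in the only register;
-- δ x is the position on the stack of the variable x.
compile : ∀ {k} → Tm k → (Fin k → ℕ) → Command 1
compile (get x)       δ = push (access (δ x) stack)
compile null          δ = push `nil
compile (pair t u)    δ = compile t δ ︔ compile u (suc ∘ δ) ︔ makePair
compile (left t)      δ = compile t δ ︔ replaceTop (`hd (`hd stack))
compile (right t)     δ = compile t δ ︔ replaceTop (`tl (`hd stack))
compile (ite c t u)   δ = compile c δ ︔
                          (if `hd stack then (pop ︔ compile t δ) else (pop ︔ compile u δ))
compile (bind t u)    δ = compile t δ ︔ compile u (extend 0 (suc ∘ δ)) ︔ dropSecond
compile (loop xs s b) δ =
  compile xs δ ︔ compile s (suc ∘ δ) ︔
  (while remaining loop
     (push (`hd remaining) ︔ compile b (extend 0 (extend 1 (λ x → 3 + δ x))) ︔ nextIteration)) ︔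
  dropSecond
compile (call xs t)   δ = compile t (λ x → δ (lookup xs x))

-- A bound on the running time when all loops run over lists of length ≤ P.
time : ∀ {k} → Tm k → (Fin k → ℕ) → ℕ → ℕ
time (get x)       δ P = suc (cost (`cons (access (δ x) stack) stack))
time null          δ P = 4
time (pair t u)    δ P = suc (time t δ P + suc (time u (suc ∘ δ) P + 11))
time (left t)      δ P = suc (time t δ P + 7)
time (right t)     δ P = suc (time t δ P + 7)
time (ite c t u)   δ P = suc (time c δ P + suc (2 + suc (3 + (time t δ P + time u δ P))))
time (bind t u)    δ P = suc (time t δ P + suc (time u (extend 0 (suc ∘ δ)) P + 7))
time (loop xs s b) δ P =
  suc (time xs δ P + suc (time s (suc ∘ δ) P + suc (
    (P * (13 + (time b (extend 0 (extend 1 (λ x → 3 + δ x))) P + 16)) + 4) + 7)))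
time (call xs t)   δ P = time t (λ x → δ (lookup xs x)) P

-- Correctness and running time of compiled terms

infix 8 _‼_
_‼_ : Tree → ℕ → Tree
S ‼ zero  = hd S
S ‼ suc j = tl S ‼ j

eval-access : ∀ j e σ → eval (access j e) σ ≡ eval e σ ‼ j
eval-access zero    e σ = refl
eval-access (suc j) e σ = eval-access j (`tl e) σ

Locates : ∀ {k} → (Fin k → ℕ) → Tree → Vec Tree k → Set
Locates δ S ρ = ∀ x → S ‼ δ x ≡ lookup ρ x

locates-extend : ∀ {k} {δ : Fin k → ℕ} {S ρ p v} → S ‼ p ≡ v → Locates δ S ρ →
                 Locates (extend p δ) S (v ∷ ρ)
locates-extend e l zero    = e
locates-extend e l (suc x) = l x

-- The stack is arbitrary apart from the positions of the variables, because a subterm runs with the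
-- temporaries of its context on top of the stack. `P` is the bound on the lengths of loops and
-- enters only through the time.
record Ev (P : ℕ) {k : ℕ} (ρ : Vec Tree k) (t : Tm k) (v : Tree) : Set where
  constructor ev
  field
    run : ∀ δ S → Locates δ S ρ →
          ∃[ τ ] (⟨ compile t δ , S ∷ [] ⟩⇓⟨ (v ∙ S) ∷ [] , τ ⟩ × τ ≤ time t δ P)

open Ev

module _ {P k : ℕ} {ρ : Vec Tree k} where

  ev-≡ : ∀ {t v w} → v ≡ w → Ev P ρ t v → Ev P ρ t w
  ev-≡ refl e = e

  ev-get : ∀ x → Ev P ρ (get x) (lookup ρ x)
  ev-get x .run δ S l =
    _ , subst (λ v → ⟨ compile (get x) δ , S ∷ [] ⟩⇓⟨ (v ∙ S) ∷ [] , _ ⟩)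
          (trans (eval-access (δ x) stack (S ∷ [])) (l x)) ⇓assign
      , ≤-refl

  ev-null : Ev P ρ null nil
  ev-null .run δ S l = _ , ⇓assign , ≤-refl

  ev-pair : ∀ {t u v w} → Ev P ρ t v → Ev P ρ u w → Ev P ρ (pair t u) (v ∙ w)
  ev-pair e f .run δ S l =
    let _ , r₁ , b₁ = run e δ S l
        _ , r₂ , b₂ = run f (suc ∘ δ) (_ ∙ S) l
    in _ , ⇓seq r₁ (⇓seq r₂ ⇓assign) , s≤s (+-mono-≤ b₁ (s≤s (+-monoˡ-≤ _ b₂)))

  ev-left : ∀ {t v} → Ev P ρ t v → Ev P ρ (left t) (hd v)
  ev-left e .run δ S l =
    let _ , r₁ , b₁ = run e δ S l
    in _ , ⇓seq r₁ ⇓assign , s≤s (+-mono-≤ b₁ ≤-refl)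

  ev-right : ∀ {t v} → Ev P ρ t v → Ev P ρ (right t) (tl v)
  ev-right e .run δ S l =
    let _ , r₁ , b₁ = run e δ S l
    in _ , ⇓seq r₁ ⇓assign , s≤s (+-mono-≤ b₁ ≤-refl)

  ev-then : ∀ {c t u a b v} → Ev P ρ c (a ∙ b) → Ev P ρ t v → Ev P ρ (ite c t u) v
  ev-then {u = u} e f .run δ S l =
    let _ , r₁ , b₁ = run e δ S l
        _ , r₂ , b₂ = run f δ S l
    in _ , ⇓seq r₁ (⇓then (λ ()) (⇓seq ⇓assign r₂))
         , s≤s (+-mono-≤ b₁ (+-monoʳ-≤ 7 (≤-trans b₂ (m≤m+n _ (time u δ P)))))

  ev-else : ∀ {c t u v} → Ev P ρ c nil → Ev P ρ u v → Ev P ρ (ite c t u) v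
  ev-else {t = t} e f .run δ S l =
    let _ , r₁ , b₁ = run e δ S l
        _ , r₂ , b₂ = run f δ S l
    in _ , ⇓seq r₁ (⇓else refl (⇓seq ⇓assign r₂))
         , s≤s (+-mono-≤ b₁ (+-monoʳ-≤ 7 (≤-trans b₂ (m≤n+m _ (time t δ P)))))

  ev-ite : ∀ {A : Set} (enc : A → Tree) {c t u b} {x y : A} → Ev P ρ c (encodeBool b) →
           Ev P ρ t (enc x) → Ev P ρ u (enc y) → Ev P ρ (ite c t u) (enc (Bool.if b then x else y))
  ev-ite enc {b = true}  e f g = ev-then e f
  ev-ite enc {b = false} e f g = ev-else e g

  ev-bind : ∀ {t u v w} → Ev P ρ t v → Ev P (v ∷ ρ) u w → Ev P ρ (bind t u) w
  ev-bind e f .run δ S l =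
    let _ , r₁ , b₁ = run e δ S l
        _ , r₂ , b₂ = run f (extend 0 (suc ∘ δ)) (_ ∙ S) (locates-extend refl l)
    in _ , ⇓seq r₁ (⇓seq r₂ ⇓assign) , s≤s (+-mono-≤ b₁ (s≤s (+-mono-≤ b₂ ≤-refl)))

  ev-call : ∀ {j} {xs : Vec (Fin k) j} {t v} → Ev P (Vec.map (lookup ρ) xs) t v →
            Ev P ρ (call xs t) v
  ev-call {xs = xs} e .run δ S l =
    run e (λ x → δ (lookup xs x)) S
      (λ x → trans (l (lookup xs x)) (sym (lookup-map x (lookup ρ) xs)))

  module _ {A B : Set} (encA : A → Tree) (encB : B → Tree) {f : B → A → B} (I : B → Set) {body : Tm (2 + k)} where

    Iterates : A → Set
    Iterates a = ∀ b → I b → I (f b a) × Ev P (encA a ∷ encB b ∷ ρ) body (encB (f b a))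

    private
      run-loop : ∀ δ S → Locates δ S ρ → ∀ xs b → All Iterates xs → I b → ∃[ τ ]
        ( ⟨ while remaining loop
              (push (`hd remaining) ︔ compile body (extend 0 (extend 1 (λ x → 3 + δ x))) ︔ nextIteration)
          , (encB b ∙ encodeList (map encA xs) ∙ S) ∷ [] ⟩⇓⟨ (encB (foldl f b xs) ∙ nil ∙ S) ∷ [] , τ ⟩
        × τ ≤ length xs * (13 + (time body (extend 0 (extend 1 (λ x → 3 + δ x))) P + 16)) + 4)
      run-loop δ S l []       b _        i = _ , ⇓exit refl , ≤-refl
      run-loop δ S l (a ∷ xs) b (e ∷ es) i =
        let i′ , e′ = e b i
            -- The body runs with the element, the state and the list on top of the old stack,
            -- whence the shift of the outer variables by 3.
            _ , r₁ , b₁ = run e′ (extend 0 (extend 1 (λ x → 3 + δ x)))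
                            (encA a ∙ encB b ∙ encodeList (map encA (a ∷ xs)) ∙ S)
                            (locates-extend refl (locates-extend refl l))
            _ , r₂ , b₂ = run-loop δ S l xs (f b a) es i′
        in _ , ⇓loop (λ ()) (⇓seq ⇓assign (⇓seq r₁ ⇓assign)) r₂
             , ≤-trans (+-mono-≤ (+-monoʳ-≤ 13 (+-monoˡ-≤ 16 b₁)) b₂)
                       (≤-reflexive (sym (+-assoc (13 + (time body (extend 0 (extend 1 (λ x → 3 + δ x))) P + 16)) _ 4)))

    -- The body may contain loops whose lengths depend on the current state; `I` carries the bound
    -- on the state that keeps them below `P`.
    ev-loop-inv : ∀ {txs ts xs b} → length xs ≤ P → I b → All Iterates xs →
                  Ev P ρ txs (encodeList (map encA xs)) → Ev P ρ ts (encB b) →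
                  Ev P ρ (loop txs ts body) (encB (foldl f b xs))
    ev-loop-inv {xs = xs} {b} h i es e₁ e₂ .run δ S l =
      let _ , r₁ , b₁ = run e₁ δ S l
          _ , r₂ , b₂ = run e₂ (suc ∘ δ) (_ ∙ S) l
          _ , r₃ , b₃ = run-loop δ S l xs b es i
      in _ , ⇓seq r₁ (⇓seq r₂ (⇓seq r₃ ⇓assign))
           , s≤s (+-mono-≤ b₁ (s≤s (+-mono-≤ b₂ (s≤s (+-mono-≤
               (≤-trans b₃ (+-monoˡ-≤ 4 (*-monoˡ-≤ _ h))) ≤-refl)))))

  ev-loop-all : ∀ {A B : Set} (encA : A → Tree) (encB : B → Tree) {f : B → A → B} {txs ts body xs b} →
                length xs ≤ P →
                Ev P ρ txs (encodeList (map encA xs)) → Ev P ρ ts (encB b) →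
                All (λ a → ∀ b → Ev P (encA a ∷ encB b ∷ ρ) body (encB (f b a))) xs →
                Ev P ρ (loop txs ts body) (encB (foldl f b xs))
  ev-loop-all encA encB h e₁ e₂ es =
    ev-loop-inv encA encB (λ _ → ⊤) h tt (All.map (λ e b _ → tt , e b) es) e₁ e₂

  ev-loop : ∀ {A B : Set} (encA : A → Tree) (encB : B → Tree) {f : B → A → B} {txs ts body xs b} →
            length xs ≤ P →
            Ev P ρ txs (encodeList (map encA xs)) → Ev P ρ ts (encB b) →
            (∀ a b → Ev P (encA a ∷ encB b ∷ ρ) body (encB (f b a))) →
            Ev P ρ (loop txs ts body) (encB (foldl f b xs))
  ev-loop encA encB {xs = xs} h e₁ e₂ e₃ = ev-loop-all encA encB h e₁ e₂ (All.universal e₃ xs)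

-- Polynomial bounds

-- Excluding 0 makes powers monotone in the exponent, so that two bounds can be brought to a common
-- exponent.
PolyBounded : (ℕ → ℕ) → Set
PolyBounded g = ∃[ c ] ∃[ e ] (∀ P → 1 ≤ P → g P ≤ c * P ^ e)

poly-const : ∀ a → PolyBounded (λ _ → a)
poly-const a = a , 0 , λ P _ → ≤-reflexive (sym (*-identityʳ a))

^-monoʳ : ∀ {P a b} → 1 ≤ P → a ≤ b → P ^ a ≤ P ^ b
^-monoʳ {suc P} _ h = ^-monoʳ-≤ (suc P) h

poly-+ : ∀ {g h} → PolyBounded g → PolyBounded h → PolyBounded (λ P → g P + h P)
poly-+ {g} {h} (c , e , G) (c′ , e′ , H) = c + c′ , e ⊔ e′ , λ P 1≤P → begin
  g P + h P                              ≤⟨ +-mono-≤ (G P 1≤P) (H P 1≤P) ⟩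
  c * P ^ e + c′ * P ^ e′                ≤⟨ +-mono-≤ (*-monoʳ-≤ c (^-monoʳ 1≤P (m≤m⊔n e e′)))
                                                     (*-monoʳ-≤ c′ (^-monoʳ 1≤P (m≤n⊔m e e′))) ⟩
  c * P ^ (e ⊔ e′) + c′ * P ^ (e ⊔ e′)   ≡⟨ sym (*-distribʳ-+ (P ^ (e ⊔ e′)) c c′) ⟩
  (c + c′) * P ^ (e ⊔ e′)                ∎
  where open ≤-Reasoning

poly-* : ∀ {g} → PolyBounded g → PolyBounded (λ P → P * g P)
poly-* {g} (c , e , G) = c , suc e , λ P 1≤P → begin
  P * g P         ≤⟨ *-monoʳ-≤ P (G P 1≤P) ⟩
  P * (c * P ^ e) ≡⟨ sym (*-assoc P c (P ^ e)) ⟩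
  P * c * P ^ e   ≡⟨ cong (_* P ^ e) (*-comm P c) ⟩
  c * P * P ^ e   ≡⟨ *-assoc c P (P ^ e) ⟩
  c * P ^ suc e   ∎
  where open ≤-Reasoning

^-distribʳ-* : ∀ k m n → (m * n) ^ k ≡ m ^ k * n ^ k
^-distribʳ-* zero    m n = refl
^-distribʳ-* (suc k) m n = trans (cong (m * n *_) (^-distribʳ-* k m n))
                             ([m*n]*[o*p]≡[m*o]*[n*p] m n (m ^ k) (n ^ k))

-- The coefficient has the form `suc c` to keep the argument of `g` positive.
poly-∘ : ∀ {g} c e → PolyBounded g → PolyBounded (λ N → g (suc c * N ^ e))
poly-∘ {g} c e (c′ , e′ , G) = c′ * suc c ^ e′ , e * e′ , λ N 1≤N → begin
  g (suc c * N ^ e)                   ≤⟨ G (suc c * N ^ e) (*-mono-≤ (s≤s (z≤n {c})) (^-monoʳ {b = e} 1≤N z≤n)) ⟩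
  c′ * (suc c * N ^ e) ^ e′           ≡⟨ cong (c′ *_) (^-distribʳ-* e′ (suc c) (N ^ e)) ⟩
  c′ * (suc c ^ e′ * (N ^ e) ^ e′)    ≡⟨ sym (*-assoc c′ (suc c ^ e′) _) ⟩
  c′ * suc c ^ e′ * (N ^ e) ^ e′      ≡⟨ cong (c′ * suc c ^ e′ *_) (^-*-assoc N e e′) ⟩
  c′ * suc c ^ e′ * N ^ (e * e′)      ∎
  where open ≤-Reasoning

time-poly : ∀ {k} (t : Tm k) δ → PolyBounded (time t δ)
time-poly (get x)       δ = poly-const _
time-poly null          δ = poly-const _
time-poly (pair t u)    δ = poly-+ (poly-const 1) (poly-+ (time-poly t δ)
                              (poly-+ (poly-const 1) (poly-+ (time-poly u (suc ∘ δ)) (poly-const 11))))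
time-poly (left t)      δ = poly-+ (poly-const 1) (poly-+ (time-poly t δ) (poly-const 7))
time-poly (right t)     δ = poly-+ (poly-const 1) (poly-+ (time-poly t δ) (poly-const 7))
time-poly (ite c t u)   δ = poly-+ (poly-const 1) (poly-+ (time-poly c δ)
                              (poly-+ (poly-const 7) (poly-+ (time-poly t δ) (time-poly u δ))))
time-poly (bind t u)    δ = poly-+ (poly-const 1) (poly-+ (time-poly t δ)
                              (poly-+ (poly-const 1) (poly-+ (time-poly u (extend 0 (suc ∘ δ))) (poly-const 7))))
time-poly (loop xs s b) δ =
  poly-+ (poly-const 1) (poly-+ (time-poly xs δ)
    (poly-+ (poly-const 1) (poly-+ (time-poly s (suc ∘ δ))
      (poly-+ (poly-const 1) (poly-+
        (poly-+ (poly-* (poly-+ (poly-const 13)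
          (poly-+ (time-poly b (extend 0 (extend 1 (λ x → 3 + δ x)))) (poly-const 16)))) (poly-const 4))
        (poly-const 7))))))
time-poly (call xs t)   δ = time-poly t (λ x → δ (lookup xs x))

-- Left folds

module _ {A B : Set} {f : B → A → B} where

  foldl-preserves : (I : B → Set) → (∀ b a → I b → I (f b a)) →
                    ∀ xs {b} → I b → I (foldl f b xs)
  foldl-preserves I h []       i = i
  foldl-preserves I h (x ∷ xs) i = foldl-preserves I h xs (h _ x i)

  -- The single visit of `a` achieves `Q`, and no later visit destroys it. Nested loops are handled
  -- by nesting this lemma.
  foldl-reaches : (I Q : B → Set) → (∀ b a → I b → I (f b a)) → (∀ b a → I b → Q b → Q (f b a)) →
                  ∀ {a} → (∀ b → I b → Q (f b a)) →
                  ∀ {xs} → a ∈ xs → ∀ {b} → I b → Q (foldl f b xs)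
  foldl-reaches I Q hI hQ ha {x ∷ xs} (here refl) {b} i =
    proj₂ (foldl-preserves (λ b → I b × Q b) (λ b a (i , q) → hI b a i , hQ b a i q) xs
             (hI b x i , ha b i))
  foldl-reaches I Q hI hQ ha (there m) i = foldl-reaches I Q hI hQ ha m (hI _ _ i)

  foldl-counts : (I : ℕ → B → Set) (k : ℕ) → (∀ X b a → I X b → I (k + X) (f b a)) →
                 ∀ xs {X b} → I X b → I (length xs * k + X) (foldl f b xs)
  foldl-counts I k h []       i = i
  foldl-counts I k h (x ∷ xs) {X} {b} i =
    subst (λ Y → I Y (foldl f (f b x) xs))
      (trans (sym (+-assoc (length xs * k) k X)) (cong (_+ X) (+-comm (length xs * k) k)))
      (foldl-counts I k h xs (h X b x i))

-- Simple walks

data Walk {A : Set} (R : A → A → Set) : A → A → List A → Set where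
  [-]  : ∀ {x} → Walk R x x (x ∷ [])
  _∷_ : ∀ {x y z P} → R x y → Walk R y z P → Walk R x z (x ∷ P)

module _ {A : Set} where

  walk-map : ∀ {R S : A → A → Set} → (∀ {x y} → R x y → S x y) → ∀ {x y P} → Walk R x y P → Walk S x y P
  walk-map f [-]     = [-]
  walk-map f (r ∷ w) = f r ∷ walk-map f w

  last∈ : ∀ {R : A → A → Set} {x y P} → Walk R x y P → y ∈ P
  last∈ [-]     = here refl
  last∈ (_ ∷ w) = there (last∈ w)

  head∈ : ∀ {R : A → A → Set} {x y P} → Walk R x y P → x ∈ P
  head∈ [-]     = here refl
  head∈ (_ ∷ w) = here refl

  walk-respects : ∀ {R : A → A → Set} {B : Set} (l : A → B) → (∀ {x y} → R x y → l x ≡ l y) →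
                  ∀ {x y P} → Walk R x y P → l x ≡ l y
  walk-respects l h [-]     = refl
  walk-respects l h (r ∷ w) = trans (h r) (walk-respects l h w)

  Forestlike : (A → A → Set) → Set
  Forestlike R = ∀ {s t P} → Walk R s t P → Unique P → 3 ≤ length P → ¬ R t s

  AddEdge : (A → A → Set) → A → A → A → A → Set
  AddEdge R u w x y = R x y ⊎ (x ≡ u × y ≡ w) ⊎ (x ≡ w × y ≡ u)

  swap-edge : ∀ {R : A → A → Set} {u w x y} → AddEdge R u w x y → AddEdge R w u x y
  swap-edge (inj₁ r)        = inj₁ r
  swap-edge (inj₂ (inj₁ e)) = inj₂ (inj₂ e)
  swap-edge (inj₂ (inj₂ e)) = inj₂ (inj₁ e)

  fresh : ∀ {x : A} {P} → Unique (x ∷ P) → x ∉ P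
  fresh (h ∷ _) m = All.lookup h m refl

  avoid : ∀ {R : A → A → Set} {u w x y P} → Walk (AddEdge R u w) x y P → u ∉ P → Walk R x y P
  avoid [-] _ = [-]
  avoid (inj₁ r ∷ p) h = r ∷ avoid p (h ∘ there)
  avoid (inj₂ (inj₁ (refl , _)) ∷ p) h = ⊥-elim (h (here refl))
  avoid (inj₂ (inj₂ (_ , refl)) ∷ p) h = ⊥-elim (h (there (head∈ p)))

  module _ {R : A → A → Set} {B : Set} (l : A → B) (resp : ∀ {x y} → R x y → l x ≡ l y) where

    private
      Crossing : A → A → A → A → Set
      Crossing u w x z = (l x ≡ l u × l z ≡ l w) ⊎ (l x ≡ l w × l z ≡ l u)

    -- A simple walk uses the new edge at most once, since a second use would repeat an end of it.
    -- Before and after the crossing the walk stays in `R`, where `l` is constant.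
    cross : ∀ {u w x z P} → Walk (AddEdge R u w) x z P → Unique P → Walk R x z P ⊎ Crossing u w x z
    cross [-] _ = inj₁ [-]
    cross (inj₁ r ∷ p) (_ ∷ up) with cross p up
    ... | inj₁ q                = inj₁ (r ∷ q)
    ... | inj₂ (inj₁ (a , b)) = inj₂ (inj₁ (trans (resp r) a , b))
    ... | inj₂ (inj₂ (a , b)) = inj₂ (inj₂ (trans (resp r) a , b))
    cross (inj₂ (inj₁ (refl , refl)) ∷ p) un =
      inj₂ (inj₁ (refl , sym (walk-respects l resp (avoid p (fresh un)))))
    cross (inj₂ (inj₂ (refl , refl)) ∷ p) un =
      inj₂ (inj₂ (refl , sym (walk-respects l resp (avoid (walk-map (swap-edge {R = R}) p) (fresh un)))))

    closed-unique : ∀ {S : A → A → Set} {z P} → Walk S z z P → Unique P → length P ≡ 1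
    closed-unique [-]     _  = refl
    closed-unique (_ ∷ p) un = ⊥-elim (fresh un (last∈ p))

    -- Different labels force the walk to use the new edge, and it must do so at once: having left
    -- `w` along `R`, it cannot come back to `w`.
    short : ∀ {u w P} → l u ≢ l w → Walk (AddEdge R u w) w u P → Unique P → length P ≡ 2
    short ne [-] _ = ⊥-elim (ne refl)
    short ne (inj₁ r ∷ p) un =
      ⊥-elim (ne (sym (trans (resp r) (walk-respects l resp (avoid (walk-map (swap-edge {R = R}) p) (fresh un))))))
    short ne (inj₂ (inj₁ (refl , _)) ∷ p) _ = ⊥-elim (ne refl)
    short ne (inj₂ (inj₂ (_ , refl)) ∷ p) (_ ∷ up) = cong suc (closed-unique p up)

    -- A cycle closed by an old edge either is an old cycle or crosses the new edge once, which
    -- would equate `l u` and `l w`. A cycle closed by the new edge would have only two vertices, by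
    -- `short`.
    forestlike-add : ∀ {u w} → l u ≢ l w → Forestlike R → Forestlike (AddEdge R u w)
    forestlike-add ne ac p un len (inj₁ r) with cross p un
    ... | inj₁ q                = ac q un len r
    ... | inj₂ (inj₁ (a , b)) = ne (trans (sym a) (trans (sym (resp r)) b))
    ... | inj₂ (inj₂ (a , b)) = ne (trans (sym b) (trans (resp r) a))
    forestlike-add ne ac p un len (inj₂ (inj₁ (refl , refl))) =
      1+n≰n (subst (3 ≤_) (short ne p un) len)
    forestlike-add ne ac p un len (inj₂ (inj₂ (refl , refl))) =
      1+n≰n (subst (3 ≤_) (short (ne ∘ sym) (walk-map (swap-edge {R = R}) p) un) len)

-- The algorithm

-- cyc m k is -k modulo m + 1, obtained by counting down.
cyc : ℕ → ℕ → ℕ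
next : ℕ → ℕ → ℕ
next m zero    = m
next m (suc c) = c
cyc m zero     = zero
cyc m (suc k)  = next m (cyc m k)

isZero : ℕ → Bool
isZero zero    = true
isZero (suc _) = false

module _ {n : ℕ} where

  -- A labelling sends each vertex to a representative of its component. The numbers in a state
  -- count the new edges that a vertex may still receive.
  Labelling Matrix Forest State : Set
  Labelling = Fin n → Fin n
  Matrix    = Fin n → Fin n → Bool
  Forest    = Labelling × Matrix
  State     = Forest × (Fin n → ℕ)

  infix 7 _==_
  _==_ : Fin n → Fin n → Bool
  u == w = does (u Fin.≟ w)

  -- Descending, so that a left fold that conses its results lists them in order.
  vertices↓ : List (Fin n)
  vertices↓ = reverse (allFin n)

  merge : Fin n → Fin n → Labelling → Labelling
  merge u w l x = Bool.if l x == l w then l u else l x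

  link : Fin n → Fin n → Matrix → Matrix
  link u w e x y = e x y ∨ (x == u ∧ y == w) ∨ (x == w ∧ y == u)

  join : Fin n → Fin n → Forest → Forest
  join u w (l , e) = Bool.if l u == l w then (l , e) else (merge u w l , link u w e)

  spend : Fin n → Fin n → (Fin n → ℕ) → Fin n → ℕ
  spend u w c x = Bool.if (x == u ∨ x == w) then pred (c x) else c x

  joinCapped : Fin n → Fin n → State → State
  joinCapped u w ((l , e) , c) =
    Bool.if isZero (c u) ∨ isZero (c w) ∨ l u == l w
    then ((l , e) , c) else ((merge u w l , link u w e) , spend u w c)

  -- Starting from `id` turns every vertex outside V(Γ) into a singleton cluster. Each tree edge is
  -- met in both directions; `join` ignores it the second time.
  clusterForest : List (Cluster n) → Forest
  clusterForest =
    foldl (λ σ γ → foldl (λ σ u → foldl (λ σ w →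
        Bool.if Graph.adj (tree γ) u w then join u w σ else σ)
      σ vertices↓) σ vertices↓)
    (id , λ _ _ → false)

  module Sampling (adj : Matrix) (inU : Fin n → Bool) (lab₀ : Labelling) where

    near : Matrix
    near u w = adj u w ∨ u == w

    touches : Fin n → Fin n → Bool
    touches u δ = foldl (λ b w → b ∨ (near u w ∧ lab₀ w == δ)) false vertices↓

    module _ (m r₁ r₂ r₃ : ℕ) where

      sampledVertex sampledCluster : Fin n → Bool
      sampledVertex u  = inU u ∧ (does (cyc m (toℕ u) ℕ.≟ r₁) ∨ does (cyc m (toℕ u) ℕ.≟ r₂))
      sampledCluster δ = lab₀ δ == δ ∧ does (cyc m (toℕ δ) ℕ.≟ r₃)

      sampledTouches : Fin n → Fin n → Bool
      sampledTouches δ u = sampledVertex u ∧ touches u δ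

      mergeAt : Fin n → Fin n → Labelling × Bool → Fin n → Labelling × Bool
      mergeAt δ u (π , b) u′ =
        Bool.if sampledTouches δ u ∧ sampledTouches δ u′ ∧ not (π u == π u′)
        then (merge u u′ π , true) else (π , b)

      -- `π` records which vertices of `U` are connected by the clusters kept so far in this sample.
      -- Any merge raises the flag, and a raised flag means that `δ` is kept.
      mergeAround : Fin n → Labelling → Labelling × Bool
      mergeAround δ π = foldl (λ p u → foldl (mergeAt δ u) p vertices↓) (π , false) vertices↓

      joinAt : Fin n → Fin n → State → Fin n → State
      joinAt δ u σ w = Bool.if sampledVertex u ∧ near u w ∧ lab₀ w == δ
                       then joinCapped u w σ else σ

      joinAround : Fin n → State → State
      joinAround δ σ = foldl (λ σ u → foldl (joinAt δ u) σ vertices↓) σ vertices↓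

      visit : Labelling × State → Fin n → Labelling × State
      visit (π , σ) δ =
        Bool.if sampledCluster δ
        then (proj₁ (mergeAround δ π) ,
              (Bool.if proj₂ (mergeAround δ π) then joinAround δ σ else σ))
        else (π , σ)

      sample : State → State
      sample σ = proj₂ (foldl visit (id , σ) vertices↓)

    -- The number `m` stands for the modulus `suc m`, whose residues are at most `m`; so one range
    -- serves all four loops.
    samples : ℕ → State → State
    samples M σ =
      foldl (λ σ m → foldl (λ σ r₁ → foldl (λ σ r₂ → foldl (λ σ r₃ →
        sample m r₁ r₂ r₃ σ) σ (downFrom M)) σ (downFrom M)) σ (downFrom M)) σ (downFrom M)

  finalState : Matrix → (Fin n → Bool) → List (Cluster n) → ℕ → ℕ → State
  finalState adj inU Γ M s = Sampling.samples adj inU (proj₁ (clusterForest Γ)) M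
                               (clusterForest Γ , λ _ → s)

-- Boolean tests as propositions

if-elim : ∀ {A : Set} (Q : A → Set) b {x y} → (b ≡ true → Q x) → (b ≡ false → Q y) →
          Q (Bool.if b then x else y)
if-elim Q true  f g = f refl
if-elim Q false f g = g refl

∨-true : ∀ a {b} → a ∨ b ≡ true → a ≡ true ⊎ b ≡ true
∨-true true  _ = inj₁ refl
∨-true false h = inj₂ h

∧-true : ∀ a {b} → a ∧ b ≡ true → a ≡ true × b ≡ true
∧-true true h = refl , h

∨-false : ∀ a {b} → a ∨ b ≡ false → a ≡ false × b ≡ false
∨-false false h = refl , h

∨-introʳ : ∀ a {b} → b ≡ true → a ∨ b ≡ true
∨-introʳ a refl = ∨-zeroʳ a

∨-introˡ : ∀ {a b} → a ≡ true → a ∨ b ≡ true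
∨-introˡ refl = refl

∧-intro : ∀ {a b} → a ≡ true → b ≡ true → a ∧ b ≡ true
∧-intro refl refl = refl

not-true : ∀ {a} → not a ≡ true → a ≡ false
not-true {false} _ = refl

isZero-true : ∀ {k} → isZero k ≡ true → k ≡ 0
isZero-true {zero} _ = refl

T⇒≡ : ∀ {b} → T b → b ≡ true
T⇒≡ = Equivalence.to T-≡

≡⇒T : ∀ {b} → b ≡ true → T b
≡⇒T = Equivalence.from T-≡

-- Labelled forests

module _ {n : ℕ} where

  ==-true : ∀ {u w : Fin n} → u == w ≡ true → u ≡ w
  ==-true {u} {w} h with u Fin.≟ w
  ... | yes e = e

  ==-false : ∀ {u w : Fin n} → u == w ≡ false → u ≢ w
  ==-false {u} {w} h with u Fin.≟ w
  ... | no ne = ne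

  ==-refl : ∀ (u : Fin n) → u == u ≡ true
  ==-refl u with u Fin.≟ u
  ... | yes _ = refl
  ... | no ne = ⊥-elim (ne refl)

  ==-intro : ∀ {u w : Fin n} → u ≡ w → u == w ≡ true
  ==-intro {u} refl = ==-refl u

  ∈-vertices↓ : ∀ (u : Fin n) → u ∈ vertices↓
  ∈-vertices↓ u = reverse⁺ (∈-allFin u)

  Edge : Matrix → Fin n → Fin n → Set
  Edge e x y = e x y ≡ true

  merge-cases : ∀ u w (l : Labelling {n}) x →
                (l x ≡ l w × merge u w l x ≡ l u) ⊎ (l x ≢ l w × merge u w l x ≡ l x)
  merge-cases u w l x with l x Fin.≟ l w
  ... | yes h = inj₁ (h , refl)
  ... | no h  = inj₂ (h , refl)

  merge-cong : ∀ u w (l : Labelling {n}) {x y} → l x ≡ l y → merge u w l x ≡ merge u w l y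
  merge-cong u w l = cong (λ k → Bool.if k == l w then l u else k)

  merge-source : ∀ u w (l : Labelling {n}) → merge u w l u ≡ l u
  merge-source u w l with merge-cases u w l u
  ... | inj₁ (_ , h) = h
  ... | inj₂ (_ , h) = h

  merge-target : ∀ u w (l : Labelling {n}) → merge u w l w ≡ l u
  merge-target u w l with merge-cases u w l w
  ... | inj₁ (_ , h)  = h
  ... | inj₂ (ne , _) = ⊥-elim (ne refl)

  merge-same : ∀ u w (l : Labelling {n}) → merge u w l u ≡ merge u w l w
  merge-same u w l = trans (merge-source u w l) (sym (merge-target u w l))

  link-elim : ∀ u w e {x y : Fin n} → Edge (link u w e) x y → AddEdge (Edge e) u w x y
  link-elim u w e {x} {y} h with ∨-true (e x y) h
  ... | inj₁ h₁ = inj₁ h₁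
  ... | inj₂ h₁ with ∨-true (x == u ∧ y == w) h₁
  ...   | inj₁ h₂ = let a , b = ∧-true (x == u) h₂ in inj₂ (inj₁ (==-true a , ==-true b))
  ...   | inj₂ h₂ = let a , b = ∧-true (x == w) h₂ in inj₂ (inj₂ (==-true a , ==-true b))

  link-intro : ∀ u w e {x y : Fin n} → AddEdge (Edge e) u w x y → Edge (link u w e) x y
  link-intro u w e (inj₁ h) = ∨-introˡ h
  link-intro u w e (inj₂ (inj₁ (refl , refl))) =
    ∨-introʳ (e u w) (∨-introˡ (∧-intro (==-refl u) (==-refl w)))
  link-intro u w e (inj₂ (inj₂ (refl , refl))) =
    ∨-introʳ (e w u) (∨-introʳ (w == u ∧ u == w) (∧-intro (==-refl w) (==-refl u)))

  -- By `within` and `connects`, two vertices share a label exactly when the forest connects them;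
  -- `idempotent` makes the label a member of the component that it names.
  record IsForest (E : Fin n → Fin n → Set) (σ : Forest {n}) : Set where
    private
      l = proj₁ σ
      e = proj₂ σ
    field
      idempotent : ∀ x → l (l x) ≡ l x
      within     : ∀ {x y} → Edge e x y → l x ≡ l y
      symmetric  : ∀ {x y} → Edge e x y → Edge e y x
      edges      : ∀ {x y} → Edge e x y → E x y
      connects   : ∀ {x y} → l x ≡ l y → Star (Edge e) x y
      forestlike : Forestlike (Edge e)

  module _ {E : Fin n → Fin n → Set} where

    empty-forest : IsForest E (id , λ _ _ → false)
    empty-forest = record
      { idempotent = λ _ → refl
      ; within     = λ ()
      ; symmetric  = λ ()
      ; edges      = λ ()
      ; connects   = λ { refl → ε }
      ; forestlike = λ _ _ _ ()
      }

    weaken-forest : ∀ {E′ : Fin n → Fin n → Set} {σ} → (∀ {x y} → E x y → E′ x y) → IsForest E σ → IsForest E′ σ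
    weaken-forest f i = record
      { idempotent = idempotent ; within = within ; symmetric = symmetric
      ; edges = λ h → f (edges h) ; connects = connects ; forestlike = forestlike }
      where open IsForest i

    linked-forest : ∀ {u w l e} → E u w → E w u → l u ≢ l w → IsForest E (l , e) →
                    IsForest E (merge u w l , link u w e)
    linked-forest {u} {w} {l} {e} Euw Ewu ne i = record
      { idempotent = idem
      ; within     = λ h → within′ (elim h)
      ; symmetric  = λ h → intro (symmetric′ (elim h))
      ; edges      = λ h → edges′ (elim h)
      ; connects   = λ {x} {y} → connects′ x y
      ; forestlike = λ p un len h →
          forestlike-add l within ne forestlike (walk-map elim p) un len (elim h)
      }
      where
      open IsForest i

      elim : ∀ {x y} → Edge (link u w e) x y → AddEdge (Edge e) u w x y
      elim = link-elim u w e

      intro : ∀ {x y} → AddEdge (Edge e) u w x y → Edge (link u w e) x y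
      intro = link-intro u w e

      idem : ∀ x → merge u w l (merge u w l x) ≡ merge u w l x
      idem x with merge-cases u w l x
      ... | inj₁ (_ , h) = trans (cong (merge u w l) h)
                             (trans (trans (merge-cong u w l (idempotent u)) (merge-source u w l)) (sym h))
      ... | inj₂ (a , h) = trans (cong (merge u w l) h) (merge-cong u w l (idempotent x))

      within′ : ∀ {x y} → AddEdge (Edge e) u w x y → merge u w l x ≡ merge u w l y
      within′ (inj₁ h)                    = merge-cong u w l (within h)
      within′ (inj₂ (inj₁ (refl , refl))) = merge-same u w l
      within′ (inj₂ (inj₂ (refl , refl))) = sym (merge-same u w l)

      symmetric′ : ∀ {x y} → AddEdge (Edge e) u w x y → AddEdge (Edge e) u w y x
      symmetric′ (inj₁ h)                    = inj₁ (symmetric h)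
      symmetric′ (inj₂ (inj₁ (refl , refl))) = inj₂ (inj₂ (refl , refl))
      symmetric′ (inj₂ (inj₂ (refl , refl))) = inj₂ (inj₁ (refl , refl))

      edges′ : ∀ {x y} → AddEdge (Edge e) u w x y → E x y
      edges′ (inj₁ h)                    = edges h
      edges′ (inj₂ (inj₁ (refl , refl))) = Euw
      edges′ (inj₂ (inj₂ (refl , refl))) = Ewu

      old : ∀ {x y} → l x ≡ l y → Star (Edge (link u w e)) x y
      old h = Star.map (λ r → intro (inj₁ r)) (connects h)

      uw : Edge (link u w e) u w
      uw = intro (inj₂ (inj₁ (refl , refl)))

      wu : Edge (link u w e) w u
      wu = intro (inj₂ (inj₂ (refl , refl)))

      connects′ : ∀ x y → merge u w l x ≡ merge u w l y → Star (Edge (link u w e)) x y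
      connects′ x y h with merge-cases u w l x | merge-cases u w l y
      ... | inj₁ (a , _) | inj₁ (b , _) = old (trans a (sym b))
      ... | inj₁ (a , p) | inj₂ (b , q) = old a ◅◅ wu ◅ old (trans (sym p) (trans h q))
      ... | inj₂ (a , p) | inj₁ (b , q) = old (trans (sym p) (trans h q)) ◅◅ uw ◅ old (sym b)
      ... | inj₂ (a , p) | inj₂ (b , q) = old (trans (sym p) (trans h q))

    join-forest : ∀ {u w σ} → E u w → E w u → IsForest E σ → IsForest E (join u w σ)
    join-forest {u} {w} {l , e} Euw Ewu i =
      if-elim (IsForest E) (l u == l w) (λ _ → i) (λ h → linked-forest Euw Ewu (==-false h) i)

  _⊑_ : Labelling {n} → Labelling {n} → Set
  l ⊑ l′ = ∀ {x y} → l x ≡ l y → l′ x ≡ l′ y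

  join-⊑ : ∀ u w (σ : Forest {n}) → proj₁ σ ⊑ proj₁ (join u w σ)
  join-⊑ u w (l , e) = if-elim (λ τ → l ⊑ proj₁ τ) (l u == l w) (λ _ h → h) (λ _ → merge-cong u w l)

  join-joins : ∀ u w (σ : Forest {n}) → proj₁ (join u w σ) u ≡ proj₁ (join u w σ) w
  join-joins u w (l , e) = if-elim (λ (τ : Forest) → proj₁ τ u ≡ proj₁ τ w) (l u == l w) ==-true (λ _ → merge-same u w l)

  ClusterEdge : List (Cluster n) → Fin n → Fin n → Set
  ClusterEdge Γ x y = Any (λ γ → Adj (tree γ) x y) Γ

  clusterEdge-sym : ∀ {Γ x y} → ClusterEdge Γ x y → ClusterEdge Γ y x
  clusterEdge-sym = Any.map λ {γ} → subst T (Graph.sym (tree γ) _ _)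

  private
    step₁ : Cluster n → Fin n → Forest → Fin n → Forest
    step₁ γ u σ w = Bool.if Graph.adj (tree γ) u w then join u w σ else σ

    step₂ : Cluster n → Forest → Fin n → Forest
    step₂ γ σ u = foldl (step₁ γ u) σ vertices↓

    step₃ : Forest → Cluster n → Forest
    step₃ σ γ = foldl (step₂ γ) σ vertices↓

  clusterForest-induction :
    ∀ (I : Forest → Set) Γ →
    (∀ u w σ → ClusterEdge Γ u w → I σ → I (join u w σ)) → I (id , λ _ _ → false) →
    I (clusterForest Γ)
  clusterForest-induction I Γ h i = go Γ id i
    where
    go : ∀ Δ → (∀ {u w} → ClusterEdge Δ u w → ClusterEdge Γ u w) → ∀ {σ} → I σ → I (foldl step₃ σ Δ)
    go []      inc j = j
    go (γ ∷ Δ) inc j = go Δ (inc ∘ there)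
      (foldl-preserves I (λ σ u → foldl-preserves I (λ σ w k →
          if-elim I (Graph.adj (tree γ) u w) (λ a → h u w σ (inc (here (≡⇒T a))) k) (λ _ → k))
        vertices↓) vertices↓ j)

  clusterForest-isForest : ∀ Γ → IsForest (ClusterEdge Γ) (clusterForest Γ)
  clusterForest-isForest Γ = clusterForest-induction (IsForest (ClusterEdge Γ)) Γ
    (λ u w σ e i → join-forest e (clusterEdge-sym e) i) empty-forest

  clusterForest-joins : ∀ Γ {x y} → ClusterEdge Γ x y →
                        proj₁ (clusterForest Γ) x ≡ proj₁ (clusterForest Γ) y
  clusterForest-joins Γ {x} {y} = go Γ
    where
    Q : Forest → Set
    Q σ = proj₁ σ x ≡ proj₁ σ y

    Q-join : ∀ u w σ → Q σ → Q (join u w σ)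
    Q-join u w σ q = join-⊑ u w σ q

    Q₁ : ∀ γ u σ w → Q σ → Q (step₁ γ u σ w)
    Q₁ γ u σ w q = if-elim Q (Graph.adj (tree γ) u w) (λ _ → Q-join u w σ q) (λ _ → q)

    Q₂ : ∀ γ σ u → Q σ → Q (step₂ γ σ u)
    Q₂ γ σ u = foldl-preserves Q (Q₁ γ u) vertices↓

    Q₃ : ∀ σ γ → Q σ → Q (step₃ σ γ)
    Q₃ σ γ = foldl-preserves Q (Q₂ γ) vertices↓

    hit₁ : ∀ γ → Adj (tree γ) x y → ∀ σ → Q (step₁ γ x σ y)
    hit₁ γ a σ = if-elim Q (Graph.adj (tree γ) x y) (λ _ → join-joins x y σ)
                   (λ b → case trans (sym b) (T⇒≡ a) of λ ())

    go : ∀ Δ {σ} → ClusterEdge Δ x y → Q (foldl step₃ σ Δ)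
    go (γ ∷ Δ) {σ} (here a) = foldl-preserves Q Q₃ Δ
      (foldl-reaches (λ _ → ⊤) Q (λ _ _ _ → tt) (λ σ u _ → Q₂ γ σ u)
        (λ σ _ → foldl-reaches (λ _ → ⊤) Q (λ _ _ _ → tt) (λ σ w _ → Q₁ γ x σ w)
          (λ σ _ → hit₁ γ a σ) (∈-vertices↓ y) tt)
        (∈-vertices↓ x) {σ} tt)
    go (γ ∷ Δ) (there m) = go Δ m

-- Growth of states

module _ {n : ℕ} where

  labels : State {n} → Labelling {n}
  labels = proj₁ ∘ proj₁

  capacity : State {n} → Fin n → ℕ
  capacity = proj₂

  infix 4 _≼_
  _≼_ : State {n} → State {n} → Set
  σ ≼ τ = labels σ ⊑ labels τ × (∀ {x} → capacity σ x ≡ 0 → capacity τ x ≡ 0)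

  ≼-refl : ∀ {σ} → σ ≼ σ
  ≼-refl = id , id

  ≼-trans : ∀ {σ τ υ} → σ ≼ τ → τ ≼ υ → σ ≼ υ
  ≼-trans (f , g) (f′ , g′) = f′ ∘ f , g′ ∘ g

  -- For an edge, this says that it may be used by a path respecting (B, Λ): a vertex of capacity 0
  -- belongs to `B`, and equal labels mean a common member of Λ. All three alternatives persist
  -- under `≼`.
  Good : State {n} → Fin n → Fin n → Set
  Good σ u w = capacity σ u ≡ 0 ⊎ capacity σ w ≡ 0 ⊎ labels σ u ≡ labels σ w

  good-mono : ∀ {σ τ u w} → σ ≼ τ → Good σ u w → Good τ u w
  good-mono (f , g) (inj₁ h)        = inj₁ (g h)
  good-mono (f , g) (inj₂ (inj₁ h)) = inj₂ (inj₁ (g h))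
  good-mono (f , g) (inj₂ (inj₂ h)) = inj₂ (inj₂ (f h))

  good-sym : ∀ {σ u w} → Good σ u w → Good σ w u
  good-sym (inj₁ h)        = inj₂ (inj₁ h)
  good-sym (inj₂ (inj₁ h)) = inj₁ h
  good-sym (inj₂ (inj₂ h)) = inj₂ (inj₂ (sym h))

  joinCapped-elim : ∀ (I : State {n} → Set) u w l e c → I ((l , e) , c) →
    (isZero (c u) ≡ false → isZero (c w) ≡ false → l u ≢ l w →
     I ((merge u w l , link u w e) , spend u w c)) →
    I (joinCapped u w ((l , e) , c))
  joinCapped-elim I u w l e c i h =
    if-elim I (isZero (c u) ∨ isZero (c w) ∨ l u == l w) (λ _ → i) λ b →
      let a , b₁ = ∨-false (isZero (c u)) b
          b₂ , d = ∨-false (isZero (c w)) b₁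
      in h a b₂ (==-false d)

  spend-zero : ∀ u w (c : Fin n → ℕ) {x} → c x ≡ 0 → spend u w c x ≡ 0
  spend-zero u w c {x} h = if-elim (_≡ 0) (x == u ∨ x == w) (λ _ → cong pred h) (λ _ → h)

  joinCapped-≼ : ∀ u w σ → σ ≼ joinCapped u w σ
  joinCapped-≼ u w σ@((l , e) , c) = joinCapped-elim (σ ≼_) u w l e c (≼-refl {σ})
    (λ _ _ _ → merge-cong u w l , spend-zero u w c)

  joinCapped-good : ∀ u w σ → Good (joinCapped u w σ) u w
  joinCapped-good u w ((l , e) , c) =
    if-elim (λ τ → Good τ u w) (isZero (c u) ∨ isZero (c w) ∨ l u == l w)
      (λ b → case ∨-true (isZero (c u)) b of λ where
        (inj₁ h) → inj₁ (isZero-true h)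
        (inj₂ h) → case ∨-true (isZero (c w)) h of λ where
          (inj₁ h) → inj₂ (inj₁ (isZero-true h))
          (inj₂ h) → inj₂ (inj₂ (==-true h)))
      (λ _ → inj₂ (inj₂ (merge-same u w l)))

  foldl-or : ∀ (p : Fin n → Bool) xs {b} → foldl (λ b w → b ∨ p w) b xs ≡ true →
             b ≡ true ⊎ ∃[ w ] p w ≡ true
  foldl-or p []       h = inj₁ h
  foldl-or p (x ∷ xs) {b} h with foldl-or p xs h
  ... | inj₂ r = inj₂ r
  ... | inj₁ r with ∨-true b r
  ...   | inj₁ r′ = inj₁ r′
  ...   | inj₂ r′ = inj₂ (x , r′)

  or-foldl : ∀ (p : Fin n → Bool) {w} → p w ≡ true → ∀ {xs} → w ∈ xs → ∀ {b} →
             foldl (λ b w → b ∨ p w) b xs ≡ true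
  or-foldl p h m = foldl-reaches (λ _ → ⊤) (_≡ true) (λ _ _ _ → tt) (λ b a _ q → ∨-introˡ q)
                     (λ b _ → ∨-introʳ b h) m tt

  module SamplingProperties (adj : Matrix {n}) (inU : Fin n → Bool) (lab₀ : Labelling {n}) where

    open Sampling adj inU lab₀

    Near : Fin n → Fin n → Set
    Near u w = near u w ≡ true

    touches-elim : ∀ {u δ} → touches u δ ≡ true → ∃[ w ] (Near u w × lab₀ w ≡ δ)
    touches-elim {u} {δ} h with foldl-or (λ w → near u w ∧ lab₀ w == δ) vertices↓ h
    ... | inj₂ (w , r) = let a , b = ∧-true (near u w) r in w , a , ==-true b

    touches-intro : ∀ {u w δ} → Near u w → lab₀ w ≡ δ → touches u δ ≡ true
    touches-intro {u} {w} {δ} a b =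
      or-foldl (λ w → near u w ∧ lab₀ w == δ) (∧-intro a (==-intro b)) (∈-vertices↓ w)

    module _ (m r₁ r₂ r₃ : ℕ) where

      private
        SampledVertex : Fin n → Set
        SampledVertex u = sampledVertex m r₁ r₂ r₃ u ≡ true

        SampledTouches : Fin n → Fin n → Set
        SampledTouches δ u = sampledTouches m r₁ r₂ r₃ δ u ≡ true

      sampledVertex-inU : ∀ {u} → SampledVertex u → inU u ≡ true
      sampledVertex-inU {u} h = proj₁ (∧-true (inU u) h)

      joinAround-induction : ∀ (I : State → Set) δ →
        (∀ u w σ → SampledVertex u → Near u w → lab₀ w ≡ δ → I σ → I (joinCapped u w σ)) →
        ∀ σ → I σ → I (joinAround m r₁ r₂ r₃ δ σ)
      joinAround-induction I δ h σ = foldl-preserves I (λ σ u → foldl-preserves I (λ σ w i →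
        if-elim I (sampledVertex m r₁ r₂ r₃ u ∧ near u w ∧ lab₀ w == δ)
          (λ b → let a , b₁ = ∧-true (sampledVertex m r₁ r₂ r₃ u) b
                     b₂ , c = ∧-true (near u w) b₁
                 in h u w σ a b₂ (==-true c) i)
          (λ _ → i)) vertices↓) vertices↓

      joinAround-≼ : ∀ δ σ → σ ≼ joinAround m r₁ r₂ r₃ δ σ
      joinAround-≼ δ σ = joinAround-induction (σ ≼_) δ
        (λ u w τ _ _ _ h → ≼-trans {σ} {τ} {joinCapped u w τ} h (joinCapped-≼ u w τ)) σ (≼-refl {σ})

      visit-induction : ∀ (I : State → Set) δ →
        (∀ σ → I σ → I (joinAround m r₁ r₂ r₃ δ σ)) →
        ∀ π σ → I σ → I (proj₂ (visit m r₁ r₂ r₃ (π , σ) δ))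
      visit-induction I δ h π σ i = if-elim (I ∘ proj₂) (sampledCluster m r₁ r₂ r₃ δ)
        (λ _ → if-elim I (proj₂ (mergeAround m r₁ r₂ r₃ δ π)) (λ _ → h σ i) (λ _ → i)) (λ _ → i)

      sample-induction : ∀ (I : State → Set) →
        (∀ δ σ → I σ → I (joinAround m r₁ r₂ r₃ δ σ)) → ∀ σ → I σ → I (sample m r₁ r₂ r₃ σ)
      sample-induction I h σ = foldl-preserves (I ∘ proj₂)
        (λ (π , σ) δ → visit-induction I δ (h δ) π σ) vertices↓

      joinAround-good : ∀ {u w δ} σ → SampledVertex u → Near u w → lab₀ w ≡ δ →
                        Good (joinAround m r₁ r₂ r₃ δ σ) u w
      joinAround-good {u} {w} {δ} σ su nw e =
        foldl-reaches (λ _ → ⊤) Q (λ _ _ _ → tt)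
          (λ σ u _ → foldl-preserves Q (λ σ w → mono u w σ) vertices↓)
          (λ σ _ → foldl-reaches (λ _ → ⊤) Q (λ _ _ _ → tt) (λ σ w _ → mono u w σ)
            (λ σ _ → if-elim Q (sampledVertex m r₁ r₂ r₃ u ∧ near u w ∧ lab₀ w == δ)
              (λ _ → joinCapped-good u w σ)
              (λ b → case trans (sym b) (∧-intro su (∧-intro nw (==-intro e))) of λ ()))
            (∈-vertices↓ w) tt)
          (∈-vertices↓ u) tt
        where
        Q : State → Set
        Q σ = Good σ u w

        mono : ∀ v x σ → Q σ → Q (joinAt m r₁ r₂ r₃ δ v σ x)
        mono v x σ q = if-elim Q (sampledVertex m r₁ r₂ r₃ v ∧ near v x ∧ lab₀ x == δ)
          (λ _ → good-mono {σ} {joinCapped v x σ} {u} {w} (joinCapped-≼ v x σ) q) (λ _ → q)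

      mergeAround-induction : ∀ (I : Labelling × Bool → Set) δ →
        (∀ u u′ π b → SampledTouches δ u → SampledTouches δ u′ → π u ≢ π u′ → I (π , b) →
         I (merge u u′ π , true)) →
        ∀ π → I (π , false) → I (mergeAround m r₁ r₂ r₃ δ π)
      mergeAround-induction I δ h π =
        foldl-preserves I (λ p u → foldl-preserves I (λ (π , b) u′ i →
          if-elim I (sampledTouches m r₁ r₂ r₃ δ u ∧ sampledTouches m r₁ r₂ r₃ δ u′ ∧ not (π u == π u′))
            (λ c → let a , c₁ = ∧-true (sampledTouches m r₁ r₂ r₃ δ u) c
                       a′ , d = ∧-true (sampledTouches m r₁ r₂ r₃ δ u′) c₁
                   in h u u′ π b a a′ (==-false (not-true d)) i)
            (λ _ → i)) vertices↓) vertices↓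

      mergeAround-merges : ∀ {δ u u′} π → SampledTouches δ u → SampledTouches δ u′ →
        proj₁ (mergeAround m r₁ r₂ r₃ δ π) u ≡ proj₁ (mergeAround m r₁ r₂ r₃ δ π) u′
      mergeAround-merges {δ} {u} {u′} π a a′ =
        foldl-reaches (λ _ → ⊤) Q (λ _ _ _ → tt)
          (λ p v _ → foldl-preserves Q (mono v) vertices↓)
          (λ p _ → foldl-reaches (λ _ → ⊤) Q (λ _ _ _ → tt) (λ p v _ → mono u p v)
            (λ (π , b) _ → if-elim Q
              (sampledTouches m r₁ r₂ r₃ δ u ∧ sampledTouches m r₁ r₂ r₃ δ u′ ∧ not (π u == π u′))
              (λ _ → merge-same u u′ π)
              (λ c → differ π c)) (∈-vertices↓ u′) tt)
          (∈-vertices↓ u) {π , false} tt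
        where
        Q : Labelling × Bool → Set
        Q p = proj₁ p u ≡ proj₁ p u′

        mono : ∀ v p v′ → Q p → Q (mergeAt m r₁ r₂ r₃ δ v p v′)
        mono v (π , b) v′ q = if-elim Q
          (sampledTouches m r₁ r₂ r₃ δ v ∧ sampledTouches m r₁ r₂ r₃ δ v′ ∧ not (π v == π v′))
          (λ _ → merge-cong v v′ π q) (λ _ → q)

        differ : ∀ (π : Labelling) → sampledTouches m r₁ r₂ r₃ δ u ∧ sampledTouches m r₁ r₂ r₃ δ u′ ∧ not (π u == π u′) ≡ false →
                 π u ≡ π u′
        differ π c with π u Fin.≟ π u′
        ... | yes e = e
        ... | no _  = case trans (sym c) (∧-intro a (∧-intro a′ refl)) of λ ()

    samples-induction : ∀ (I : State → Set) →
      (∀ m r₁ r₂ r₃ σ → I σ → I (sample m r₁ r₂ r₃ σ)) → ∀ M σ → I σ → I (samples M σ)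
    samples-induction I h M σ =
      foldl-preserves I (λ σ m → foldl-preserves I (λ σ r₁ → foldl-preserves I (λ σ r₂ →
        foldl-preserves I (λ σ r₃ → h m r₁ r₂ r₃ σ) (downFrom M)) (downFrom M)) (downFrom M)) (downFrom M)

    samples-reach : ∀ (I Q : State → Set) →
      (∀ m r₁ r₂ r₃ σ → I σ → I (sample m r₁ r₂ r₃ σ)) →
      (∀ m r₁ r₂ r₃ σ → Q σ → Q (sample m r₁ r₂ r₃ σ)) →
      ∀ {M m r₁ r₂ r₃} → m ∈ downFrom M → r₁ ∈ downFrom M → r₂ ∈ downFrom M → r₃ ∈ downFrom M →
      (∀ σ → I σ → Q (sample m r₁ r₂ r₃ σ)) → ∀ σ → I σ → Q (samples M σ)
    samples-reach I Q hI hQ {M} {m} {r₁} {r₂} {r₃} mm m₁ m₂ m₃ h σ i =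
      foldl-reaches I Q (λ σ m → I₁ m σ) (λ σ m _ → Q₁ m σ) (λ σ i →
        foldl-reaches I Q (λ σ r₁ → I₂ m r₁ σ) (λ σ r₁ _ → Q₂ m r₁ σ) (λ σ i →
          foldl-reaches I Q (λ σ r₂ → I₃ m r₁ r₂ σ) (λ σ r₂ _ → Q₃ m r₁ r₂ σ) (λ σ i →
            foldl-reaches I Q (λ σ r₃ → hI m r₁ r₂ r₃ σ) (λ σ r₃ _ → hQ m r₁ r₂ r₃ σ) (λ σ i →
              h σ i) m₃ i) m₂ i) m₁ i) mm i
      where
      module Closed (J : State → Set) (hJ : ∀ m r₁ r₂ r₃ σ → J σ → J (sample m r₁ r₂ r₃ σ)) where
        J₃ : ∀ m r₁ r₂ σ → J σ → J (foldl (λ σ r₃ → sample m r₁ r₂ r₃ σ) σ (downFrom M))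
        J₃ m r₁ r₂ σ = foldl-preserves J (λ σ r₃ → hJ m r₁ r₂ r₃ σ) (downFrom M)
        J₂ : ∀ m r₁ σ → J σ → J (foldl (λ σ r₂ → foldl (λ σ r₃ → sample m r₁ r₂ r₃ σ) σ (downFrom M)) σ (downFrom M))
        J₂ m r₁ σ = foldl-preserves J (λ σ r₂ → J₃ m r₁ r₂ σ) (downFrom M)
        J₁ : ∀ m σ → J σ → J (foldl (λ σ r₁ → foldl (λ σ r₂ → foldl (λ σ r₃ → sample m r₁ r₂ r₃ σ) σ (downFrom M)) σ (downFrom M)) σ (downFrom M))
        J₁ m σ = foldl-preserves J (λ σ r₁ → J₂ m r₁ σ) (downFrom M)
      open Closed I hI renaming (J₁ to I₁; J₂ to I₂; J₃ to I₃)
      open Closed Q hQ renaming (J₁ to Q₁; J₂ to Q₂; J₃ to Q₃)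

  -- Sampling and connectivity

  module _ (G : Graph n) (F : Subset n) where

    -- In the final state, walks along this relation yield paths of G - F that respect (B, Λ); see
    -- `reach-respects`.
    record Step (σ : State {n}) (x y : Fin n) : Set where
      constructor step
      field
        source∉ : x Subset.∉ F
        target∉ : y Subset.∉ F
        adjacent : Adj G x y
        good     : Good σ x y

    Reach : State {n} → Fin n → Fin n → Set
    Reach σ = Star (Step σ)

    step-sym : ∀ {σ x y} → Step σ x y → Step σ y x
    step-sym {σ} {x} {y} (step a b c d) = step b a (subst T (Graph.sym G x y) c) (good-sym {σ} {x} {y} d)

    reach-sym : ∀ {σ x y} → Reach σ x y → Reach σ y x
    reach-sym = Star.reverse step-sym

    reach-mono : ∀ {σ τ} → σ ≼ τ → ∀ {x y} → Reach σ x y → Reach τ x y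
    reach-mono {σ} {τ} h = Star.map λ { {x} {y} (step a b c d) → step a b c (good-mono {σ} {τ} {x} {y} h d) }

    module _ (inU : Fin n → Bool) {lab₀ : Labelling {n}} {e₀ : Matrix {n}} (forest₀ : IsForest (Adj G) (lab₀ , e₀)) where

      open Sampling (Graph.adj G) inU lab₀
      open SamplingProperties (Graph.adj G) inU lab₀
      open IsForest forest₀

      reach-cluster : ∀ {σ} → lab₀ ⊑ labels σ → ∀ {x y} → (∀ {z} → lab₀ z ≡ lab₀ x → z Subset.∉ F) →
                      lab₀ x ≡ lab₀ y → Reach σ x y
      reach-cluster {σ} h {x} {y} free e = go free (connects e)
        where
        go : ∀ {x} → (∀ {z} → lab₀ z ≡ lab₀ x → z Subset.∉ F) → Star (Edge e₀) x y → Reach σ x y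
        go free ε       = ε
        go free (r ◅ p) = step (free refl) (free (sym (within r))) (edges r) (inj₂ (inj₂ (h (within r))))
                          ◅ go (λ q → free (trans q (sym (within r)))) p

      near-step : ∀ {σ u w} → Near u w → u Subset.∉ F → w Subset.∉ F → Good σ u w → Reach σ u w
      near-step {σ} {u} {w} h a b g with ∨-true (Graph.adj G u w) h
      ... | inj₁ k = step a b (≡⇒T k) g ◅ ε
      ... | inj₂ k with ==-true {u = u} {w} k
      ...   | refl = ε

      module _ {a b γ : Fin n} (m r₁ r₂ r₃ : ℕ) where

        private
          SV SC : Fin n → Set
          SV u = sampledVertex m r₁ r₂ r₃ u ≡ true
          SC δ = sampledCluster m r₁ r₂ r₃ δ ≡ true

        -- All neighbours in the cluster are covered, because the algorithm cannot know which of
        -- them `F` leaves usable.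
        Links : State → Set
        Links σ = (∀ {x} → Near a x → lab₀ x ≡ γ → Good σ a x)
                × (∀ {x} → Near b x → lab₀ x ≡ γ → Good σ b x)

        Goal : State → Set
        Goal σ = Links σ ⊎ Reach σ a b

        goal-mono : ∀ {σ τ} → σ ≼ τ → Goal σ → Goal τ
        goal-mono {σ} {τ} h (inj₁ (f , g)) =
          inj₁ ((λ {x} p q → good-mono {σ} {τ} {a} {x} h (f p q)) ,
                (λ {x} p q → good-mono {σ} {τ} {b} {x} h (g p q)))
        goal-mono {σ} {τ} h (inj₂ r) = inj₂ (reach-mono {σ} {τ} h r)

        module _ (sa : SV a) (sb : SV b) (sγ : SC γ)
                 (ta : touches a γ ≡ true) (tb : touches b γ ≡ true)
                 (freeV : ∀ {u} → SV u → u Subset.∉ F)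
                 (freeC : ∀ {δ} → SC δ → δ ≢ γ → ∀ {z} → lab₀ z ≡ δ → z Subset.∉ F) where

          private
            Sound : Labelling → State → Set
            Sound π σ = ∀ {u u′} → π u ≡ π u′ → Reach σ u u′

            -- The one sampled cluster that may meet `F` is `γ`, so only `γ` could make a merge in
            -- `π` unsound. But `π` changes at `γ` only if `γ` is kept, and then `Goal` holds from
            -- there on.
            Inv : Labelling × State → Set
            Inv (π , σ) = lab₀ ⊑ labels σ × (Goal σ ⊎ Sound π σ)

            sound-merge : ∀ {σ u u′ π} → Reach σ u u′ → Sound π σ → Sound (merge u u′ π) σ
            sound-merge {σ} {u} {u′} {π} r s {x} {y} h with merge-cases u u′ π x | merge-cases u u′ π y
            ... | inj₁ (p , _) | inj₁ (q , _) = s (trans p (sym q))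
            ... | inj₁ (p , e) | inj₂ (_ , f) = s p ◅◅ reach-sym {σ} r ◅◅ s (trans (sym e) (trans h f))
            ... | inj₂ (_ , e) | inj₁ (q , f) = s (trans (sym e) (trans h f)) ◅◅ r ◅◅ s (sym q)
            ... | inj₂ (_ , e) | inj₂ (_ , f) = s (trans (sym e) (trans h f))

            -- The cluster `δ` is disjoint from `F`, so the connection runs from `u` into `δ`,
            -- through the tree of `δ`, and out to `u′`.
            around : ∀ {δ u u′} σ → lab₀ ⊑ labels σ → SC δ → δ ≢ γ →
                     sampledTouches m r₁ r₂ r₃ δ u ≡ true → sampledTouches m r₁ r₂ r₃ δ u′ ≡ true →
                     Reach (joinAround m r₁ r₂ r₃ δ σ) u u′
            around {δ} {u} {u′} σ h sδ ne t t′ =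
              let su  , v  = ∧-true (sampledVertex m r₁ r₂ r₃ u) t
                  su′ , v′ = ∧-true (sampledVertex m r₁ r₂ r₃ u′) t′
                  w  , nw  , e  = touches-elim v
                  w′ , nw′ , e′ = touches-elim v′
                  τ = joinAround m r₁ r₂ r₃ δ σ
              in near-step {τ} nw (freeV su) (freeC sδ ne e) (joinAround-good m r₁ r₂ r₃ σ su nw e)
                 ◅◅ reach-cluster {τ} (λ q → proj₁ (joinAround-≼ m r₁ r₂ r₃ δ σ) (h q))
                      (λ q → freeC sδ ne (trans q e)) (trans e (sym e′))
                 ◅◅ reach-sym {τ} (near-step {τ} nw′ (freeV su′) (freeC sδ ne e′)
                      (joinAround-good m r₁ r₂ r₃ σ su′ nw′ e′))

            merged-sound : ∀ δ π σ → Sound π σ →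
              (∀ {u u′} → sampledTouches m r₁ r₂ r₃ δ u ≡ true → sampledTouches m r₁ r₂ r₃ δ u′ ≡ true → Reach σ u u′) →
              Sound (proj₁ (mergeAround m r₁ r₂ r₃ δ π)) σ
            merged-sound δ π σ s t = mergeAround-induction m r₁ r₂ r₃ (λ p → Sound (proj₁ p) σ) δ
              (λ u u′ π b a a′ _ i → sound-merge {σ} {u} {u′} {π} (t a a′) i) π s

            -- Any merge would have raised the flag, so the labelling is unchanged.
            unmerged-sound : ∀ δ π σ → Sound π σ → proj₂ (mergeAround m r₁ r₂ r₃ δ π) ≡ false →
                             Sound (proj₁ (mergeAround m r₁ r₂ r₃ δ π)) σ
            unmerged-sound δ π σ s = mergeAround-induction m r₁ r₂ r₃
              (λ p → proj₂ p ≡ false → Sound (proj₁ p) σ) δ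
              (λ _ _ _ _ _ _ _ _ ()) π (λ _ → s)

            visit-inv : ∀ p δ → Inv p → Inv (visit m r₁ r₂ r₃ p δ)
            visit-goal : ∀ p → Inv p → Goal (proj₂ (visit m r₁ r₂ r₃ p γ))

            visit-≼ : ∀ π σ δ → σ ≼ proj₂ (visit m r₁ r₂ r₃ (π , σ) δ)
            visit-≼ π σ δ = visit-induction m r₁ r₂ r₃ (σ ≼_) δ
              (λ τ h → ≼-trans {σ} {τ} {joinAround m r₁ r₂ r₃ δ τ} h (joinAround-≼ m r₁ r₂ r₃ δ τ)) π σ (≼-refl {σ})

            joinAround-links : ∀ σ → Links (joinAround m r₁ r₂ r₃ γ σ)
            joinAround-links σ = joinAround-good m r₁ r₂ r₃ σ sa , joinAround-good m r₁ r₂ r₃ σ sb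

            visit-inv (π , σ) δ (h , inj₁ g) =
              (λ q → proj₁ (visit-≼ π σ δ) (h q)) , inj₁ (goal-mono {σ} (visit-≼ π σ δ) g)
            visit-inv (π , σ) δ (h , inj₂ s) = if-elim Inv (sampledCluster m r₁ r₂ r₃ δ)
              (λ sδ → if-elim (λ τ → Inv (proj₁ (mergeAround m r₁ r₂ r₃ δ π) , τ))
                (proj₂ (mergeAround m r₁ r₂ r₃ δ π))
                (λ _ → (λ q → proj₁ (joinAround-≼ m r₁ r₂ r₃ δ σ) (h q)) , flagged sδ (δ Fin.≟ γ))
                (λ f → h , inj₂ (unmerged-sound δ π σ s f)))
              (λ _ → h , inj₂ s)
              where
              flagged : SC δ → Dec (δ ≡ γ) → Goal (joinAround m r₁ r₂ r₃ δ σ) ⊎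
                        Sound (proj₁ (mergeAround m r₁ r₂ r₃ δ π)) (joinAround m r₁ r₂ r₃ δ σ)
              flagged sδ (yes refl) = inj₁ (inj₁ (joinAround-links σ))
              flagged sδ (no ne)    = inj₂ (merged-sound δ π (joinAround m r₁ r₂ r₃ δ σ)
                (λ q → reach-mono {σ} (joinAround-≼ m r₁ r₂ r₃ δ σ) (s q)) (around σ h sδ ne))

            visit-goal (π , σ) (h , inj₁ g) = goal-mono {σ} (visit-≼ π σ γ) g
            visit-goal (π , σ) (h , inj₂ s) = if-elim (Goal ∘ proj₂) (sampledCluster m r₁ r₂ r₃ γ)
              (λ _ → if-elim Goal (proj₂ (mergeAround m r₁ r₂ r₃ γ π))
                (λ _ → inj₁ (joinAround-links σ))
                -- If `γ` is not kept, then `π` already identifies `a` and `b`, which both touch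
                -- `γ`; soundness of `π` connects them.
                (λ f → inj₂ (unmerged-sound γ π σ s f
                   (mergeAround-merges m r₁ r₂ r₃ π (∧-intro sa ta) (∧-intro sb tb)))))
              (λ f → case trans (sym f) sγ of λ ())

          sample-goal : ∀ σ → lab₀ ⊑ labels σ → Goal (sample m r₁ r₂ r₃ σ)
          sample-goal σ h = foldl-reaches Inv (Goal ∘ proj₂) visit-inv
            (λ (π , σ) δ _ → goal-mono {σ} (visit-≼ π σ δ)) visit-goal
            (∈-vertices↓ γ) {id , σ} (h , inj₂ (λ { refl → ε }))

-- Common multiples and residues

binom : ℕ → ℕ → ℕ
binom n       zero    = 1
binom zero    (suc k) = 0
binom (suc n) (suc k) = binom n k + binom n (suc k)

absorption : ∀ n k → suc k * binom (suc n) (suc k) ≡ suc n * binom n k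
absorption zero    zero    = refl
absorption zero    (suc k) = *-zeroʳ (2 + k)
absorption (suc n) zero    = begin
  1 * (1 + binom (suc n) 1)   ≡⟨ *-identityˡ _ ⟩
  1 + binom (suc n) 1         ≡⟨ cong suc (sym (*-identityˡ _)) ⟩
  1 + 1 * binom (suc n) 1     ≡⟨ cong suc (absorption n zero) ⟩
  1 + suc n * 1               ∎
  where open ≡-Reasoning
absorption (suc n) (suc k) = begin
  suc (suc k) * (b + c)             ≡⟨ solve 3 (λ k b c → (con 2 :+ k) :* (b :+ c) :=
                                         b :+ (con 1 :+ k) :* b :+ (con 2 :+ k) :* c) refl k b c ⟩
  b + suc k * b + suc (suc k) * c   ≡⟨ cong₂ (λ x y → b + x + y) (absorption n k) (absorption n (suc k)) ⟩
  b + suc n * binom n k + suc n * binom n (suc k)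
                                    ≡⟨ solve 3 (λ n x y → (x :+ y) :+ (con 1 :+ n) :* x :+ (con 1 :+ n) :* y :=
                                         (con 2 :+ n) :* (x :+ y)) refl n (binom n k) (binom n (suc k)) ⟩
  suc (suc n) * b                   ∎
  where
  open ≡-Reasoning
  b = binom (suc n) (suc k)
  c = binom (suc n) (suc (suc k))

-- The difference n + 1 - k has the name `q` in order to avoid truncated subtraction. Adding
-- `absorption` to the claim turns it into Pascal's rule.
co-absorption : ∀ {n q} k → q + k ≡ suc n → q * binom (suc n) k ≡ suc n * binom n k
co-absorption {n} {q} zero h = cong (_* 1) (trans (sym (+-identityʳ q)) h)
co-absorption {n} {q} (suc k) h = +-cancelˡ-≡ (suc k * b) _ _ (begin
  suc k * b + q * b                          ≡⟨ sym (*-distribʳ-+ b (suc k) q) ⟩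
  (suc k + q) * b                            ≡⟨ cong (_* b) (trans (+-comm (suc k) q) h) ⟩
  suc n * (binom n k + binom n (suc k))      ≡⟨ *-distribˡ-+ (suc n) (binom n k) _ ⟩
  suc n * binom n k + suc n * binom n (suc k) ≡⟨ cong (_+ suc n * binom n (suc k)) (sym (absorption n k)) ⟩
  suc k * b + suc n * binom n (suc k)        ∎)
  where
  open ≡-Reasoning
  b = binom (suc n) (suc k)

-- Leibniz' harmonic triangle: the numbers (n+1) * binom n k satisfy
-- 1/X = 1/A - 1/B for X its entry at (n+1, k+1), A at (n, k) and B at (n+1, k).
leibniz∣ : ∀ n {D} → (∀ {j} → j ≤ n → suc j ∣ D) → ∀ k → k ≤ n → suc n * binom n k ∣ D
leibniz∣ n {D} h zero k≤n = subst (_∣ D) (sym (*-identityʳ (suc n))) (h ≤-refl)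
leibniz∣ (suc n) {D} h (suc k) (s≤s k≤n)
  with leibniz∣ n (λ j≤n → h (m≤n⇒m≤1+n j≤n)) k k≤n | leibniz∣ (suc n) h k (m≤n⇒m≤1+n k≤n)
... | divides x D≡xA | divides y D≡yB = ∣m+n∣m⇒∣n (subst (X ∣_) (trans Xx≡D+Xy (+-comm D (X * y))) (m∣m*n x)) (m∣m*n y)
  where
  open ≡-Reasoning
  q = suc n ∸ k
  q+k : q + k ≡ suc n
  q+k = m∸n+n≡m (m≤n⇒m≤1+n k≤n)
  A = suc n * binom n k
  B = suc (suc n) * binom (suc n) k
  X = suc (suc n) * binom (suc n) (suc k)

  X-A : suc k * X ≡ suc (suc n) * A
  X-A = begin
    suc k * (suc (suc n) * b)  ≡⟨ solve 3 (λ k n b → k :* (n :* b) := n :* (k :* b)) refl (suc k) (suc (suc n)) b ⟩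
    suc (suc n) * (suc k * b)  ≡⟨ cong (suc (suc n) *_) (absorption n k) ⟩
    suc (suc n) * A            ∎
    where b = binom (suc n) (suc k)

  B-A : q * B ≡ suc (suc n) * A
  B-A = begin
    q * (suc (suc n) * b)      ≡⟨ solve 3 (λ k n b → k :* (n :* b) := n :* (k :* b)) refl q (suc (suc n)) b ⟩
    suc (suc n) * (q * b)      ≡⟨ cong (suc (suc n) *_) (co-absorption k q+k) ⟩
    suc (suc n) * A            ∎
    where b = binom (suc n) k

  Xx≡D+Xy : X * x ≡ D + X * y
  Xx≡D+Xy = *-cancelˡ-≡ _ _ (suc k) (begin
    suc k * (X * x)              ≡⟨ sym (*-assoc (suc k) X x) ⟩
    suc k * X * x                ≡⟨ cong (_* x) X-A ⟩
    suc (suc n) * A * x          ≡⟨ *-assoc (suc (suc n)) A x ⟩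
    suc (suc n) * (A * x)        ≡⟨ cong (suc (suc n) *_) (trans (*-comm A x) (sym D≡xA)) ⟩
    suc (suc n) * D              ≡⟨ cong (λ z → suc z * D) (sym q+k) ⟩
    suc (q + k) * D              ≡⟨ solve 3 (λ q k D → (con 1 :+ (q :+ k)) :* D := (con 1 :+ k) :* D :+ q :* D) refl q k D ⟩
    suc k * D + q * D            ≡⟨ cong (λ z → suc k * D + q * z) D≡yB ⟩
    suc k * D + q * (y * B)      ≡⟨ cong (suc k * D +_) (solve 3 (λ q y B → q :* (y :* B) := q :* B :* y) refl q y B) ⟩
    suc k * D + q * B * y        ≡⟨ cong (λ z → suc k * D + z * y) (trans B-A (sym X-A)) ⟩
    suc k * D + suc k * X * y    ≡⟨ solve 4 (λ k D X y → k :* D :+ k :* X :* y := k :* (D :+ X :* y)) refl (suc k) D X y ⟩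
    suc k * (D + X * y)          ∎)

rowSum : ℕ → ℕ → ℕ
rowSum n zero    = 0
rowSum n (suc j) = rowSum n j + binom n j

rowSum-suc : ∀ n j → rowSum (suc n) (suc j) ≡ rowSum n (suc j) + rowSum n j
rowSum-suc n zero    = refl
rowSum-suc n (suc j) = trans (cong (_+ (binom n j + binom n (suc j))) (rowSum-suc n j))
  (solve 4 (λ r s b c → r :+ b :+ s :+ (b :+ c) := r :+ b :+ c :+ (s :+ b)) refl
     (rowSum n j) (rowSum n j) (binom n j) (binom n (suc j)))

binom-zero : ∀ n k → n < k → binom n k ≡ 0
binom-zero zero    (suc k) _       = refl
binom-zero (suc n) (suc k) (s≤s h) = cong₂ _+_ (binom-zero n k h) (binom-zero n (suc k) (m<n⇒m<1+n h))

rowSum-full : ∀ n → rowSum n (suc n) ≡ 2 ^ n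
rowSum-full zero    = refl
rowSum-full (suc n) = begin
  rowSum (suc n) (suc (suc n))                      ≡⟨ rowSum-suc n (suc n) ⟩
  rowSum n (suc n) + binom n (suc n) + rowSum n (suc n)
    ≡⟨ cong (λ z → rowSum n (suc n) + z + rowSum n (suc n)) (binom-zero n (suc n) ≤-refl) ⟩
  rowSum n (suc n) + 0 + rowSum n (suc n)           ≡⟨ cong (λ z → z + 0 + z) (rowSum-full n) ⟩
  2 ^ n + 0 + 2 ^ n                                 ≡⟨ cong (_+ 2 ^ n) (+-identityʳ (2 ^ n)) ⟩
  2 ^ n + 2 ^ n                                     ≡⟨ cong (2 ^ n +_) (sym (+-identityʳ (2 ^ n))) ⟩
  2 ^ suc n                                         ∎
  where open ≡-Reasoning

-- Each of the n + 1 numbers (n + 1) C(n, k) divides `D` and so is at most `D`, while their sum is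
-- (n + 1) 2ⁿ.
common-multiple-≥ : ∀ n {D} → 1 ≤ D → (∀ {j} → j ≤ n → suc j ∣ D) → 2 ^ n ≤ D
common-multiple-≥ n {D@(suc _)} _ h = *-cancelˡ-≤ (suc n) (begin
  suc n * 2 ^ n             ≡⟨ cong (suc n *_) (sym (rowSum-full n)) ⟩
  suc n * rowSum n (suc n)  ≤⟨ go (suc n) ≤-refl ⟩
  suc n * D                 ∎)
  where
  open ≤-Reasoning
  go : ∀ j → j ≤ suc n → suc n * rowSum n j ≤ j * D
  go zero    _       = ≤-reflexive (*-zeroʳ (suc n))
  go (suc j) (s≤s l) = begin
    suc n * (rowSum n j + binom n j)           ≡⟨ *-distribˡ-+ (suc n) (rowSum n j) _ ⟩
    suc n * rowSum n j + suc n * binom n j     ≤⟨ +-mono-≤ (go j (m≤n⇒m≤1+n l)) (∣⇒≤ (leibniz∣ n h j l)) ⟩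
    j * D + D                                  ≡⟨ +-comm (j * D) D ⟩
    suc j * D                                  ∎

-- The product of the given numbers is too small to be divisible by all of 1, …, M.
avoiding-modulus : ∀ L ds → All (λ d → 1 ≤ d × d ≤ 2 ^ L) ds → ∀ {M} → 2 + length ds * L ≤ M →
                   ∃[ m ] (m < M × All (λ d → ¬ suc m ∣ d) ds)
avoiding-modulus L ds bs {suc M} (s≤s large)
  with anyUpTo? (λ m → All.all? (λ d → ¬? (suc m ∣? d)) ds) (suc M)
... | yes found = found
... | no none   = ⊥-elim (<-irrefl refl (begin-strict
    2 ^ (length ds * L)    <⟨ ^-monoʳ-< 2 (s≤s (s≤s z≤n)) large ⟩
    2 ^ M                  ≤⟨ common-multiple-≥ M (proj₁ (product-bounds ds bs)) (λ j≤M → divides-product ds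
                                (Any.map (λ {d} nn → decidable-stable (suc _ ∣? d) nn)
                                  (AllP.¬All⇒Any¬ (λ d → ¬? (suc _ ∣? d)) ds (λ a → none (_ , s≤s j≤M , a))))) ⟩
    product ds             ≤⟨ proj₂ (product-bounds ds bs) ⟩
    2 ^ (length ds * L)    ∎))
  where
  open ≤-Reasoning
  product-bounds : ∀ ds → All (λ d → 1 ≤ d × d ≤ 2 ^ L) ds → 1 ≤ product ds × product ds ≤ 2 ^ (length ds * L)
  product-bounds []       []             = ≤-refl , ≤-refl
  product-bounds (d ∷ ds) ((a , b) ∷ bs) =
    let a′ , b′ = product-bounds ds bs
    in *-mono-≤ a a′ , ≤-trans (*-mono-≤ b b′) (≤-reflexive (sym (^-distribˡ-+-* 2 L (length ds * L))))

  divides-product : ∀ {j} ds → Any (j ∣_) ds → j ∣ product ds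
  divides-product (d ∷ ds) (here h)  = ∣m⇒∣m*n (product ds) h
  divides-product (d ∷ ds) (there h) = ∣n⇒∣m*n d (divides-product ds h)

next-≤ : ∀ m c → c ≤ m → next m c ≤ m
next-≤ m zero    _ = ≤-refl
next-≤ m (suc c) h = <⇒≤ h

cyc-≤ : ∀ m k → cyc m k ≤ m
cyc-≤ m zero    = z≤n
cyc-≤ m (suc k) = next-≤ m (cyc m k) (cyc-≤ m k)

cyc-multiple : ∀ m k → ∃[ q ] k + cyc m k ≡ q * suc m
cyc-multiple m zero = 0 , refl
cyc-multiple m (suc k) with cyc m k | cyc-multiple m k
... | zero  | q , h = suc q , (begin
  suc k + m             ≡⟨ sym (+-suc k m) ⟩
  k + suc m             ≡⟨ cong (_+ suc m) (trans (sym (+-identityʳ k)) h) ⟩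
  q * suc m + suc m     ≡⟨ +-comm (q * suc m) (suc m) ⟩
  suc q * suc m         ∎)
  where open ≡-Reasoning
... | suc c | q , h = q , trans (sym (+-suc k c)) h

-- Adding the common value of `cyc` to both numbers makes them multiples of `suc m` without changing
-- their distance.
cyc-≡⇒∣ : ∀ m a b → cyc m a ≡ cyc m b → suc m ∣ ∣ a - b ∣
cyc-≡⇒∣ m a b e with cyc-multiple m a | cyc-multiple m b
... | q , h | q′ , h′ = divides ∣ q - q′ ∣ (begin
  ∣ a - b ∣                          ≡⟨ sym (∣m+n-m+o∣≡∣n-o∣ c a b) ⟩
  ∣ c + a - c + b ∣                  ≡⟨ cong₂ ∣_-_∣ (trans (+-comm c a) h) (trans (+-comm c b) (trans (cong (b +_) e) h′)) ⟩
  ∣ q * suc m - q′ * suc m ∣         ≡⟨ sym (*-distribʳ-∣-∣ (suc m) q q′) ⟩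
  ∣ q - q′ ∣ * suc m                 ∎)
  where
  open ≡-Reasoning
  c = cyc m a

-- Binary logarithm by repeated doubling

double : ℕ → ℕ × ℕ → ℕ × ℕ
double n (p , L) = Bool.if isZero (n ∸ p) then (p , L) else (p + p , suc L)

doublings : ℕ → ℕ × ℕ
doublings n = foldl (λ s (_ : ⊤) → double n s) (1 , 0) (replicate n tt)

log↑ : ℕ → ℕ
log↑ n = proj₂ (doublings n)

private
  -- The second part says that the last doubling started below `n`; this is what bounds `L` from
  -- above.
  Powers : ℕ → ℕ × ℕ → Set
  Powers n (p , L) = p ≡ 2 ^ L × (L ≡ 0 ⊎ 2 ^ pred L < n)

  double-powers : ∀ n s → Powers n s → Powers n (double n s)
  double-powers n (p , L) (h , b) = if-elim (Powers n) (isZero (n ∸ p)) (λ _ → h , b)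
    (λ z → trans (cong₂ _+_ h h) (cong (2 ^ L +_) (sym (+-identityʳ (2 ^ L)))) ,
           inj₂ (subst (_< n) h (≰⇒> λ n≤p → case trans (sym z) (cong isZero (m≤n⇒m∸n≡0 n≤p)) of λ ())))

  doublings-powers : ∀ n → Powers n (doublings n)
  doublings-powers n = foldl-preserves (Powers n) (λ s _ → double-powers n s) (replicate n tt) (refl , inj₁ refl)

  -- Doubling a positive number adds at least 1, so that n rounds suffice to reach n.
  grows : ∀ n (xs : List ⊤) s → 1 ≤ proj₁ s →
          length xs + proj₁ s ≤ proj₁ (foldl (λ s _ → double n s) s xs) ⊎ n ≤ proj₁ (foldl (λ s _ → double n s) s xs)
  grows n []       s       _ = inj₁ ≤-refl
  grows n (x ∷ xs) (p , L) h with isZero (n ∸ p) in z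
  ... | true  = inj₂ (foldl-preserves (λ s → n ≤ proj₁ s)
    (λ (p , L) _ i → if-elim (λ s → n ≤ proj₁ s) (isZero (n ∸ p)) (λ _ → i) (λ _ → ≤-trans i (m≤m+n p p)))
    xs (m∸n≡0⇒m≤n (isZero-true z)))
  ... | false with grows n xs (p + p , suc L) (≤-trans h (m≤m+n p p))
  ...   | inj₂ r = inj₂ r
  ...   | inj₁ r = inj₁ (≤-trans (≤-trans (≤-reflexive (sym (+-suc (length xs) p)))
                      (+-monoʳ-≤ (length xs) (+-monoˡ-≤ p h))) r)

n≤2^log↑ : ∀ n → n ≤ 2 ^ log↑ n
n≤2^log↑ n = ≤-trans (case grows n (replicate n tt) (1 , 0) ≤-refl of λ where
    (inj₁ h) → ≤-trans (≤-trans (≤-reflexive (sym (length-replicate n))) (m≤m+n _ 1)) h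
    (inj₂ h) → h) (≤-reflexive (proj₁ (doublings-powers n)))

log↑≤ : ∀ n → 2 ≤ n → log↑ n ≤ 2 * ⌈log₂ n ⌉
log↑≤ n 2≤n with proj₂ (doublings-powers n)
... | inj₁ h = ≤-trans (≤-reflexive h) z≤n
... | inj₂ h = begin
  log↑ n                      ≤⟨ suc-pred-≤ (log↑ n) ⟩
  suc (pred (log↑ n))         ≡⟨ cong suc (sym (⌈log₂2^n⌉≡n (pred (log↑ n)))) ⟩
  -- The 1 is read as ⌈log₂ 2⌉, which n ≥ 2 allows to be absorbed; hence the factor 2.
  1 + ⌈log₂ 2 ^ pred (log↑ n) ⌉ ≤⟨ +-mono-≤ (⌈log₂⌉-mono-≤ 2≤n) (⌈log₂⌉-mono-≤ (<⇒≤ h)) ⟩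
  ⌈log₂ n ⌉ + ⌈log₂ n ⌉       ≡⟨ cong (⌈log₂ n ⌉ +_) (sym (+-identityʳ ⌈log₂ n ⌉)) ⟩
  2 * ⌈log₂ n ⌉               ∎
  where
  open ≤-Reasoning
  suc-pred-≤ : ∀ k → k ≤ suc (pred k)
  suc-pred-≤ zero    = z≤n
  suc-pred-≤ (suc k) = ≤-refl

log↑≤n : ∀ n → log↑ n ≤ n
log↑≤n n = ≤-trans (foldl-counts (λ X s → proj₂ s ≤ X) 1
  (λ X (p , L) _ h → if-elim (λ s → proj₂ s ≤ suc X) (isZero (n ∸ p)) (λ _ → m≤n⇒m≤1+n h) (λ _ → s≤s h))
  (replicate n tt) {0} {1 , 0} z≤n)
  (≤-reflexive (trans (+-identityʳ _) (trans (*-identityʳ _) (length-replicate n))))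

-- Moduli that separate vertices and clusters from the failed ones

∈-tabulate⁺ : ∀ {n} {f : Fin n → Bool} {x} → f x ≡ true → x Subset.∈ tabulate f
∈-tabulate⁺ {f = f} {x} h = lookup⇒[]= x (tabulate f) (trans (lookup∘tabulate f x) h)

∈-tabulate⁻ : ∀ {n} {f : Fin n → Bool} {x} → x Subset.∈ tabulate f → f x ≡ true
∈-tabulate⁻ {f = f} {x} h = trans (sym (lookup∘tabulate f x)) ([]=⇒lookup h)

elements : ∀ {n} → Subset n → List (Fin n)
elements []            = []
elements (true  ∷ p) = zero ∷ map suc (elements p)
elements (false ∷ p) = map suc (elements p)

length-elements : ∀ {n} (p : Subset n) → length (elements p) ≡ ∣ p ∣
length-elements []            = refl
length-elements (true  ∷ p) = cong suc (trans (length-map suc (elements p)) (length-elements p))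
length-elements (false ∷ p) = trans (length-map suc (elements p)) (length-elements p)

∈-elements⁺ : ∀ {n} {p : Subset n} {x} → x Subset.∈ p → x ∈ elements p
∈-elements⁺ {p = true  ∷ p} Vec.here      = here refl
∈-elements⁺ {p = true  ∷ p} (Vec.there h) = there (∈-map⁺ suc (∈-elements⁺ h))
∈-elements⁺ {p = false ∷ p} (Vec.there h) = ∈-map⁺ suc (∈-elements⁺ h)

∈-elements⁻ : ∀ {n} (p : Subset n) → All (Subset._∈ p) (elements p)
∈-elements⁻ []            = []
∈-elements⁻ (true  ∷ p) = Vec.here ∷ AllP.map⁺ (All.map Vec.there (∈-elements⁻ p))
∈-elements⁻ (false ∷ p) = AllP.map⁺ (All.map Vec.there (∈-elements⁻ p))

distance : ∀ {n} → Fin n → Fin n → ℕ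
distance x y = ∣ toℕ x - toℕ y ∣

distance-pos : ∀ {n} {x y : Fin n} → x ≢ y → 1 ≤ distance x y
distance-pos ne = n≢0⇒n>0 λ h → ne (toℕ-injective (∣m-n∣≡0⇒m≡n h))

distance≤ : ∀ {n} (x y : Fin n) → distance x y ≤ n
distance≤ x y = ≤-trans (∣m-n∣≤m⊔n (toℕ x) (toℕ y)) (⊔-lub (<⇒≤ (toℕ<n x)) (<⇒≤ (toℕ<n y)))

module _ {n : ℕ} where

  -- This is `avoiding-modulus` for three distances per failed vertex: from it to `a`, from it to
  -- `b`, and from its cluster label to `γ`. Distances are at most n, hence at most 2 ^ L.
  separating-modulus : ∀ {L} → n ≤ 2 ^ L → (lab₀ : Labelling {n}) (F : Subset n) {a b : Fin n} (γ : Fin n) →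
    a Subset.∉ F → b Subset.∉ F → ∀ {M} → 2 + ∣ F ∣ * 3 * L ≤ M → ∃[ m ] (m < M
    × (∀ {z} → z Subset.∈ F → cyc m (toℕ z) ≢ cyc m (toℕ a))
    × (∀ {z} → z Subset.∈ F → cyc m (toℕ z) ≢ cyc m (toℕ b))
    × (∀ {z} → z Subset.∈ F → lab₀ z ≢ γ → cyc m (toℕ (lab₀ z)) ≢ cyc m (toℕ γ)))
  separating-modulus {L} n≤ lab₀ F {a} {b} γ a∉ b∉ {M} large =
    let m , m<M , av = avoiding-modulus L (distances (elements F)) (bounds (∈-elements⁻ F))
                         (subst (λ k → 2 + k * L ≤ M) (sym (trans (length-distances (elements F))
                           (cong (_* 3) (length-elements F)))) large)
    in m , m<M
       , (λ {z} z∈F e → proj₁ (avoided (elements F) av (∈-elements⁺ z∈F)) (cyc-≡⇒∣ m (toℕ z) (toℕ a) e))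
       , (λ {z} z∈F e → proj₁ (proj₂ (avoided (elements F) av (∈-elements⁺ z∈F))) (cyc-≡⇒∣ m (toℕ z) (toℕ b) e))
       , (λ {z} z∈F ne e → proj₂ (proj₂ (avoided (elements F) av (∈-elements⁺ z∈F))) ne (cyc-≡⇒∣ m (toℕ (lab₀ z)) (toℕ γ) e))
    where
    clusterDistance : Fin n → ℕ
    -- A failed vertex inside the cluster `γ` imposes no condition here. The default 1 respects the
    -- required bounds and rules out only the modulus 1, which the other distances of `z` exclude
    -- anyway.
    clusterDistance z = Bool.if lab₀ z == γ then 1 else distance (lab₀ z) γ

    distances : List (Fin n) → List ℕ
    distances []       = []
    distances (z ∷ zs) = distance z a ∷ distance z b ∷ clusterDistance z ∷ distances zs

    length-distances : ∀ zs → length (distances zs) ≡ length zs * 3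
    length-distances []       = refl
    length-distances (z ∷ zs) = cong (3 +_) (length-distances zs)

    clusterDistance-bounds : ∀ z → 1 ≤ clusterDistance z × clusterDistance z ≤ 2 ^ L
    clusterDistance-bounds z = if-elim (λ d → 1 ≤ d × d ≤ 2 ^ L) (lab₀ z == γ)
      (λ _ → ≤-refl , m^n>0 2 L)
      (λ h → distance-pos {x = lab₀ z} {γ} (==-false h) , ≤-trans (distance≤ (lab₀ z) γ) n≤)

    ∈∉⇒≢ : ∀ {z y} → z Subset.∈ F → y Subset.∉ F → z ≢ y
    ∈∉⇒≢ h k refl = k h

    bounds : ∀ {zs} → All (Subset._∈ F) zs → All (λ d → 1 ≤ d × d ≤ 2 ^ L) (distances zs)
    bounds []            = []
    bounds {z ∷ _} (h ∷ hs) = (distance-pos (∈∉⇒≢ h a∉) , ≤-trans (distance≤ z a) n≤)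
                            ∷ (distance-pos (∈∉⇒≢ h b∉) , ≤-trans (distance≤ z b) n≤)
                            ∷ clusterDistance-bounds z ∷ bounds hs

    avoided : ∀ {m} zs → All (λ d → suc m ∤ d) (distances zs) → ∀ {z} → z ∈ zs →
      suc m ∤ distance z a × suc m ∤ distance z b × (lab₀ z ≢ γ → suc m ∤ distance (lab₀ z) γ)
    avoided (z ∷ zs) (p ∷ q ∷ r ∷ _) (here refl) = p , q ,
      λ ne → if-elim (λ d → _ ∤ d → _ ∤ distance (lab₀ z) γ) (lab₀ z == γ)
               (λ h → ⊥-elim (ne (==-true h))) (λ _ → id) r
    avoided (z ∷ zs) (_ ∷ _ ∷ _ ∷ av) (there h) = avoided zs av h

  -- Paths

  module _ {R : Fin n → Fin n → Set} where

    private
      suffix : ∀ {x y z P} → x ∈ P → Walk R y z P → Unique P → ∃[ P′ ] (Walk R x z P′ × Unique P′)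
      suffix (here refl) [-]     u       = _ , [-] , u
      suffix (here refl) (r ∷ w) u       = _ , r ∷ w , u
      suffix (there m)   (r ∷ w) (_ ∷ u) = suffix m w u

    simple-walk : ∀ {x y} → Star R x y → ∃[ P ] (Walk R x y P × Unique P)
    simple-walk ε = _ , [-] , [] ∷ []
    simple-walk {x} (r ◅ s) with simple-walk s
    ... | P , w , u with Any.any? (x Fin.≟_) P
    ...   | yes m = suffix m w u
    ...   | no h  = x ∷ P , r ∷ w , AllP.¬Any⇒All¬ P h ∷ u

    walk-head : ∀ {x y P} → Walk R x y P → head P ≡ just x
    walk-head [-]     = refl
    walk-head (_ ∷ _) = refl

    walk-last : ∀ {x y P} → Walk R x y P → last P ≡ just y
    walk-last [-]               = refl
    walk-last (_ ∷ [-])         = refl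
    walk-last (_ ∷ w@(_ ∷ _))   = walk-last w

    walk-linked : ∀ {x y P} → Walk R x y P → Linked R P
    walk-linked [-]             = [-]
    walk-linked (r ∷ [-])       = r ∷ [-]
    walk-linked (r ∷ w@(_ ∷ _)) = r ∷ walk-linked w

    linked-walk : ∀ {x y} P → head P ≡ just x → last P ≡ just y → Linked R P → Walk R x y P
    linked-walk (x ∷ [])     refl refl [-]     = [-]
    linked-walk (x ∷ y ∷ P) refl h    (r ∷ l) = r ∷ linked-walk (y ∷ P) refl h l

    walk-star : ∀ {x y P} → Walk R x y P → Star R x y
    walk-star [-]     = ε
    walk-star (r ∷ w) = r ◅ walk-star w

    linked-suffix : ∀ xs {ys} → Linked R (xs ++ ys) → Linked R ys
    linked-suffix []           l       = l
    linked-suffix (x ∷ [])     [-]     = []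
    linked-suffix (x ∷ [])     (_ ∷ l) = l
    linked-suffix (x ∷ y ∷ xs) (_ ∷ l) = linked-suffix (y ∷ xs) l

    linked-prefix : ∀ xs {ys} → Linked R (xs ++ ys) → Linked R xs
    linked-prefix []           l       = []
    linked-prefix (x ∷ [])     l       = [-]
    linked-prefix (x ∷ y ∷ xs) (r ∷ l) = r ∷ linked-prefix (y ∷ xs) l

    -- Keeping `Linked R` besides the path preserves more than adjacency: `reach-respects` needs
    -- that consecutive vertices are good pairs.
    star-path : ∀ (G : Graph n) {S : Subset n} → (∀ {x y} → R x y → Adj G x y × x Subset.∈ S × y Subset.∈ S) →
                ∀ {x y} → x Subset.∈ S → Star R x y →
                ∃[ P ] (IsPath G S x y P × Linked R P)
    star-path G {S} h {x} x∈S s with simple-walk s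
    ... | P , w , u = P , record
      { first    = walk-head w
      ; final    = walk-last w
      ; adjacent = Linked.map (proj₁ ∘ h) (walk-linked w)
      ; simple   = u
      ; inside   = all-inside x∈S w
      } , walk-linked w
      where
      all-inside : ∀ {x y P} → x Subset.∈ S → Walk R x y P → All (Subset._∈ S) P
      all-inside m [-]     = m ∷ []
      all-inside m (r ∷ w) = m ∷ all-inside (proj₂ (proj₂ (h r))) w

  Inside : Graph n → Subset n → Fin n → Fin n → Set
  Inside G S x y = Adj G x y × x Subset.∈ S × y Subset.∈ S

  path-walk : ∀ {G : Graph n} {S s t P} → IsPath G S s t P → Walk (Inside G S) s t P
  path-walk {G} {S} {P = P} p = linked-walk P first final (both adjacent inside)
    where
    open IsPath p
    both : ∀ {P} → Linked (Adj G) P → All (Subset._∈ S) P → Linked (Inside G S) P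
    both []      _             = []
    both [-]     _             = [-]
    both (r ∷ l) (a ∷ b ∷ as) = (r , a , b) ∷ both l (b ∷ as)

  path-star : ∀ {G : Graph n} {S s t P} → IsPath G S s t P → Star (Inside G S) s t
  path-star = walk-star ∘ path-walk

  path-source : ∀ {G : Graph n} {S s t P} → IsPath G S s t P → s Subset.∈ S
  path-source p = All.lookup (IsPath.inside p) (head∈ (path-walk p))

  connected-trans : ∀ {G : Graph n} {S s t u} → Connected G S s t → Connected G S t u → Connected G S s u
  connected-trans {G} (_ , p) (_ , q) =
    let P , r , _ = star-path G id (path-source p) (path-star p ◅◅ path-star q) in P , r

  connected-sym : ∀ {G : Graph n} {S s t} → Connected G S s t → Connected G S t s
  connected-sym {G} (_ , p) =
    let P , r , _ = star-path G id (All.lookup (IsPath.inside p) (last∈ (path-walk p)))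
                      (Star.reverse (λ (a , b , c) → subst T (Graph.sym G _ _) a , c , b) (path-star p))
    in P , r

  -- Vertices of U attached to a component of a cluster

  module _ (G : Graph n) (inU : Fin n → Bool) {lab₀ : Labelling {n}} {e₀ : Matrix {n}}
           (forest₀ : IsForest (Adj G) (lab₀ , e₀)) (F : Subset n) where

    open Sampling (Graph.adj G) inU lab₀
    open SamplingProperties (Graph.adj G) inU lab₀

    record ClusterStep (x y : Fin n) : Set where
      constructor clusterStep
      field
        source∉  : x Subset.∉ F
        target∉  : y Subset.∉ F
        adjacent : Adj G x y
        same     : lab₀ x ≡ lab₀ y

    -- This is a ∈ U(p, F) after the clusters have been completed by singletons, so that vertices
    -- inside and outside V(Γ) are treated alike.
    record Attached (p a : Fin n) : Set where
      constructor attached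
      field
        {via}   : Fin n
        inside  : inU a ≡ true
        intact  : a Subset.∉ F
        nearby  : Near a via
        inCluster : Star ClusterStep via p

    cluster-label : ∀ {x y} → Star ClusterStep x y → lab₀ x ≡ lab₀ y
    cluster-label ε       = refl
    cluster-label (r ◅ s) = trans (ClusterStep.same r) (cluster-label s)

    cluster-source : ∀ {x y} → y Subset.∉ F → Star ClusterStep x y → x Subset.∉ F
    cluster-source h ε       = h
    cluster-source h (r ◅ _) = ClusterStep.source∉ r

    -- The sample that matters belongs to a separating modulus and the residues of `a`, `b` and the
    -- label of `p`. It contains both vertices and the cluster of `p`, and apart from that cluster
    -- nothing that meets `F`.
    attached-reach : ∀ {L M} → n ≤ 2 ^ L → 2 + ∣ F ∣ * 3 * L ≤ M → ∀ σ → lab₀ ⊑ labels σ →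
                     ∀ {p a b} → p Subset.∉ F → Attached p a → Attached p b →
                     Reach G F (samples M σ) a b
    attached-reach {L} {M} n≤ large σ₀ h₀ {p} {a} {b} p∉ (attached {x} ua a∉ na ca) (attached {y} ub b∉ nb cb)
      with separating-modulus n≤ lab₀ F (lab₀ p) a∉ b∉ large
    ... | m , m<M , sepa , sepb , sepγ = conclude
          (samples-reach (λ σ → lab₀ ⊑ labels σ) (Goal G F inU forest₀ m r₁ r₂ r₃)
            (λ m r₁ r₂ r₃ σ h q → proj₁ (sample-≼ m r₁ r₂ r₃ σ) (h q))
            (λ m′ r₁′ r₂′ r₃′ σ → goal-mono G F inU forest₀ m r₁ r₂ r₃ {σ} (sample-≼ m′ r₁′ r₂′ r₃′ σ))
            (∈-downFrom⁺ m<M) (residue∈ a) (residue∈ b) (residue∈ γ)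
            (sample-goal G F inU forest₀ m r₁ r₂ r₃ sampled-a sampled-b sampled-γ
              (touches-intro na (cluster-label ca)) (touches-intro nb (cluster-label cb)) freeV freeC)
            σ₀ h₀)
      where
      γ = lab₀ p
      r₁ = cyc m (toℕ a)
      r₂ = cyc m (toℕ b)
      r₃ = cyc m (toℕ γ)
      τ = samples M σ₀

      residue∈ : ∀ (z : Fin n) → cyc m (toℕ z) ∈ downFrom M
      residue∈ z = ∈-downFrom⁺ (≤-<-trans (cyc-≤ m (toℕ z)) m<M)

      ≟-refl : ∀ k → does (k ℕ.≟ k) ≡ true
      ≟-refl k = dec-true (k ℕ.≟ k) refl

      ≟-true : ∀ k l → does (k ℕ.≟ l) ≡ true → k ≡ l
      ≟-true k l h = ≡ᵇ⇒≡ k l (≡⇒T h)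

      sampled-a : sampledVertex m r₁ r₂ r₃ a ≡ true
      sampled-a = ∧-intro ua (∨-introˡ (≟-refl r₁))

      sampled-b : sampledVertex m r₁ r₂ r₃ b ≡ true
      sampled-b = ∧-intro ub (∨-introʳ (does (r₂ ℕ.≟ r₁)) (≟-refl r₂))

      sampled-γ : sampledCluster m r₁ r₂ r₃ γ ≡ true
      sampled-γ = ∧-intro (==-intro (IsForest.idempotent forest₀ p)) (≟-refl r₃)

      freeV : ∀ {u} → sampledVertex m r₁ r₂ r₃ u ≡ true → u Subset.∉ F
      freeV {u} s u∈F with ∨-true (does (cyc m (toℕ u) ℕ.≟ r₁)) (proj₂ (∧-true (inU u) s))
      ... | inj₁ q = sepa u∈F (≟-true _ _ q)
      ... | inj₂ q = sepb u∈F (≟-true _ _ q)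

      freeC : ∀ {δ} → sampledCluster m r₁ r₂ r₃ δ ≡ true → δ ≢ γ → ∀ {z} → lab₀ z ≡ δ → z Subset.∉ F
      freeC {δ} s ne {z} refl z∈F = sepγ z∈F ne (≟-true _ _ (proj₂ (∧-true (lab₀ δ == δ) s)))

      sample-≼ : ∀ m r₁ r₂ r₃ σ → σ ≼ sample m r₁ r₂ r₃ σ
      sample-≼ m r₁ r₂ r₃ σ = sample-induction m r₁ r₂ r₃ (σ ≼_)
        (λ δ τ h → ≼-trans {σ = σ} {τ} {joinAround m r₁ r₂ r₃ δ τ} h (joinAround-≼ m r₁ r₂ r₃ δ τ)) σ (≼-refl {σ = σ})

      τ-⊑ : lab₀ ⊑ labels τ
      τ-⊑ = samples-induction (λ σ → lab₀ ⊑ labels σ)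
              (λ m r₁ r₂ r₃ σ h q → proj₁ (sample-≼ m r₁ r₂ r₃ σ) (h q)) M σ₀ h₀

      along : ∀ {x y} → Star ClusterStep x y → Reach G F τ x y
      along = Star.map λ (clusterStep c d e f) → step c d e (inj₂ (inj₂ (τ-⊑ f)))

      conclude : Goal G F inU forest₀ m r₁ r₂ r₃ τ → Reach G F τ a b
      conclude (inj₂ r)       = r
      conclude (inj₁ (f , g)) =
        near-step G F inU forest₀ {τ} na a∉ (cluster-source p∉ ca) (f na (cluster-label ca))
        ◅◅ along ca ◅◅ reach-sym G F {τ} (along cb)
        ◅◅ reach-sym G F {τ} (near-step G F inU forest₀ {τ} nb b∉ (cluster-source p∉ cb) (g nb (cluster-label cb)))

-- Cardinalities and sums

∣p∪q∣≤∣p∣+∣q∣ : ∀ {n} (p q : Subset n) → ∣ p ∪ q ∣ ≤ ∣ p ∣ + ∣ q ∣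
∣p∪q∣≤∣p∣+∣q∣ []          []          = z≤n
∣p∪q∣≤∣p∣+∣q∣ (true ∷ p)  (true ∷ q)  = s≤s (≤-trans (∣p∪q∣≤∣p∣+∣q∣ p q) (+-monoʳ-≤ ∣ p ∣ (n≤1+n ∣ q ∣)))
∣p∪q∣≤∣p∣+∣q∣ (true ∷ p)  (false ∷ q) = s≤s (∣p∪q∣≤∣p∣+∣q∣ p q)
∣p∪q∣≤∣p∣+∣q∣ (false ∷ p) (true ∷ q)  =
  ≤-trans (s≤s (∣p∪q∣≤∣p∣+∣q∣ p q)) (≤-reflexive (sym (+-suc ∣ p ∣ ∣ q ∣)))
∣p∪q∣≤∣p∣+∣q∣ (false ∷ p) (false ∷ q) = ∣p∪q∣≤∣p∣+∣q∣ p q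

∣p∣≤length : ∀ {n} {p : Subset n} xs → (∀ {x} → x Subset.∈ p → x ∈ xs) → ∣ p ∣ ≤ length xs
∣p∣≤length {n} xs h = ≤-trans (p⊆q⇒∣p∣≤∣q∣ (λ x∈p → covers xs (h x∈p))) (bound xs)
  where
  cover : List (Fin n) → Subset n
  cover []       = Subset.⊥
  cover (x ∷ xs) = ⁅ x ⁆ ∪ cover xs
  covers : ∀ xs {x} → x ∈ xs → x Subset.∈ cover xs
  covers (x ∷ xs) (here refl) = x∈p∪q⁺ (inj₁ (x∈⁅x⁆ x))
  covers (x ∷ xs) (there m)   = x∈p∪q⁺ (inj₂ (covers xs m))
  bound : ∀ xs → ∣ cover xs ∣ ≤ length xs
  bound []       = ≤-reflexive (∣⊥∣≡0 n)
  bound (x ∷ xs) = ≤-trans (∣p∪q∣≤∣p∣+∣q∣ ⁅ x ⁆ (cover xs)) (+-mono-≤ (≤-reflexive (∣⁅x⁆∣≡1 x)) (bound xs))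

does-true : ∀ {A : Set} (a? : Dec A) → does a? ≡ true → A
does-true (yes a) _ = a

indicator : Bool → ℕ
indicator b = Bool.if b then 1 else 0

sum-mono : ∀ {n} {f g : Fin n → ℕ} → (∀ x → f x ≤ g x) → sum f ≤ sum g
sum-mono {zero}  h = z≤n
sum-mono {suc n} h = +-mono-≤ (h zero) (sum-mono (λ x → h (suc x)))

sum-const : ∀ n k → sum {n} (λ _ → k) ≡ n * k
sum-const zero    k = refl
sum-const (suc n) k = cong (k +_) (sum-const n k)

sum-indicator : ∀ {n} (u : Fin n) → sum (λ x → indicator (x == u)) ≡ 1
sum-indicator {suc n} zero    = cong suc (trans (sum-const n 0) (*-zeroʳ n))
sum-indicator {suc n} (suc u) = sum-indicator u

∣tabulate∣*s≡sum : ∀ {n} (b : Fin n → Bool) s → ∣ tabulate b ∣ * s ≡ sum (λ x → Bool.if b x then s else 0)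
∣tabulate∣*s≡sum {zero}  b s = refl
∣tabulate∣*s≡sum {suc n} b s with b zero
... | true  = cong (s +_) (∣tabulate∣*s≡sum (b ∘ suc) s)
... | false = ∣tabulate∣*s≡sum (b ∘ suc) s

nonzero : ∀ {k} → isZero k ≡ false → suc (pred k) ≡ k
nonzero {suc k} _ = refl

module _ {n : ℕ} where

  spend-cases : ∀ (u w : Fin n) c → isZero (c u) ≡ false → isZero (c w) ≡ false → u ≢ w → ∀ x →
                c x ≡ spend u w c x + (indicator (x == u) + indicator (x == w))
  spend-cases u w c cu cw ne x with x Fin.≟ u | x Fin.≟ w
  ... | yes refl | yes refl = ⊥-elim (ne refl)
  ... | yes refl | no _     = trans (sym (nonzero cu)) (sym (+-comm (pred (c u)) 1))
  ... | no _     | yes refl = trans (sym (nonzero cw)) (sym (+-comm (pred (c w)) 1))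
  ... | no _     | no _     = sym (+-identityʳ (c x))

  sum-spend : ∀ (u w : Fin n) c → isZero (c u) ≡ false → isZero (c w) ≡ false → u ≢ w →
              sum c ≡ sum (spend u w c) + 2
  sum-spend u w c cu cw ne = begin
    sum c
      ≡⟨ sum-cong-≗ (spend-cases u w c cu cw ne) ⟩
    sum (λ x → spend u w c x + (indicator (x == u) + indicator (x == w)))
      ≡⟨ ∑-distrib-+ (spend u w c) (λ x → indicator (x == u) + indicator (x == w)) ⟩
    sum (spend u w c) + sum (λ x → indicator (x == u) + indicator (x == w))
      ≡⟨ cong (sum (spend u w c) +_) (trans (∑-distrib-+ (λ x → indicator (x == u)) (λ x → indicator (x == w)))
           (cong₂ _+_ (sum-indicator u) (sum-indicator w))) ⟩
    sum (spend u w c) + 2 ∎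
    where open ≡-Reasoning

  module _ (inU : Fin n → Bool) where

    private
      used? : ∀ (l : Labelling {n}) k → Dec (∃[ v ] (inU v ≡ true × l v ≡ k))
      used? l k = any? (λ v → (inU v ≟ᵇ true) ×-dec (l v Fin.≟ k))

    -- The components that meet `U`, represented by their labels. Their number is the potential
    -- against which joins are counted.
    image : Labelling → Subset n
    image l = tabulate (λ k → does (used? l k))

    image⁺ : ∀ {l v} → inU v ≡ true → l v Subset.∈ image l
    image⁺ {l} {v} h = ∈-tabulate⁺ (dec-true (used? l (l v)) (v , h , refl))

    image⁻ : ∀ {l k} → k Subset.∈ image l → ∃[ v ] (inU v ≡ true × l v ≡ k)
    image⁻ {l} {k} m = does-true (used? l k) (∈-tabulate⁻ m)

    ∣image∣≤∣U∣ : ∀ l → ∣ image l ∣ ≤ ∣ tabulate inU ∣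
    ∣image∣≤∣U∣ l = ≤-trans
      (∣p∣≤length (map l (elements (tabulate inU)))
        (λ m → case image⁻ {l} m of λ { (v , h , refl) → ∈-map⁺ l (∈-elements⁺ (∈-tabulate⁺ h)) }))
      (≤-reflexive (trans (length-map l (elements (tabulate inU))) (length-elements (tabulate inU))))

    merge-image⊆ : ∀ {u w l} → inU u ≡ true → image (merge u w l) Subset.⊆ image l
    merge-image⊆ {u} {w} {l} hu m with image⁻ {merge u w l} m
    ... | v , hv , refl with merge-cases u w l v
    ...   | inj₁ (_ , e) = subst (Subset._∈ image l) (sym e) (image⁺ hu)
    ...   | inj₂ (_ , e) = subst (Subset._∈ image l) (sym e) (image⁺ hv)

    ∣merge-image∣≤ : ∀ {u w l} → inU u ≡ true → ∣ image (merge u w l) ∣ ≤ ∣ image l ∣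
    ∣merge-image∣≤ {u} {w} {l} hu = p⊆q⇒∣p∣≤∣q∣ (merge-image⊆ {u} {w} {l} hu)

    -- The label `l w` disappears from `U` and no new label appears.
    ∣merge-image∣< : ∀ {u w l} → inU u ≡ true → l u ≢ l w → l w Subset.∈ image l →
                     ∣ image (merge u w l) ∣ < ∣ image l ∣
    ∣merge-image∣< {u} {w} {l} hu ne m = p⊂q⇒∣p∣<∣q∣
      (merge-image⊆ {u} {w} {l} hu , l w , m , λ m′ → case image⁻ {merge u w l} m′ of λ (v , _ , e) → lost v e)
      where
      lost : ∀ v → merge u w l v ≢ l w
      lost v e with merge-cases u w l v
      ... | inj₁ (_ , e′) = ne (trans (sym e′) e)
      ... | inj₂ (d , e′) = d (trans (sym e′) e)

    module Potential (adj : Matrix {n}) (lab₀ : Labelling {n}) (s : ℕ) where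

      open Sampling adj inU lab₀
      open SamplingProperties adj inU lab₀

      ∣U∣ : ℕ
      ∣U∣ = ∣ tabulate inU ∣

      -- Every join spends two units of capacity; all but at most X of them lower the
      -- number of labels on U.
      Balanced : ℕ → State → Set
      Balanced X σ = n * s + 2 * ∣ image (labels σ) ∣ ≤ sum (capacity σ) + 2 * (∣U∣ + X)

      balanced-mono : ∀ {X Y σ} → X ≤ Y → Balanced X σ → Balanced Y σ
      balanced-mono {σ = σ} h b = ≤-trans b (+-monoʳ-≤ (sum (capacity σ)) (*-monoʳ-≤ 2 (+-monoʳ-≤ ∣U∣ h)))

      private
        -- The two units of capacity that a join costs are balanced by the label that it removes
        -- from `U`.
        paid : ∀ {A I I′ S S′ Y} → I′ < I → S ≡ S′ + 2 → A + 2 * I ≤ S + Y → A + 2 * I′ ≤ S′ + Y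
        paid {A} {I} {I′} {S} {S′} {Y} lt e h = +-cancelˡ-≤ 2 _ _ (begin
          2 + (A + 2 * I′)   ≡⟨ solve 2 (λ A I → con 2 :+ (A :+ con 2 :* I) := A :+ con 2 :* (con 1 :+ I)) refl A I′ ⟩
          A + 2 * suc I′     ≤⟨ +-monoʳ-≤ A (*-monoʳ-≤ 2 lt) ⟩
          A + 2 * I          ≤⟨ h ⟩
          S + Y              ≡⟨ cong (_+ Y) e ⟩
          S′ + 2 + Y         ≡⟨ solve 2 (λ S Y → S :+ con 2 :+ Y := con 2 :+ (S :+ Y)) refl S′ Y ⟩
          2 + (S′ + Y)       ∎)
          where open ≤-Reasoning

        -- Here no label need be lost, and the two units are charged to `X`.
        free : ∀ {A I I′ S S′ U X} → I′ ≤ I → S ≡ S′ + 2 → A + 2 * I ≤ S + 2 * (U + X) →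
               A + 2 * I′ ≤ S′ + 2 * (U + suc X)
        free {A} {I} {I′} {S} {S′} {U} {X} le e h = begin
          A + 2 * I′              ≤⟨ +-monoʳ-≤ A (*-monoʳ-≤ 2 le) ⟩
          A + 2 * I               ≤⟨ h ⟩
          S + 2 * (U + X)         ≡⟨ cong (_+ 2 * (U + X)) e ⟩
          S′ + 2 + 2 * (U + X)    ≡⟨ solve 3 (λ S U X → S :+ con 2 :+ con 2 :* (U :+ X) := S :+ con 2 :* (U :+ (con 1 :+ X))) refl S′ U X ⟩
          S′ + 2 * (U + suc X)    ∎
          where open ≤-Reasoning

      Above : State → Set
      Above σ = lab₀ ⊑ labels σ

      private
        joinCapped-above : ∀ u w σ → Above σ → Above (joinCapped u w σ)
        joinCapped-above u w σ h q = proj₁ (joinCapped-≼ u w σ) (h q)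

      Hit : Fin n → State → Set
      Hit δ σ = ∃[ v ] (inU v ≡ true × (∀ {x} → lab₀ x ≡ δ → labels σ v ≡ labels σ x))

      -- A join is unpaid only if the component of `δ` contains no vertex of `U`. That join
      -- establishes `Hit`, after which each further join at `δ` merges two components that meet
      -- `U`. So `X` rises at most once.
      joinAround-balanced : ∀ m r₁ r₂ r₃ δ {X} σ → Above σ → Balanced X σ →
                            Balanced (suc X) (joinAround m r₁ r₂ r₃ δ σ)
      joinAround-balanced m r₁ r₂ r₃ δ {X} σ ab b =
        case joinAround-induction m r₁ r₂ r₃ During δ During-step σ (ab , inj₁ b) of λ where
          (_ , inj₁ b)       → balanced-mono {σ = joinAround m r₁ r₂ r₃ δ σ} (n≤1+n X) b
          (_ , inj₂ (b , _)) → b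
        where
        During : State → Set
        During σ = Above σ × (Balanced X σ ⊎ (Balanced (suc X) σ × Hit δ σ))

        During-step : ∀ u w σ → sampledVertex m r₁ r₂ r₃ u ≡ true → Near u w → lab₀ w ≡ δ → During σ → During (joinCapped u w σ)
        During-step u w σ@((l , e) , c) su _ wδ (ab , j) = joinCapped-above u w σ ab ,
          joinCapped-elim (λ τ → Balanced X τ ⊎ (Balanced (suc X) τ × Hit δ τ)) u w l e c j (joined j)
          where
          hu = sampledVertex-inU m r₁ r₂ r₃ su

          joined : Balanced X σ ⊎ (Balanced (suc X) σ × Hit δ σ) → isZero (c u) ≡ false → isZero (c w) ≡ false → l u ≢ l w →
                   Balanced X ((merge u w l , link u w e) , spend u w c) ⊎
                   (Balanced (suc X) ((merge u w l , link u w e) , spend u w c) ×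
                    Hit δ ((merge u w l , link u w e) , spend u w c))
          joined (inj₂ (b , v , hv , same)) cu cw ne with sum-spend u w c cu cw (ne ∘ cong l)
          ... | sp = inj₂
            ( paid {A = n * s} (∣merge-image∣< {u} {w} {l} hu ne (subst (Subset._∈ image l) (same wδ) (image⁺ hv))) sp b
            , v , hv , λ q → merge-cong u w l (same q))
          joined (inj₁ b) cu cw ne with sum-spend u w c cu cw (ne ∘ cong l) | l w ∈? image l
          ... | sp | yes m = inj₁ (paid {A = n * s} (∣merge-image∣< {u} {w} {l} hu ne m) sp b)
          ... | sp | no _  = inj₂ (free {A = n * s} {U = ∣U∣} {X} (∣merge-image∣≤ {u} {w} {l} hu) sp b
                               , u , hu , λ q → trans (merge-same u w l) (merge-cong u w l (ab (trans wδ (sym q)))))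

      joinAround-above : ∀ m r₁ r₂ r₃ δ σ → Above σ → Above (joinAround m r₁ r₂ r₃ δ σ)
      joinAround-above m r₁ r₂ r₃ δ σ h q = proj₁ (joinAround-≼ m r₁ r₂ r₃ δ σ) (h q)

      -- A raised flag witnesses a merge of two classes of `π` that both contain vertices of `U`.
      mergeAround-image : ∀ m r₁ r₂ r₃ δ π →
        ∣ image (proj₁ (mergeAround m r₁ r₂ r₃ δ π)) ∣ + indicator (proj₂ (mergeAround m r₁ r₂ r₃ δ π)) ≤ ∣ image π ∣
      mergeAround-image m r₁ r₂ r₃ δ π₀ = mergeAround-induction m r₁ r₂ r₃
        (λ (π , b) → ∣ image π ∣ + indicator b ≤ ∣ image π₀ ∣) δ
        (λ u u′ π b t t′ ne i → ≤-trans (≤-trans (≤-reflexive (+-comm _ 1))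
            (∣merge-image∣< {u} {u′} {π} (used t) ne (image⁺ (used t′)))) (≤-trans (m≤m+n _ (indicator b)) i))
        π₀ (≤-reflexive (+-identityʳ _))
        where
        used : ∀ {u} → sampledTouches m r₁ r₂ r₃ δ u ≡ true → inU u ≡ true
        used {u} t = sampledVertex-inU m r₁ r₂ r₃ (proj₁ (∧-true (sampledVertex m r₁ r₂ r₃ u) t))

      sample-balanced : ∀ m r₁ r₂ r₃ {X} σ → Above σ → Balanced X σ →
                        Above (sample m r₁ r₂ r₃ σ) × Balanced (∣U∣ + X) (sample m r₁ r₂ r₃ σ)
      sample-balanced m r₁ r₂ r₃ {X} σ ab b =
        let ab′ , Y , bal , le = foldl-preserves K K-step vertices↓ {id , σ}
              (ab , X , b , ≤-trans (+-monoʳ-≤ X (∣image∣≤∣U∣ id)) (≤-reflexive (+-comm X ∣U∣)))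
        in ab′ , balanced-mono {σ = sample m r₁ r₂ r₃ σ} (≤-trans (m≤m+n Y _) le) bal
        where
        -- `Y` grows by one for each kept cluster, while the number of classes of `π` on `U` drops
        -- by at least one. As there are at most |U| classes at the start, at most |U| clusters are
        -- kept.
        K : Labelling × State → Set
        K (π , σ) = Above σ × ∃[ Y ] (Balanced Y σ × Y + ∣ image π ∣ ≤ ∣U∣ + X)

        K-step : ∀ p δ → K p → K (visit m r₁ r₂ r₃ p δ)
        K-step (π , σ) δ k@(ab , Y , bal , le) = if-elim K (sampledCluster m r₁ r₂ r₃ δ)
          (λ _ → chosen (proj₂ (mergeAround m r₁ r₂ r₃ δ π)) (mergeAround-image m r₁ r₂ r₃ δ π)) (λ _ → k)
          where
          π′ = proj₁ (mergeAround m r₁ r₂ r₃ δ π)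
          chosen : ∀ b → ∣ image π′ ∣ + indicator b ≤ ∣ image π ∣ →
                   K (π′ , (Bool.if b then joinAround m r₁ r₂ r₃ δ σ else σ))
          chosen true  h = joinAround-above m r₁ r₂ r₃ δ σ ab , suc Y , joinAround-balanced m r₁ r₂ r₃ δ σ ab bal ,
            ≤-trans (≤-reflexive (trans (sym (+-suc Y _)) (cong (Y +_) (+-comm 1 _)))) (≤-trans (+-monoʳ-≤ Y h) le)
          chosen false h = ab , Y , bal , ≤-trans (+-monoʳ-≤ Y (≤-trans (m≤m+n _ 0) h)) le

      samples-balanced : ∀ M σ → Above σ → Balanced 0 σ → Balanced (M * (M * (M * (M * ∣U∣)))) (samples M σ)
      samples-balanced M σ ab b = subst (λ Y → Balanced Y (samples M σ)) (+-identityʳ _) (proj₂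
        (counts (M * (M * (M * ∣U∣))) (λ m → counts (M * (M * ∣U∣)) (λ r₁ → counts (M * ∣U∣) (λ r₂ →
          counts ∣U∣ (λ r₃ X σ (ab , b) → sample-balanced m r₁ r₂ r₃ σ ab b)))) 0 σ (ab , b)))
        where
        I : ℕ → State → Set
        I X σ = Above σ × Balanced X σ

        counts : ∀ k {f : ℕ → State → State} → (∀ r X σ → I X σ → I (k + X) (f r σ)) →
                 ∀ X σ → I X σ → I (M * k + X) (foldl (λ σ r → f r σ) σ (downFrom M))
        counts k {f} h X σ i = subst (λ L → I (L * k + X) (foldl (λ σ r → f r σ) σ (downFrom M))) (length-downFrom M)
          (foldl-counts I k (λ X σ r → h r X σ) (downFrom M) i)

      -- A vertex without capacity has spent `s`, so the left side is at most the total capacity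
      -- spent, which `Balanced` bounds.
      saturated-bound : ∀ {X σ} → (∀ x → capacity σ x ≤ s) → Balanced X σ →
                        ∣ tabulate (λ x → isZero (capacity σ x)) ∣ * s ≤ 2 * (∣U∣ + X)
      saturated-bound {X} {σ} le b = +-cancelʳ-≤ (sum c) _ _ (begin
        ∣ tabulate (isZero ∘ c) ∣ * s + sum c              ≡⟨ cong (_+ sum c) (∣tabulate∣*s≡sum (isZero ∘ c) s) ⟩
        sum (λ x → Bool.if isZero (c x) then s else 0) + sum c ≡⟨ sym (∑-distrib-+ (λ x → Bool.if isZero (c x) then s else 0) c) ⟩
        sum (λ x → (Bool.if isZero (c x) then s else 0) + c x) ≤⟨ sum-mono (λ x → small (c x) (le x)) ⟩
        sum (λ (_ : Fin n) → s)                            ≡⟨ sum-const n s ⟩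
        n * s                                              ≤⟨ m≤m+n (n * s) _ ⟩
        n * s + 2 * ∣ image (labels σ) ∣                   ≤⟨ b ⟩
        sum c + 2 * (∣U∣ + X)                              ≡⟨ +-comm (sum c) _ ⟩
        2 * (∣U∣ + X) + sum c                              ∎)
        where
        open ≤-Reasoning
        c = capacity σ
        small : ∀ k → k ≤ s → (Bool.if isZero k then s else 0) + k ≤ s
        small zero    _ = ≤-reflexive (+-identityʳ s)
        small (suc k) h = h

  -- Degrees

  row : State {n} → Fin n → Subset n
  row ((_ , e) , _) x = tabulate (e x)

  DegreeBound : ℕ → State {n} → Set
  DegreeBound D σ = ∀ x → ∣ row σ x ∣ + capacity σ x ≤ D

  -- A new edge adds at most 1 to the degree of each end and takes 1 from its capacity.
  joinCapped-degree : ∀ D u w σ → DegreeBound D σ → DegreeBound D (joinCapped u w σ)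
  joinCapped-degree D u w σ@((l , e) , c) h = joinCapped-elim (DegreeBound D) u w l e c h
    (λ cu cw ne x → ≤-trans (joined cu cw (ne ∘ cong l) x) (h x))
    where
    new : Fin n → Subset n
    new x = (Bool.if x == u then ⁅ w ⁆ else Subset.⊥) ∪ (Bool.if x == w then ⁅ u ⁆ else Subset.⊥)

    row⊆ : ∀ x → tabulate (link u w e x) Subset.⊆ tabulate (e x) ∪ new x
    row⊆ x {y} m with link-elim u w e {x} {y} (∈-tabulate⁻ m)
    ... | inj₁ r                    = x∈p∪q⁺ (inj₁ (∈-tabulate⁺ r))
    ... | inj₂ (inj₁ (refl , refl)) = x∈p∪q⁺ (inj₂ (x∈p∪q⁺ (inj₁
      (subst (λ b → w Subset.∈ (Bool.if b then ⁅ w ⁆ else Subset.⊥)) (sym (==-refl u)) (x∈⁅x⁆ w)))))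
    ... | inj₂ (inj₂ (refl , refl)) = x∈p∪q⁺ (inj₂ (x∈p∪q⁺ (inj₂
      (subst (λ b → u Subset.∈ (Bool.if b then ⁅ u ⁆ else Subset.⊥)) (sym (==-refl w)) (x∈⁅x⁆ u)))))

    ∣if∣ : ∀ b (v : Fin n) → ∣ Bool.if b then ⁅ v ⁆ else Subset.⊥ ∣ ≡ indicator b
    ∣if∣ true  v = ∣⁅x⁆∣≡1 v
    ∣if∣ false v = ∣⊥∣≡0 n

    joined : isZero (c u) ≡ false → isZero (c w) ≡ false → u ≢ w → ∀ x →
             ∣ tabulate (link u w e x) ∣ + spend u w c x ≤ ∣ tabulate (e x) ∣ + c x
    joined cu cw ne x = begin
      ∣ tabulate (link u w e x) ∣ + spend u w c x
        ≤⟨ +-monoˡ-≤ _ (≤-trans (p⊆q⇒∣p∣≤∣q∣ (row⊆ x)) (≤-trans (∣p∪q∣≤∣p∣+∣q∣ (tabulate (e x)) (new x))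
             (+-monoʳ-≤ _ (≤-trans (∣p∪q∣≤∣p∣+∣q∣ (Bool.if x == u then ⁅ w ⁆ else Subset.⊥) _)
               (≤-reflexive (cong₂ _+_ (∣if∣ (x == u) w) (∣if∣ (x == w) u))))))) ⟩
      ∣ tabulate (e x) ∣ + (indicator (x == u) + indicator (x == w)) + spend u w c x
        ≡⟨ +-assoc ∣ tabulate (e x) ∣ _ _ ⟩
      ∣ tabulate (e x) ∣ + (indicator (x == u) + indicator (x == w) + spend u w c x)
        ≡⟨ cong (∣ tabulate (e x) ∣ +_) (trans (+-comm _ (spend u w c x)) (sym (spend-cases u w c cu cw ne x))) ⟩
      ∣ tabulate (e x) ∣ + c x ∎
      where open ≤-Reasoning

  joinCapped-capacity : ∀ s u w (σ : State {n}) → (∀ x → capacity σ x ≤ s) → ∀ x → capacity (joinCapped u w σ) x ≤ s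
  joinCapped-capacity s u w σ@((l , e) , c) h = joinCapped-elim (λ τ → ∀ x → capacity τ x ≤ s) u w l e c h
    (λ _ _ _ x → if-elim (_≤ s) (x == u ∨ x == w) (λ _ → ≤-trans pred[n]≤n (h x)) (λ _ → h x))

  degree≤maxDegree : ∀ (G : Graph n) x → Graph.degree G x ≤ maxDegree G
  degree≤maxDegree G x = All.lookup (xs≤max 0 (map (Graph.degree G) (allFin n)))
                           (∈-map⁺ (Graph.degree G) (∈-allFin x))

  -- By disjointness at most one cluster contains `x`, and all cluster edges at `x` belong to its
  -- tree.
  cluster-degree : ∀ (G : Graph n) {D x p} Γ → All (λ γ → IsSpanningTree G (vertices γ) (tree γ)) Γ →
    AllPairs (λ γ δ → Empty (vertices γ ∩ vertices δ)) Γ → All (λ γ → maxDegree (tree γ) ≤ D) Γ →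
    (∀ {y} → y Subset.∈ p → ClusterEdge Γ x y) → ∣ p ∣ ≤ D
  cluster-degree G {D} {x} {p} [] _ _ _ h =
    ≤-trans (∣p∣≤length {p = p} [] (λ m → case h m of λ ())) z≤n
  cluster-degree G {D} {x} {p} (γ ∷ Γ) (t ∷ ts) (d ∷ ds) (b ∷ bs) h with x ∈? vertices γ
  ... | yes x∈γ = ≤-trans (p⊆q⇒∣p∣≤∣q∣ (λ m → ∈-tabulate⁺ (T⇒≡ (own (h m))))) (≤-trans (degree≤maxDegree (tree γ) x) b)
    where
    elsewhere : ∀ {Γ y} → All (λ γ → IsSpanningTree G (vertices γ) (tree γ)) Γ →
                All (λ δ → Empty (vertices γ ∩ vertices δ)) Γ → ¬ ClusterEdge Γ x y
    elsewhere (t ∷ _)  (d ∷ _)  (here a)  = d (x , x∈p∩q⁺ (x∈γ , proj₁ (proj₂ (IsSpanningTree.subgraph t _ _ a))))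
    elsewhere (_ ∷ ts) (_ ∷ ds) (there m) = elsewhere ts ds m
    own : ∀ {y} → ClusterEdge (γ ∷ Γ) x y → Adj (tree γ) x y
    own (here a)  = a
    own (there m) = ⊥-elim (elsewhere ts d m)
  ... | no x∉γ = cluster-degree G {D} {x} {p} Γ ts ds bs (λ m → other (h m))
    where
    other : ∀ {y} → ClusterEdge (γ ∷ Γ) x y → ClusterEdge Γ x y
    other (here a)  = ⊥-elim (x∉γ (proj₁ (proj₂ (IsSpanningTree.subgraph t _ _ a))))
    other (there m) = m

≡-bool : ∀ {a b} → (a ≡ true → b ≡ true) → (b ≡ true → a ≡ true) → a ≡ b
≡-bool {true}          f g = sym (f refl)
≡-bool {false} {true}  f g = g refl
≡-bool {false} {false} f g = refl

module _ {n : ℕ} where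

  maxDegree≤ : ∀ (G : Graph n) {D} → (∀ x → Graph.degree G x ≤ D) → maxDegree G ≤ D
  maxDegree≤ G h = max≤v⁺ {xs = map (Graph.degree G) (allFin n)} z≤n (AllP.map⁺ (All.universal h (allFin n)))

  x∈p─q⇒x∉q : ∀ {m} (p q : Subset m) {x} → x Subset.∈ p ─ q → x Subset.∉ q
  x∈p─q⇒x∉q (_ ∷ p) (true ∷ q)  (Vec.there m) (Vec.there h) = x∈p─q⇒x∉q p q m h
  x∈p─q⇒x∉q (_ ∷ p) (false ∷ q) (Vec.there m) (Vec.there h) = x∈p─q⇒x∉q p q m h

  -- The components of a forest as clusters

  module Components (G : Graph n) {l : Labelling {n}} {e : Matrix {n}} (forest : IsForest (Adj G) (l , e)) where

    open IsForest forest

    component : Fin n → Cluster n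
    component z = record
      { vertices = tabulate (λ x → l x == z)
      ; tree     = record
        { adj    = λ x y → e x y ∧ l x == z
        ; sym    = λ x y → ≡-bool (flip x y) (flip y x)
        ; irrefl = λ x → ≡-bool (λ h → ⊥-elim (loopless x (proj₁ (∧-true (e x x) h)))) (λ ())
        }
      }
      where
      flip : ∀ x y → e x y ∧ l x == z ≡ true → e y x ∧ l y == z ≡ true
      flip x y h = let a , b = ∧-true (e x y) h
                   in ∧-intro (symmetric a) (==-intro (trans (sym (within a)) (==-true b)))
      loopless : ∀ x → ¬ Edge e x x
      loopless x h = case trans (sym (Graph.irrefl G x)) (T⇒≡ (edges h)) of λ ()

    ∈-component : ∀ {z x} → l x ≡ z → x Subset.∈ vertices (component z)
    ∈-component h = ∈-tabulate⁺ (==-intro h)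

    component-label : ∀ {z x} → x Subset.∈ vertices (component z) → l x ≡ z
    component-label m = ==-true (∈-tabulate⁻ m)

    private
      tree-edge : ∀ {z x y} → Adj (tree (component z)) x y → Edge e x y × l x ≡ z
      tree-edge {z} {x} {y} a = let p , q = ∧-true (e x y) (T⇒≡ a) in p , ==-true q

    component-spanning : ∀ z → l z ≡ z → IsSpanningTree G (vertices (component z)) (tree (component z))
    component-spanning z rep = record
      { subgraph  = λ u v a → let p , q = tree-edge a
                              in edges p , ∈-component q , ∈-component (trans (sym (within p)) q)
      ; nonempty  = z , ∈-component rep
      ; connected = λ u v hu hv →
          let P , p , _ = star-path (tree (component z)) {vertices (component z)} id hu
                (inside (component-label hu) (connects (trans (component-label hu) (sym (component-label hv)))))
          in P , p
      ; acyclic   = λ s t P p len a →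
          forestlike (walk-map (λ r → proj₁ (tree-edge (proj₁ r))) (path-walk p)) (IsPath.simple p) len
            (proj₁ (tree-edge a))
      }
      where
      inside : ∀ {u v} → l u ≡ z → Star (Edge e) u v → Star (Inside (tree (component z)) (vertices (component z))) u v
      inside h ε       = ε
      inside h (r ◅ s) = let h′ = trans (sym (within r)) h
                         in (≡⇒T (∧-intro r (==-intro h)) , ∈-component h , ∈-component h′) ◅ inside h′ s

    representatives : List (Fin n)
    representatives = filter (λ z → l z Fin.≟ z) (allFin n)

    components : List (Cluster n)
    components = map component representatives

    components-spanning : All (λ γ → IsSpanningTree G (vertices γ) (tree γ)) components
    components-spanning = AllP.map⁺ (All.map (λ {z} → component-spanning z)
                            (AllP.all-filter (λ z → l z Fin.≟ z) (allFin n)))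

    components-disjoint : AllPairs (λ γ δ → Empty (vertices γ ∩ vertices δ)) components
    components-disjoint = AllPairsP.map⁺ (AllPairs.map
      (λ ne (x , m) → let a , b = x∈p∩q⁻ _ _ m in ne (trans (sym (component-label a)) (component-label b)))
      (AllPairsP.filter⁺ (λ z → l z Fin.≟ z) (allFin⁺ n)))

    ∈-components : ∀ x → component (l x) ∈ components
    ∈-components x = ∈-map⁺ component (∈-filter⁺ (λ z → l z Fin.≟ z) (∈-allFin (l x)) (idempotent x))

    components-degree : ∀ {D} → (∀ x → ∣ tabulate (e x) ∣ ≤ D) →
                        max 0 (map (λ γ → maxDegree (tree γ)) components) ≤ D
    components-degree {D} h = max≤v⁺ {xs = map (maxDegree ∘ tree) components} z≤n
      (AllP.map⁺ (AllP.map⁺ (All.universal (λ z → maxDegree≤ (tree (component z)) (λ x →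
        ≤-trans (p⊆q⇒∣p∣≤∣q∣ (row⊆ z x)) (h x))) representatives)))
      where
      row⊆ : ∀ z x → tabulate (λ y → e x y ∧ l x == z) Subset.⊆ tabulate (e x)
      row⊆ z x {y} m = ∈-tabulate⁺ (proj₁ (∧-true (e x y) (∈-tabulate⁻ m)))

  -- The resulting decomposition

  module Result (G : Graph n) (D : Decomposition G) (M s : ℕ) where

    inU : Fin n → Bool
    inU = lookup (U D)

    σ₀ σ : State
    σ₀ = clusterForest (Γ D) , λ _ → s
    σ  = finalState (Graph.adj G) inU (Γ D) M s

    lab₀ : Labelling
    lab₀ = labels σ₀

    open Sampling (Graph.adj G) inU lab₀
    open SamplingProperties (Graph.adj G) inU lab₀

    clusterEdge⇒adj : ∀ {Γ x y} → All (λ γ → IsSpanningTree G (vertices γ) (tree γ)) Γ → ClusterEdge Γ x y → Adj G x y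
    clusterEdge⇒adj (t ∷ _)  (here a)  = proj₁ (IsSpanningTree.subgraph t _ _ a)
    clusterEdge⇒adj (_ ∷ ts) (there m) = clusterEdge⇒adj ts m

    forest₀ : IsForest (Adj G) (clusterForest (Γ D))
    forest₀ = weaken-forest (clusterEdge⇒adj (spanning D)) (clusterForest-isForest (Γ D))

    cluster-lab₀ : ∀ {Γ′ x y} → All (λ γ → IsSpanningTree G (vertices γ) (tree γ)) Γ′ →
      (∀ {x y} → ClusterEdge Γ′ x y → lab₀ x ≡ lab₀ y) →
      Any (λ γ → x Subset.∈ vertices γ × y Subset.∈ vertices γ) Γ′ → lab₀ x ≡ lab₀ y
    cluster-lab₀ (t ∷ ts) h (there m)       = cluster-lab₀ ts (h ∘ there) m
    cluster-lab₀ (t ∷ ts) h (here (a , b)) =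
      walk-respects lab₀ (λ r → h (here (proj₁ r))) (path-walk (proj₂ (IsSpanningTree.connected t _ _ a b)))

    same-lab₀ : ∀ {x y} → Any (λ γ → x Subset.∈ vertices γ × y Subset.∈ vertices γ) (Γ D) → lab₀ x ≡ lab₀ y
    same-lab₀ = cluster-lab₀ (spanning D) (clusterForest-joins (Γ D))

    -- After `σ₀` the state changes only through `joinCapped` at nearby pairs, so invariants are
    -- checked for this operation alone.
    σ-induction : ∀ (I : State → Set) →
      (∀ u w τ → Near u w → I τ → I (joinCapped u w τ)) → I σ₀ → I σ
    σ-induction I h i = samples-induction I
      (λ m r₁ r₂ r₃ τ → sample-induction m r₁ r₂ r₃ I
        (λ δ τ → joinAround-induction m r₁ r₂ r₃ I δ (λ u w τ _ nw _ → h u w τ nw) τ) τ) M σ₀ i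

    forest : IsForest (Adj G) (proj₁ σ)
    forest = σ-induction (IsForest (Adj G) ∘ proj₁)
      (λ u w ((l , e) , c) nw i → joinCapped-elim (IsForest (Adj G) ∘ proj₁) u w l e c i
        (λ _ _ ne → let a = adjacent u w nw (ne ∘ cong l)
                    in linked-forest a (subst T (Graph.sym G u w) a) ne i)) forest₀
      where
      adjacent : ∀ u w → Near u w → u ≢ w → Adj G u w
      adjacent u w h ne with ∨-true (Graph.adj G u w) h
      ... | inj₁ a = ≡⇒T a
      ... | inj₂ b = ⊥-elim (ne (==-true b))

    open Components G forest

    result : Decomposition G
    result = record
      { U        = tabulate (λ x → isZero (capacity σ x))
      ; Γ        = components
      ; spanning = components-spanning
      ; disjoint = components-disjoint
      }

    result-degree : Δ result ≤ Δ D + s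
    result-degree = components-degree λ x → ≤-trans (m≤m+n _ (capacity σ x))
      (σ-induction (DegreeBound (Δ D + s)) (λ u w τ _ → joinCapped-degree (Δ D + s) u w τ)
        (λ x → +-monoˡ-≤ s (cluster-degree G {x = x} (Γ D) (spanning D) (disjoint D) degrees
          (λ m → IsForest.edges (clusterForest-isForest (Γ D)) (∈-tabulate⁻ m)))) x)
      where
      degrees : All (λ γ → maxDegree (tree γ) ≤ Δ D) (Γ D)
      degrees = AllP.map⁻ (xs≤max 0 (map (λ γ → maxDegree (tree γ)) (Γ D)))

    result-size : ∣ U result ∣ * s ≤ 2 * ((1 + M * (M * (M * M))) * ∣ U D ∣)
    result-size = subst (λ k → ∣ U result ∣ * s ≤ 2 * ((1 + M * (M * (M * M))) * k)) (cong ∣_∣ (tabulate∘lookup (U D)))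
      (≤-trans (saturated-bound {M * (M * (M * (M * ∣U∣)))} {σ}
          (σ-induction (λ τ → ∀ x → capacity τ x ≤ s) (λ u w τ _ → joinCapped-capacity s u w τ) (λ _ → ≤-refl))
          (samples-balanced M σ₀ id balanced₀))
        (≤-reflexive (cong (λ k → 2 * (∣U∣ + k)) (solve 2 (λ M u → M :* (M :* (M :* (M :* u))) := M :* (M :* (M :* M)) :* u) refl M ∣U∣))))
      where
      open Potential inU (Graph.adj G) lab₀ s

      balanced₀ : Balanced 0 σ₀
      balanced₀ = +-mono-≤ (≤-reflexive (sym (sum-const n s)))
        (*-monoʳ-≤ 2 (≤-trans (∣image∣≤∣U∣ inU lab₀) (m≤m+n _ 0)))

    module _ {L f : ℕ} (n≤ : n ≤ 2 ^ L) (large : 2 + (f ⊓ suc n) * 3 * L ≤ M) where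

      module _ (F : Subset n) (∣F∣≤ : ∣ F ∣ ≤ f) where

        private
          Att : Fin n → Fin n → Set
          Att = Attached G inU forest₀ F

        attached-reach′ : ∀ {p a b} → p Subset.∉ F → Att p a → Att p b → Reach G F σ a b
        attached-reach′ = attached-reach G inU forest₀ F n≤
          -- A failure set has at most n vertices, so nothing is lost by the cap on `f`.
          (≤-trans (+-monoʳ-≤ 2 (*-monoˡ-≤ L (*-monoˡ-≤ 3 (⊓-glb ∣F∣≤ (≤-trans (∣p∣≤n F) (n≤1+n n)))))) large) σ₀ id

        near-self : ∀ u → Near u u
        near-self u = ∨-introʳ (Graph.adj G u u) (==-refl u)

        near-adj : ∀ {u w} → Adj G u w → Near u w
        near-adj a = ∨-introˡ (T⇒≡ a)

        inU⁺ : ∀ {u} → u Subset.∈ U D → inU u ≡ true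
        inU⁺ = []=⇒lookup

        U-attached : ∀ {s F′ a} → F′ ≡ F → s Subset.∉ F → InU D s F′ a → Att s a
        U-attached refl s∉ (inj₂ (s∈U , _ , refl)) = attached (inU⁺ s∈U) s∉ (near-self _) ε
        U-attached {s} {a = a} refl s∉ (inj₁ h) with find h
        ... | γ , γ∈Γ , s∈γ , a∈U─F , v , v∈N , P , p = attached
            (inU⁺ (p─q⊆p (U D) F a∈U─F)) (x∈p─q⇒x∉q (U D) F a∈U─F) nearby
            (Star.reverse reverse-step (steps (path-star p)))
          where
          nearby : Near a v
          nearby with x∈p∪q⁻ (Graph.neighbours G a) ⁅ a ⁆ v∈N
          ... | inj₁ m = ∨-introˡ (∈-tabulate⁻ m)
          ... | inj₂ m = ∨-introʳ (Graph.adj G a v) (==-intro (sym (x∈⁅y⁆⇒x≡y a m)))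

          reverse-step : ∀ {x y} → ClusterStep G inU forest₀ F x y → ClusterStep G inU forest₀ F y x
          reverse-step (clusterStep a b c d) = clusterStep b a (subst T (Graph.sym G _ _) c) (sym d)

          steps : ∀ {x y} → Star (Inside G (vertices γ ─ F)) x y → Star (ClusterStep G inU forest₀ F) x y
          steps = Star.map λ (c , a , b) → clusterStep (x∈p─q⇒x∉q (vertices γ) F a) (x∈p─q⇒x∉q (vertices γ) F b) c
            (same-lab₀ (lose γ∈Γ (p─q⊆p (vertices γ) F a , p─q⊆p (vertices γ) F b)))

        self-attached : ∀ {u} → u Subset.∈ U D → u Subset.∉ F → Att u u
        self-attached u∈U u∉ = attached (inU⁺ u∈U) u∉ (near-self _) ε

        -- A vertex of `U` attached to the current vertex is carried along the path. At an edge with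
        -- an end in `U`, `attached-reach′` switches to that end. An edge without such an end is a
        -- segment avoiding `U`, hence lies in one cluster, and the attachment moves along with it.
        follow : ∀ {s t P a} → Walk (Inside G (∁ F)) s t P → PathRespects D P → Att s a →
                 ∃[ a′ ] (Reach G F σ a a′ × Att t a′)
        follow [-] _ at = _ , ε , at
        follow {s} {t} {P} {a} (_∷_ {y = y} {P = P′} (adj , s∈ , y∈) w) resp at = advance
          where
          s∉ = x∈∁p⇒x∉p s∈
          y∉ = x∈∁p⇒x∉p y∈
          sy : Adj G y s
          sy = subst T (Graph.sym G s y) adj

          continue : ∀ {b} → Reach G F σ a b → Att y b → ∃[ a′ ] (Reach G F σ a a′ × Att t a′)
          continue r at′ =
            let a′ , r′ , at″ = follow w (λ before v vs after e → resp (s ∷ before) v vs after (cong (s ∷_) e)) at′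
            in a′ , r ◅◅ r′ , at″

          inside-cluster : s Subset.∉ U D → y Subset.∉ U D → lab₀ s ≡ lab₀ y
          inside-cluster s∉U y∉U = same-lab₀ (first-two w)
            where
            first-two : Walk (Inside G (∁ F)) y t P′ → Any (λ γ → s Subset.∈ vertices γ × y Subset.∈ vertices γ) (Γ D)
            first-two [-] = Any.map (λ { (a ∷ b ∷ []) → a , b }) (resp [] s (y ∷ []) [] refl (s∉U ∷ y∉U ∷ []))
            first-two (_∷_ {P = P″} _ _) =
              Any.map (λ { (a ∷ b ∷ []) → a , b }) (resp [] s (y ∷ []) P″ refl (s∉U ∷ y∉U ∷ []))

          advance : ∃[ a′ ] (Reach G F σ a a′ × Att t a′)
          advance with s ∈? U D | y ∈? U D
          -- The edge between `s` and `y` attaches `y` to `s`, where `a` is attached as well.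
          ... | _       | yes y∈U = continue (attached-reach′ s∉ at (attached (inU⁺ y∈U) y∉ (near-adj sy) ε))
                                      (self-attached y∈U y∉)
          ... | yes s∈U | no _    = continue (attached-reach′ s∉ at (self-attached s∈U s∉))
                                      (attached (inU⁺ s∈U) s∉ (near-adj adj) ε)
          ... | no s∉U  | no y∉U  = walk-on at
            where
            same = inside-cluster s∉U y∉U
            walk-on : Att s a → ∃[ a′ ] (Reach G F σ a a′ × Att t a′)
            walk-on (attached ua a∉ near c) =
              continue ε (attached ua a∉ near (c ◅◅ clusterStep s∉ y∉ adj same ◅ ε))

        -- On a segment that avoids `B`, an edge can be good only by having equal labels at its
        -- ends; so the whole segment lies in one component of the forest.
        reach-respects : ∀ {a b} → a Subset.∉ F → Reach G F σ a b → Respects result a b F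
        reach-respects a∉ r =
          let P , p , l = star-path G (λ (step c d e f) → e , x∉p⇒x∈∁p c , x∉p⇒x∈∁p d) (x∉p⇒x∈∁p a∉) r
          in inj₂ ((P , p) , P , p , λ before v vs after e out →
            lose (∈-components v) (All.map ∈-component (same-labels (linked-prefix (v ∷ vs)
              (linked-suffix before (subst (Linked (Step G F σ)) e l))) out)))
          where
          same-labels : ∀ {v vs} → Linked (Step G F σ) (v ∷ vs) → All (Subset._∉ U result) (v ∷ vs) →
                        All (λ x → labels σ x ≡ labels σ v) (v ∷ vs)
          same-labels [-] _ = refl ∷ []
          same-labels (step _ _ _ g ∷ l) (a ∷ b ∷ as) =
            refl ∷ All.map (λ h → trans h (sym (good a b g))) (same-labels l (b ∷ as))
            where
            good : ∀ {x y} → x Subset.∉ U result → y Subset.∉ U result → Good σ x y → labels σ x ≡ labels σ y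
            good a b (inj₁ z)        = ⊥-elim (a (∈-tabulate⁺ (cong isZero z)))
            good a b (inj₂ (inj₁ z)) = ⊥-elim (b (∈-tabulate⁺ (cong isZero z)))
            good a b (inj₂ (inj₂ h)) = h

      result-respecting : ∀ (Q : TripletSet n) → IsRespectingDecomposition f Q D →
        IsRespectingDecomposition f (λ a b F → ∃[ s ] ∃[ t ] (Q s t F × InU D s F a × InU D t F b)) result
      result-respecting Q (admissible , respects) = adm , respects′
        where
        adm : Admissible f (λ a b F → ∃[ s ] ∃[ t ] (Q s t F × InU D s F a × InU D t F b))
        adm a b F (s , t , q , ha , hb) =
          let ∣F∣≤ , s∉ , t∉ = admissible s t F q
          in ∣F∣≤ , Attached.intact (U-attached F ∣F∣≤ refl s∉ ha) , Attached.intact (U-attached F ∣F∣≤ refl t∉ hb)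

        -- This carries a disconnection of `s` and `t` in G - F over to `a` and `b`.
        joined : ∀ {F s a} → ∣ F ∣ ≤ f → s Subset.∉ F → InU D s F a → Connected G (∁ F) s a
        joined {F} {s} {a} ∣F∣≤ s∉ h = to (U-attached F ∣F∣≤ refl s∉ h)
          where
          to : Attached G inU forest₀ F s a → Connected G (∁ F) s a
          to (attached {v} ua a∉ near c) =
            let P , p , _ = star-path G id (x∉p⇒x∈∁p a∉)
                              (first near (cluster-source G inU forest₀ F s∉ c) ◅◅ Star.map (λ (clusterStep x y z _) → z , x∉p⇒x∈∁p x , x∉p⇒x∈∁p y) c)
            in connected-sym (P , p)
            where
            first : ∀ {v} → Near a v → v Subset.∉ F → Star (Inside G (∁ F)) a v
            first {v} h v∉ with ∨-true (Graph.adj G a v) h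
            ... | inj₁ k = (≡⇒T k , x∉p⇒x∈∁p a∉ , x∉p⇒x∈∁p v∉) ◅ ε
            ... | inj₂ k = subst (Star _ a) (==-true k) ε

        respects′ : ∀ a b F → ∃[ s ] ∃[ t ] (Q s t F × InU D s F a × InU D t F b) → Respects result a b F
        respects′ a b F (s , t , q , ha , hb) with admissible s t F q
        ... | ∣F∣≤ , s∉ , t∉ with respects s t F q
        ...   | inj₁ disconnected = inj₁ λ c → disconnected
                  (connected-trans (joined ∣F∣≤ s∉ ha) (connected-trans c (connected-sym (joined ∣F∣≤ t∉ hb))))
        ...   | inj₂ (_ , P , p , pr) =
                  let at = U-attached F ∣F∣≤ refl s∉ ha
                      -- The vertex reached is attached to `t` but need not be `b`. Since `b` is
                      -- attached to `t` too, one more use of `attached-reach′` leads to `b`.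
                      a′ , r , at′ = follow F ∣F∣≤ (path-walk p) pr at
                  in reach-respects F ∣F∣≤ (Attached.intact at)
                       (r ◅◅ attached-reach′ F ∣F∣≤ t∉ at′ (U-attached F ∣F∣≤ refl t∉ hb))

-- Data representation

-- A unary number is itself a list to loop over, and `tl` is its predecessor.
unary : ℕ → Tree
unary zero    = nil
unary (suc k) = nil ∙ unary k

units : ∀ k → encodeList (map (λ _ → nil) (replicate k tt)) ≡ unary k
units zero    = refl
units (suc k) = cong (nil ∙_) (units k)

index : ∀ {n} → Fin n → Tree
index i = unary (toℕ i)

array : ∀ {n} → (Fin n → Tree) → Tree
array f = encodeList (List.tabulate f)

tlⁿ : ℕ → Tree → Tree
tlⁿ zero    t = t
tlⁿ (suc k) t = tlⁿ k (tl t)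

tlⁿ-unary : ∀ k m → tlⁿ k (unary m) ≡ unary (m ∸ k)
tlⁿ-unary zero    m       = refl
tlⁿ-unary (suc k) zero    = trans (tlⁿ-unary k 0) (cong unary (0∸n≡0 k))
tlⁿ-unary (suc k) (suc m) = tlⁿ-unary k m

tlⁿ-array : ∀ {n} (f : Fin n → Tree) i → hd (tlⁿ (toℕ i) (array f)) ≡ f i
tlⁿ-array f zero    = refl
tlⁿ-array f (suc i) = tlⁿ-array (f ∘ suc) i

foldl-units : ∀ {A : Set} (f : A → A) {v : ℕ → A} → (∀ k → v (suc k) ≡ f (v k)) →
              ∀ k → foldl (λ a (_ : ⊤) → f a) (v 0) (replicate k tt) ≡ v k
foldl-units f {v} h k = trans (go k 0) (cong v (+-identityʳ k))
  where
  go : ∀ k j → foldl (λ a (_ : ⊤) → f a) (v j) (replicate k tt) ≡ v (k + j)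
  go zero    j = refl
  go (suc k) j = trans (cong (λ a → foldl (λ a _ → f a) a (replicate k tt)) (sym (h j)))
                   (trans (go k (suc j)) (cong v (+-suc k j)))

foldl-tlⁿ : ∀ k t → foldl (λ s (_ : ⊤) → tl s) t (replicate k tt) ≡ tlⁿ k t
foldl-tlⁿ zero    t = refl
foldl-tlⁿ (suc k) t = foldl-tlⁿ k (tl t)

length-vertices↓ : ∀ {n} → length (vertices↓ {n}) ≡ n
length-vertices↓ {n} = trans (length-reverse (allFin n)) (length-tabulate id)

foldl-array : ∀ {n} (f : Fin n → Tree) → foldl (λ s i → f i ∙ s) nil vertices↓ ≡ array f
foldl-array {n} f = trans (reverse-foldl (λ s i → f i ∙ s) nil (allFin n)) (go n id)
  where
  go : ∀ m (g : Fin m → Fin n) → foldr (λ i s → f i ∙ s) nil (List.tabulate g) ≡ array (f ∘ g)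
  go zero    g = refl
  go (suc m) g = cong (f (g zero) ∙_) (go m (g ∘ suc))

≟-∸ : ∀ k l → isZero (k ∸ l) ∧ isZero (l ∸ k) ≡ does (k ℕ.≟ l)
≟-∸ zero    zero    = refl
≟-∸ zero    (suc l) = refl
≟-∸ (suc k) zero    = refl
≟-∸ (suc k) (suc l) = ≟-∸ k l

≟-toℕ : ∀ {n} (i j : Fin n) → does (toℕ i ℕ.≟ toℕ j) ≡ i == j
≟-toℕ i j with i Fin.≟ j
... | yes refl = dec-true (toℕ i ℕ.≟ toℕ i) refl
... | no ne    = dec-false (toℕ i ℕ.≟ toℕ j) (ne ∘ toℕ-injective)

-- Derived constructs

arg : ∀ m {k} {m<k : True (m ℕ.<? k)} → Tm k
arg m {m<k = m<k} = get (#_ m {m<n = m<k})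

truth : ∀ {k} → Tm k
truth = pair null null

_and_ _or_ : ∀ {k} → Tm k → Tm k → Tm k
t and u = ite t u null
t or u  = ite t truth u

negate isNil : ∀ {k} → Tm k → Tm k
negate t = ite t null truth
isNil t  = ite t null truth

-- On unary numbers `drop` is truncated subtraction, which yields comparison; on arrays it moves to
-- a position.
drop eqℕ look plus : ∀ {k} → Tm k → Tm k → Tm k
drop t i  = loop i t (right (arg 1))
eqℕ t u   = isNil (drop t u) and isNil (drop u t)
look a i  = left (drop a i)
plus t u  = loop t u (pair null (arg 1))

tab : ∀ {k} → Tm k → Tm (2 + k) → Tm k
tab r t = loop r null (pair t (arg 1))

infixr 5 _or_
infixr 6 _and_

module _ {P k : ℕ} {ρ : Vec Tree k} where

  ev-var : ∀ {x} → Ev P ρ (get x) (lookup ρ x)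
  ev-var = ev-get _

  ev-truth : Ev P ρ truth (encodeBool true)
  ev-truth = ev-pair ev-null ev-null

  ev-and : ∀ {t u a b} → Ev P ρ t (encodeBool a) → Ev P ρ u (encodeBool b) → Ev P ρ (t and u) (encodeBool (a ∧ b))
  ev-and {a = true}  e f = ev-then e f
  ev-and {a = false} e f = ev-else e ev-null

  ev-or : ∀ {t u a b} → Ev P ρ t (encodeBool a) → Ev P ρ u (encodeBool b) → Ev P ρ (t or u) (encodeBool (a ∨ b))
  ev-or {a = true}  e f = ev-then e ev-truth
  ev-or {a = false} e f = ev-else e f

  ev-not : ∀ {t a} → Ev P ρ t (encodeBool a) → Ev P ρ (negate t) (encodeBool (not a))
  ev-not {a = true}  e = ev-then e ev-null
  ev-not {a = false} e = ev-else e ev-truth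

  ev-isNil : ∀ {t m} → Ev P ρ t (unary m) → Ev P ρ (isNil t) (encodeBool (isZero m))
  ev-isNil {m = zero}  e = ev-else e ev-truth
  ev-isNil {m = suc m} e = ev-then e ev-null

module _ {P k : ℕ} {ρ : Vec Tree k} where

  ev-repeat : ∀ {B : Set} (encB : B → Tree) {f : B → B} {t u body m b} → m ≤ P →
              Ev P ρ t (unary m) → Ev P ρ u (encB b) →
              (∀ b → Ev P (nil ∷ encB b ∷ ρ) body (encB (f b))) →
              Ev P ρ (loop t u body) (encB (foldl (λ b (_ : ⊤) → f b) b (replicate m tt)))
  ev-repeat encB {m = m} h e₁ e₂ e₃ = ev-loop (λ _ → nil) encB (≤-trans (≤-reflexive (length-replicate m)) h)
    (ev-≡ (sym (units m)) e₁) e₂ (λ _ → e₃)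

  ev-drop : ∀ {t i v m} → m ≤ P → Ev P ρ t v → Ev P ρ i (unary m) → Ev P ρ (drop t i) (tlⁿ m v)
  ev-drop {v = v} {m} h e f = ev-≡ (foldl-tlⁿ m v) (ev-repeat id h f e (λ _ → ev-right ev-var))

  ev-monus : ∀ {t u a b} → b ≤ P → Ev P ρ t (unary a) → Ev P ρ u (unary b) → Ev P ρ (drop t u) (unary (a ∸ b))
  ev-monus {a = a} {b} h e f = ev-≡ (tlⁿ-unary b a) (ev-drop h e f)

  ev-eqℕ : ∀ {t u a b} → a ≤ P → b ≤ P → Ev P ρ t (unary a) → Ev P ρ u (unary b) →
           Ev P ρ (eqℕ t u) (encodeBool (does (a ℕ.≟ b)))
  ev-eqℕ {a = a} {b} h k e f = ev-≡ (cong encodeBool (≟-∸ a b))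
    (ev-and (ev-isNil (ev-monus k e f)) (ev-isNil (ev-monus h f e)))

  ev-plus : ∀ {t u a b} → a ≤ P → Ev P ρ t (unary a) → Ev P ρ u (unary b) → Ev P ρ (plus t u) (unary (a + b))
  ev-plus {a = a} {b} h e f = ev-≡ (cong unary (foldl-units suc {_+ b} (λ _ → refl) a))
    (ev-repeat unary h e f (λ _ → ev-pair ev-null ev-var))

  module _ {n : ℕ} (n≤ : n ≤ P) where

    private
      toℕ≤ : ∀ (i : Fin n) → toℕ i ≤ P
      toℕ≤ i = ≤-trans (<⇒≤ (toℕ<n i)) n≤

    ev-eq : ∀ {t u} {i j : Fin n} → Ev P ρ t (index i) → Ev P ρ u (index j) →
            Ev P ρ (eqℕ t u) (encodeBool (i == j))
    ev-eq {i = i} {j} e f = ev-≡ (cong encodeBool (≟-toℕ i j)) (ev-eqℕ (toℕ≤ i) (toℕ≤ j) e f)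

    ev-look : ∀ {t u} {f : Fin n → Tree} {i} → Ev P ρ t (array f) → Ev P ρ u (index i) → Ev P ρ (look t u) (f i)
    ev-look {f = f} {i} e e′ = ev-≡ (tlⁿ-array f i) (ev-left (ev-drop (toℕ≤ i) e e′))

    ev-for : ∀ {B : Set} (encB : B → Tree) {f : B → Fin n → B} {t u body b} →
             Ev P ρ t (encodeList (map index (vertices↓ {n}))) → Ev P ρ u (encB b) →
             (∀ i b → Ev P (index i ∷ encB b ∷ ρ) body (encB (f b i))) →
             Ev P ρ (loop t u body) (encB (foldl f b vertices↓))
    ev-for encB e₁ e₂ e₃ = ev-loop index encB (≤-trans (≤-reflexive length-vertices↓) n≤) e₁ e₂ e₃

    ev-tab : ∀ {t body} {f : Fin n → Tree} → Ev P ρ t (encodeList (map index (vertices↓ {n}))) →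
             (∀ i acc → Ev P (index i ∷ acc ∷ ρ) body (f i)) → Ev P ρ (tab t body) (array f)
    ev-tab {f = f} e₁ e₂ = ev-≡ (foldl-array f) (ev-for id e₁ ev-null (λ i acc → ev-pair (e₂ i acc) ev-var))

-- Procedures, each preceded by the names of its variables 0, 1, …

-- vertices, labels, u, w
mergeP : Tm 4
mergeP = tab (arg 0) (ite (eqℕ (look (arg 3) (arg 0)) (look (arg 3) (arg 5))) (look (arg 3) (arg 4)) (look (arg 3) (arg 0)))

-- vertices, edges, u, w
linkP : Tm 4
linkP = tab (arg 0) (tab (arg 2)
  (look (look (arg 5) (arg 2)) (arg 0)
   or eqℕ (arg 2) (arg 6) and eqℕ (arg 0) (arg 7)
   or eqℕ (arg 2) (arg 7) and eqℕ (arg 0) (arg 6)))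

-- vertices, forest, u, w
joinP : Tm 4
joinP = bind (left (arg 1)) (bind (right (arg 2))
  (ite (eqℕ (look (arg 1) (arg 4)) (look (arg 1) (arg 5))) (arg 3)
    (pair (call (# 2 ∷ # 1 ∷ # 4 ∷ # 5 ∷ []) mergeP) (call (# 2 ∷ # 0 ∷ # 4 ∷ # 5 ∷ []) linkP))))

-- vertices, capacities, u, w
spendP : Tm 4
spendP = tab (arg 0) (ite (eqℕ (arg 0) (arg 4) or eqℕ (arg 0) (arg 5)) (right (look (arg 3) (arg 0))) (look (arg 3) (arg 0)))

-- vertices, state, u, w
joinCappedP : Tm 4
joinCappedP =
  bind (left (arg 1)) (bind (right (arg 2)) (bind (left (arg 1)) (bind (right (arg 2))
    (ite (isNil (look (arg 2) (arg 6)) or isNil (look (arg 2) (arg 7)) or eqℕ (look (arg 1) (arg 6)) (look (arg 1) (arg 7)))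
      (arg 5)
      (pair (pair (call (# 4 ∷ # 1 ∷ # 6 ∷ # 7 ∷ []) mergeP) (call (# 4 ∷ # 0 ∷ # 6 ∷ # 7 ∷ []) linkP))
            (call (# 4 ∷ # 2 ∷ # 6 ∷ # 7 ∷ []) spendP))))))

-- vertices, clusters
clusterForestP : Tm 2
clusterForestP =
  loop (arg 1) (pair (tab (arg 0) (arg 0)) (tab (arg 0) (tab (arg 2) null)))
    (loop (arg 2) (arg 1)
      (loop (arg 4) (arg 1)
        (ite (look (look (right (arg 4)) (arg 2)) (arg 0)) (call (# 6 ∷ # 1 ∷ # 2 ∷ # 0 ∷ []) joinP) (arg 1))))

-- vertices, graph, labels, u, δ
touchesP : Tm 5
touchesP = loop (arg 0) null
  (arg 1 or (look (look (arg 3) (arg 5)) (arg 0) or eqℕ (arg 5) (arg 0)) and eqℕ (look (arg 4) (arg 0)) (arg 6))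

-- m, k
cycP : Tm 2
cycP = loop (arg 1) null (ite (arg 1) (right (arg 1)) (arg 2))

-- m, r₁, r₂, U, u
sampledVertexP : Tm 5
sampledVertexP = look (arg 3) (arg 4) and
  bind (call (# 0 ∷ # 4 ∷ []) cycP) (eqℕ (arg 0) (arg 2) or eqℕ (arg 0) (arg 3))

-- m, r₃, labels, δ
sampledClusterP : Tm 4
sampledClusterP = eqℕ (look (arg 2) (arg 3)) (arg 3) and eqℕ (call (# 0 ∷ # 3 ∷ []) cycP) (arg 1)

-- vertices, graph, U, labels, m, r₁, r₂, δ, u
sampledTouchesP : Tm 9
sampledTouchesP = call (# 4 ∷ # 5 ∷ # 6 ∷ # 2 ∷ # 8 ∷ []) sampledVertexP and
                  call (# 0 ∷ # 1 ∷ # 3 ∷ # 8 ∷ # 7 ∷ []) touchesP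

-- vertices, graph, U, labels, m, r₁, r₂, δ, π
mergeAroundP : Tm 9
mergeAroundP = loop (arg 0) (pair (arg 8) null) (loop (arg 2) (arg 1)
  (ite (call (# 4 ∷ # 5 ∷ # 6 ∷ # 7 ∷ # 8 ∷ # 9 ∷ # 10 ∷ # 11 ∷ # 2 ∷ []) sampledTouchesP and
        call (# 4 ∷ # 5 ∷ # 6 ∷ # 7 ∷ # 8 ∷ # 9 ∷ # 10 ∷ # 11 ∷ # 0 ∷ []) sampledTouchesP and
        negate (eqℕ (look (left (arg 1)) (arg 2)) (look (left (arg 1)) (arg 0))))
    (pair (bind (left (arg 1)) (call (# 5 ∷ # 0 ∷ # 3 ∷ # 1 ∷ []) mergeP)) truth)
    (arg 1)))

-- vertices, graph, U, labels, m, r₁, r₂, δ, state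
joinAroundP : Tm 9
joinAroundP = loop (arg 0) (arg 8) (loop (arg 2) (arg 1)
  (ite (call (# 8 ∷ # 9 ∷ # 10 ∷ # 6 ∷ # 2 ∷ []) sampledVertexP and
        (look (look (arg 5) (arg 2)) (arg 0) or eqℕ (arg 2) (arg 0)) and eqℕ (look (arg 7) (arg 0)) (arg 11))
    (call (# 4 ∷ # 1 ∷ # 2 ∷ # 0 ∷ []) joinCappedP)
    (arg 1)))

-- vertices, graph, U, labels, m, r₁, r₂, r₃, δ, (π, state)
visitP : Tm 10
visitP = ite (call (# 4 ∷ # 7 ∷ # 3 ∷ # 8 ∷ []) sampledClusterP)
  (bind (left (arg 9)) (bind (call (# 1 ∷ # 2 ∷ # 3 ∷ # 4 ∷ # 5 ∷ # 6 ∷ # 7 ∷ # 9 ∷ # 0 ∷ []) mergeAroundP)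
    (bind (right (arg 11))
      (pair (left (arg 1))
        (ite (right (arg 1))
          (call (# 3 ∷ # 4 ∷ # 5 ∷ # 6 ∷ # 7 ∷ # 8 ∷ # 9 ∷ # 11 ∷ # 0 ∷ []) joinAroundP)
          (arg 0))))))
  (arg 9)

-- vertices, graph, U, labels, m, r₁, r₂, r₃, state
sampleP : Tm 9
sampleP = right (loop (arg 0) (pair (tab (arg 0) (arg 0)) (arg 8))
  (call (# 2 ∷ # 3 ∷ # 4 ∷ # 5 ∷ # 6 ∷ # 7 ∷ # 8 ∷ # 9 ∷ # 0 ∷ # 1 ∷ []) visitP))

-- vertices, graph, U, labels, residues, state
samplesP : Tm 6
samplesP = loop (arg 4) (arg 5) (loop (arg 6) (arg 1) (loop (arg 8) (arg 1) (loop (arg 10) (arg 1)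
  (call (# 8 ∷ # 9 ∷ # 10 ∷ # 11 ∷ # 6 ∷ # 4 ∷ # 2 ∷ # 0 ∷ # 1 ∷ []) sampleP))))

-- vertices, state
outputP : Tm 2
outputP = bind (left (left (arg 1))) (bind (right (left (arg 2))) (bind (right (arg 3))
  (pair (tab (arg 3) (isNil (look (arg 2) (arg 0))))
    (loop (arg 3) null (ite (eqℕ (look (arg 4) (arg 0)) (arg 0))
      (pair (pair (tab (arg 5) (eqℕ (look (arg 6) (arg 0)) (arg 2)))
                  (tab (arg 5) (tab (arg 7) (look (look (arg 7) (arg 2)) (arg 0) and eqℕ (look (arg 8) (arg 2)) (arg 4)))))
            (arg 1))
      (arg 1))))))

-- Correctness of the procedures

module Correctness {P n : ℕ} (n≤ : n ≤ P) where

  encodeRange : Tree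
  encodeRange = encodeList (map index (vertices↓ {n}))

  encodeLabels : Labelling {n} → Tree
  encodeLabels l = array (λ x → index (l x))

  encodeMatrix : Matrix {n} → Tree
  encodeMatrix e = array (λ x → array (λ y → encodeBool (e x y)))

  encodeForest : Forest {n} → Tree
  encodeForest (l , e) = encodeLabels l ∙ encodeMatrix e

  encodeCapacities : (Fin n → ℕ) → Tree
  encodeCapacities c = array (λ x → unary (c x))

  encodeState : State {n} → Tree
  encodeState (σ , c) = encodeForest σ ∙ encodeCapacities c

  encodeVertices : (Fin n → Bool) → Tree
  encodeVertices p = array (λ x → encodeBool (p x))

  private
    R : Tree
    R = encodeRange

  ev-merge : ∀ u w l → Ev P (R ∷ encodeLabels l ∷ index u ∷ index w ∷ []) mergeP (encodeLabels (merge u w l))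
  ev-merge u w l = ev-tab n≤ ev-var λ x acc →
    ev-ite index (ev-eq n≤ (ev-look n≤ ev-var ev-var) (ev-look n≤ ev-var ev-var))
      (ev-look n≤ ev-var ev-var) (ev-look n≤ ev-var ev-var)

  ev-link : ∀ u w e → Ev P (R ∷ encodeMatrix e ∷ index u ∷ index w ∷ []) linkP (encodeMatrix (link u w e))
  ev-link u w e = ev-tab n≤ ev-var λ x _ → ev-tab n≤ ev-var λ y _ →
    ev-or (ev-look n≤ (ev-look n≤ ev-var ev-var) ev-var)
      (ev-or (ev-and (ev-eq n≤ ev-var ev-var) (ev-eq n≤ ev-var ev-var))
             (ev-and (ev-eq n≤ ev-var ev-var) (ev-eq n≤ ev-var ev-var)))

  ev-join : ∀ u w σ → Ev P (R ∷ encodeForest σ ∷ index u ∷ index w ∷ []) joinP (encodeForest (join u w σ))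
  ev-join u w (l , e) = ev-bind (ev-left ev-var) (ev-bind (ev-right ev-var)
    (ev-ite encodeForest (ev-eq n≤ (ev-look n≤ ev-var ev-var) (ev-look n≤ ev-var ev-var)) ev-var
      (ev-pair (ev-call (ev-merge u w l)) (ev-call (ev-link u w e)))))

  ev-spend : ∀ u w c → Ev P (R ∷ encodeCapacities c ∷ index u ∷ index w ∷ []) spendP (encodeCapacities (spend u w c))
  ev-spend u w c = ev-tab n≤ ev-var λ x _ →
    ev-ite unary (ev-or (ev-eq n≤ ev-var ev-var) (ev-eq n≤ ev-var ev-var))
      (ev-≡ (tl-unary (c x)) (ev-right (ev-look n≤ ev-var ev-var))) (ev-look n≤ ev-var ev-var)
    where
    tl-unary : ∀ k → tl (unary k) ≡ unary (pred k)
    tl-unary zero    = refl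
    tl-unary (suc k) = refl

  ev-joinCapped : ∀ u w σ → Ev P (R ∷ encodeState σ ∷ index u ∷ index w ∷ []) joinCappedP (encodeState (joinCapped u w σ))
  ev-joinCapped u w ((l , e) , c) =
    ev-bind (ev-left ev-var) (ev-bind (ev-right ev-var) (ev-bind (ev-left ev-var) (ev-bind (ev-right ev-var)
      (ev-ite encodeState
        (ev-or (ev-isNil (ev-look n≤ ev-var ev-var)) (ev-or (ev-isNil (ev-look n≤ ev-var ev-var))
          (ev-eq n≤ (ev-look n≤ ev-var ev-var) (ev-look n≤ ev-var ev-var))))
        ev-var
        (ev-pair (ev-pair (ev-call (ev-merge u w l)) (ev-call (ev-link u w e))) (ev-call (ev-spend u w c)))))))

  encodeClusterMatrix : Cluster n → Tree
  encodeClusterMatrix γ = encodeSubset (vertices γ) ∙ encodeMatrix (Graph.adj (tree γ))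

  ev-clusterForest : ∀ Γ → length Γ ≤ P →
    Ev P (R ∷ encodeList (map encodeClusterMatrix Γ) ∷ []) clusterForestP (encodeForest (clusterForest Γ))
  ev-clusterForest Γ h = ev-loop encodeClusterMatrix encodeForest h ev-var
    (ev-pair (ev-tab n≤ ev-var λ _ _ → ev-var) (ev-tab n≤ ev-var λ _ _ → ev-tab n≤ ev-var λ _ _ → ev-null))
    λ γ σ → ev-for n≤ encodeForest ev-var ev-var λ u σ → ev-for n≤ encodeForest ev-var ev-var λ w σ →
      ev-ite encodeForest (ev-look n≤ (ev-look n≤ (ev-right ev-var) ev-var) ev-var) (ev-call (ev-join u w σ)) ev-var

  encodeFlagged : Labelling {n} × Bool → Tree
  encodeFlagged (π , b) = encodeLabels π ∙ encodeBool b

  encodeVisited : Labelling {n} × State {n} → Tree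
  encodeVisited (π , σ) = encodeLabels π ∙ encodeState σ

  module _ (adj : Matrix {n}) (inU : Fin n → Bool) (lab₀ : Labelling {n}) where

    open Sampling adj inU lab₀

    private
      G V L₀ : Tree
      G  = encodeMatrix adj
      V  = encodeVertices inU
      L₀ = encodeLabels lab₀

    ev-touches : ∀ u δ → Ev P (R ∷ G ∷ L₀ ∷ index u ∷ index δ ∷ []) touchesP (encodeBool (touches u δ))
    ev-touches u δ = ev-for n≤ encodeBool ev-var ev-null λ w b →
      ev-or ev-var (ev-and (ev-or (ev-look n≤ (ev-look n≤ ev-var ev-var) ev-var) (ev-eq n≤ ev-var ev-var))
        (ev-eq n≤ (ev-look n≤ ev-var ev-var) ev-var))

    ev-cyc : ∀ m (k : Fin n) → Ev P (unary m ∷ index k ∷ []) cycP (unary (cyc m (toℕ k)))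
    ev-cyc m k = ev-≡ (cong unary (foldl-units (next m) {cyc m} (λ _ → refl) (toℕ k)))
      (ev-repeat unary (≤-trans (<⇒≤ (toℕ<n k)) n≤) ev-var ev-null ev-next)
      where
      ev-next : ∀ c → Ev P (nil ∷ unary c ∷ unary m ∷ index k ∷ []) (ite (arg 1) (right (arg 1)) (arg 2)) (unary (next m c))
      ev-next zero    = ev-else ev-var ev-var
      ev-next (suc c) = ev-then ev-var (ev-right ev-var)

    module _ {m r₁ r₂ r₃ : ℕ} (m≤ : m ≤ P) (r₁≤ : r₁ ≤ P) (r₂≤ : r₂ ≤ P) (r₃≤ : r₃ ≤ P) where

      private
        cyc≤ : ∀ k → cyc m k ≤ P
        cyc≤ k = ≤-trans (cyc-≤ m k) m≤

      ev-sampledVertex : ∀ u → Ev P (unary m ∷ unary r₁ ∷ unary r₂ ∷ V ∷ index u ∷ []) sampledVertexP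
                                 (encodeBool (sampledVertex m r₁ r₂ r₃ u))
      ev-sampledVertex u = ev-and (ev-look n≤ ev-var ev-var) (ev-bind (ev-call (ev-cyc m u))
        (ev-or (ev-eqℕ (cyc≤ (toℕ u)) r₁≤ ev-var ev-var) (ev-eqℕ (cyc≤ (toℕ u)) r₂≤ ev-var ev-var)))

      ev-sampledCluster : ∀ δ → Ev P (unary m ∷ unary r₃ ∷ L₀ ∷ index δ ∷ []) sampledClusterP
                                  (encodeBool (sampledCluster m r₁ r₂ r₃ δ))
      ev-sampledCluster δ = ev-and (ev-eq n≤ (ev-look n≤ ev-var ev-var) ev-var)
        (ev-eqℕ (cyc≤ (toℕ δ)) r₃≤ (ev-call (ev-cyc m δ)) ev-var)

      ev-sampledTouches : ∀ δ u →
        Ev P (R ∷ G ∷ V ∷ L₀ ∷ unary m ∷ unary r₁ ∷ unary r₂ ∷ index δ ∷ index u ∷ []) sampledTouchesP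
          (encodeBool (sampledTouches m r₁ r₂ r₃ δ u))
      ev-sampledTouches δ u = ev-and (ev-call (ev-sampledVertex u)) (ev-call (ev-touches u δ))

      ev-mergeAround : ∀ δ π →
        Ev P (R ∷ G ∷ V ∷ L₀ ∷ unary m ∷ unary r₁ ∷ unary r₂ ∷ index δ ∷ encodeLabels π ∷ []) mergeAroundP
          (encodeFlagged (mergeAround m r₁ r₂ r₃ δ π))
      ev-mergeAround δ π = ev-for n≤ encodeFlagged ev-var (ev-pair ev-var ev-null) λ u p →
        ev-for n≤ encodeFlagged ev-var ev-var λ { u′ (π , b) →
          ev-ite encodeFlagged
            (ev-and (ev-call (ev-sampledTouches δ u)) (ev-and (ev-call (ev-sampledTouches δ u′))
              (ev-not (ev-eq n≤ (ev-look n≤ (ev-left ev-var) ev-var) (ev-look n≤ (ev-left ev-var) ev-var)))))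
            (ev-pair (ev-bind (ev-left ev-var) (ev-call (ev-merge u u′ π))) ev-truth)
            ev-var }

      ev-joinAround : ∀ δ σ →
        Ev P (R ∷ G ∷ V ∷ L₀ ∷ unary m ∷ unary r₁ ∷ unary r₂ ∷ index δ ∷ encodeState σ ∷ []) joinAroundP
          (encodeState (joinAround m r₁ r₂ r₃ δ σ))
      ev-joinAround δ σ = ev-for n≤ encodeState ev-var ev-var λ u σ → ev-for n≤ encodeState ev-var ev-var λ w σ →
        ev-ite encodeState
          (ev-and (ev-call (ev-sampledVertex u))
            (ev-and (ev-or (ev-look n≤ (ev-look n≤ ev-var ev-var) ev-var) (ev-eq n≤ ev-var ev-var))
              (ev-eq n≤ (ev-look n≤ ev-var ev-var) ev-var)))
          (ev-call (ev-joinCapped u w σ)) ev-var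

      ev-visit : ∀ δ p →
        Ev P (R ∷ G ∷ V ∷ L₀ ∷ unary m ∷ unary r₁ ∷ unary r₂ ∷ unary r₃ ∷ index δ ∷ encodeVisited p ∷ []) visitP
          (encodeVisited (visit m r₁ r₂ r₃ p δ))
      ev-visit δ (π , σ) = ev-ite encodeVisited (ev-call (ev-sampledCluster δ))
        (ev-bind (ev-left ev-var) (ev-bind (ev-call (ev-mergeAround δ π)) (ev-bind (ev-right ev-var)
          (ev-pair (ev-left ev-var) (ev-ite encodeState (ev-right ev-var) (ev-call (ev-joinAround δ σ)) ev-var)))))
        ev-var

      ev-sample : ∀ σ →
        Ev P (R ∷ G ∷ V ∷ L₀ ∷ unary m ∷ unary r₁ ∷ unary r₂ ∷ unary r₃ ∷ encodeState σ ∷ []) sampleP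
          (encodeState (sample m r₁ r₂ r₃ σ))
      ev-sample σ = ev-right (ev-for n≤ encodeVisited ev-var (ev-pair (ev-tab n≤ ev-var (λ _ _ → ev-var)) ev-var)
        λ δ p → ev-call (ev-visit δ p))

    ev-samples : ∀ {M} → M ≤ P → ∀ σ →
      Ev P (R ∷ G ∷ V ∷ L₀ ∷ encodeList (map unary (downFrom M)) ∷ encodeState σ ∷ []) samplesP
        (encodeState (samples M σ))
    ev-samples {M} M≤ σ =
      ev-residues ev-var ev-var λ { m m≤ σ → ev-residues ev-var ev-var λ { r₁ r₁≤ σ →
        ev-residues ev-var ev-var λ { r₂ r₂≤ σ → ev-residues ev-var ev-var λ { r₃ r₃≤ σ →
          ev-call (ev-sample m≤ r₁≤ r₂≤ r₃≤ σ) } } } }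
      where
      ev-residues : ∀ {k} {ρ : Vec Tree k} {f : State → ℕ → State} {t u body σ} →
        Ev P ρ t (encodeList (map unary (downFrom M))) → Ev P ρ u (encodeState σ) →
        (∀ r → r ≤ P → ∀ σ → Ev P (unary r ∷ encodeState σ ∷ ρ) body (encodeState (f σ r))) →
        Ev P ρ (loop t u body) (encodeState (foldl f σ (downFrom M)))
      -- The body requires `r ≤ P`, which is known only for members of the range; hence the loop
      -- rule with `All`.
      ev-residues {f = f} e₁ e₂ e₃ = ev-loop-all unary encodeState
        (≤-trans (≤-reflexive (length-downFrom M)) M≤) e₁ e₂
        (All.tabulate λ r∈ σ → e₃ _ (≤-trans (<⇒≤ (∈-downFrom⁻ r∈)) M≤) σ)

  encodeOutput : State {n} → Tree
  encodeOutput ((l , e) , c) = encodeVertices (λ x → isZero (c x)) ∙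
    encodeList (foldl (λ acc z → Bool.if l z == z
      then (encodeVertices (λ x → l x == z) ∙ encodeMatrix (λ x y → e x y ∧ l x == z)) ∷ acc else acc) [] vertices↓)

  ev-output : ∀ σ → Ev P (R ∷ encodeState σ ∷ []) outputP (encodeOutput σ)
  ev-output ((l , e) , c) = ev-bind (ev-left (ev-left ev-var)) (ev-bind (ev-right (ev-left ev-var)) (ev-bind (ev-right ev-var)
    (ev-pair (ev-tab n≤ ev-var λ x _ → ev-isNil (ev-look n≤ ev-var ev-var))
      (ev-for n≤ encodeList ev-var ev-null λ z acc →
        ev-ite encodeList (ev-eq n≤ (ev-look n≤ ev-var ev-var) ev-var)
          (ev-pair (ev-pair (ev-tab n≤ ev-var λ x _ → ev-eq n≤ (ev-look n≤ ev-var ev-var) ev-var)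
                            (ev-tab n≤ ev-var λ x _ → ev-tab n≤ ev-var λ y _ →
                              ev-and (ev-look n≤ (ev-look n≤ ev-var ev-var) ev-var)
                                     (ev-eq n≤ (ev-look n≤ ev-var ev-var) ev-var)))
                   ev-var)
          ev-var))))

-- Arithmetic procedures and the main program

weaken : ∀ {k} → Tm k → Tm (suc k)
weaken t = call (tabulate suc) t

-- x, y
timesP : Tm 2
timesP = loop (arg 0) null (plus (arg 3) (arg 1))

times : ∀ {k} → Tm k → Tm k → Tm k
times t u = bind t (bind (weaken u) (call (# 1 ∷ # 0 ∷ []) timesP))

numeral : ∀ {k} → ℕ → Tm k
numeral zero    = null
numeral (suc m) = pair null (numeral m)

-- a list
lengthP rangeP : Tm 1
lengthP = loop (arg 0) null (pair null (arg 1))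
rangeP  = right (loop (arg 0) (pair null null)
            (pair (pair null (left (arg 1))) (pair (left (arg 1)) (right (arg 1)))))

-- cap, bits
cappedP : Tm 2
cappedP = loop (loop (arg 1) null (pair (arg 0) (arg 1))) null
  (bind (pair null (ite (arg 0) (pair null (plus (arg 1) (arg 1))) (plus (arg 1) (arg 1))))
    (drop (arg 3) (drop (arg 3) (arg 0))))

-- n
logP : Tm 1
logP = right (loop (arg 0) (pair (pair null null) null)
  (ite (isNil (drop (arg 2) (left (arg 1)))) (arg 1)
    (pair (plus (left (arg 1)) (left (arg 1))) (pair null (right (arg 1))))))

-- f, log n
roundsP : Tm 2
roundsP = pair null (pair null (times (times (arg 0) (numeral 3)) (arg 1)))

-- τ, M
limitP : Tm 2
limitP = times (arg 0) (times (numeral 2) (pair null (times (arg 1) (times (arg 1) (times (arg 1) (arg 1))))))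

-- vertices, graph, decomposition, M, s
solveP : Tm 5
solveP =
  bind (left (arg 2))
  (bind (right (arg 3))
  (bind (call (# 2 ∷ # 0 ∷ []) clusterForestP)
  (bind (left (arg 0))
  (bind (pair (arg 1) (tab (arg 4) (arg 10)))
  (bind (call (# 8 ∷ []) rangeP)
  (bind (call (# 6 ∷ # 7 ∷ # 5 ∷ # 2 ∷ # 0 ∷ # 1 ∷ []) samplesP)
  (call (# 7 ∷ # 0 ∷ []) outputP)))))))

-- graph, f, decomposition, τ
mainP : Tm 4
mainP =
  bind (call (# 0 ∷ []) lengthP)
  (bind (call (# 1 ∷ []) rangeP)
  (bind (pair null (arg 1))
  (bind (call (# 0 ∷ # 4 ∷ []) cappedP)
  (bind (call (# 1 ∷ # 7 ∷ []) cappedP)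
  (bind (call (# 4 ∷ []) logP)
  (bind (call (# 2 ∷ # 0 ∷ []) roundsP)
  (bind (call (# 2 ∷ # 0 ∷ []) limitP)
  (call (# 6 ∷ # 8 ∷ # 10 ∷ # 1 ∷ # 0 ∷ []) solveP))))))))

algorithm : Tm 1
algorithm =
  bind (left (arg 0))
  (bind (left (right (arg 1)))
  (bind (left (right (right (arg 2))))
  (bind (right (right (right (arg 3))))
  (call (# 3 ∷ # 2 ∷ # 1 ∷ # 0 ∷ []) mainP))))

-- Numbers

bits : ℕᵇ → List Bool
bits zero     = []
bits 2[1+ b ] = true ∷ bits b
bits 1+[2 b ] = false ∷ bits b

encode-bits : ∀ b → encodeℕᵇ b ≡ encodeList (map encodeBool (bits b))
encode-bits zero     = refl
encode-bits 2[1+ b ] = cong (encodeBool true ∙_) (encode-bits b)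
encode-bits 1+[2 b ] = cong (encodeBool false ∙_) (encode-bits b)

-- The Horner step of bijective binary notation: 2 v + 2 or 2 v + 1.
digit : Bool → ℕ → ℕ
digit b v = suc (Bool.if b then suc (v + v) else v + v)

∸∸≡⊓ : ∀ K v → K ∸ (K ∸ v) ≡ K ⊓ v
∸∸≡⊓ K v with ≤-total v K
... | inj₁ v≤K = trans (m∸[m∸n]≡n v≤K) (sym (m≥n⇒m⊓n≡n v≤K))
... | inj₂ K≤v = trans (cong (K ∸_) (m≤n⇒m∸n≡0 K≤v)) (sym (m≤n⇒m⊓n≡m K≤v))

digit-grows : ∀ b v → v ≤ digit b v
digit-grows true  v = m≤n⇒m≤1+n (m≤n⇒m≤1+n (m≤m+n v v))
digit-grows false v = m≤n⇒m≤1+n (m≤m+n v v)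

digit-≤ : ∀ b {v K} → v ≤ K → digit b v ≤ 2 + (K + K)
digit-≤ true  h = s≤s (s≤s (+-mono-≤ h h))
digit-≤ false h = s≤s (m≤n⇒m≤1+n (+-mono-≤ h h))

-- Once `v` reaches `K`, both sides equal `K`, because a digit never decreases the value. This
-- permits truncation after every digit.
⊓-digit : ∀ K b v → K ⊓ digit b (K ⊓ v) ≡ K ⊓ digit b v
⊓-digit K b v with ≤-total v K
... | inj₁ v≤K = cong (λ z → K ⊓ digit b z) (m≥n⇒m⊓n≡n v≤K)
... | inj₂ K≤v = trans (cong (λ z → K ⊓ digit b z) (m≤n⇒m⊓n≡m K≤v))
  (trans (m≤n⇒m⊓n≡m (digit-grows b K)) (sym (m≤n⇒m⊓n≡m (≤-trans K≤v (digit-grows b v)))))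

-- A number given in binary may be exponential in the size of the input, too large to be written in
-- unary; so it is truncated at `K` after every digit. The double subtraction is the minimum with
-- `K`, and the reversal lets Horner's scheme begin at the most significant digit.
capped : ℕ → List Bool → ℕ
capped K bs = foldl (λ v b → K ∸ (K ∸ digit b v)) 0 (reverse bs)

capped-bits : ∀ K b → capped K (bits b) ≡ K ⊓ ℕᵇ.toℕ b
capped-bits K b = trans (reverse-foldl (λ v b → K ∸ (K ∸ digit b v)) 0 (bits b)) (go b)
  where
  cap-digit : ∀ c {v w} → v ≡ K ⊓ w → K ∸ (K ∸ digit c v) ≡ K ⊓ digit c w
  cap-digit c {w = w} refl = trans (∸∸≡⊓ K (digit c (K ⊓ w))) (⊓-digit K c w)

  go : ∀ b → foldr (λ b v → K ∸ (K ∸ digit b v)) 0 (bits b) ≡ K ⊓ ℕᵇ.toℕ b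
  go zero     = sym (⊓-zeroʳ K)
  go 2[1+ b ] = trans (cap-digit true (go b)) (cong (K ⊓_) (double-suc (ℕᵇ.toℕ b)))
    where
    double-suc : ∀ v → suc (suc (v + v)) ≡ 2 * suc v
    double-suc v = cong suc (trans (sym (+-suc v v)) (cong (v +_) (sym (+-identityʳ (suc v)))))
  go 1+[2 b ] = trans (cap-digit false (go b)) (cong (λ z → K ⊓ suc (ℕᵇ.toℕ b + z)) (sym (+-identityʳ (ℕᵇ.toℕ b))))

module _ {P k : ℕ} {ρ : Vec Tree k} where

  ev-weaken : ∀ {t v w} → Ev P ρ t v → Ev P (w ∷ ρ) (weaken t) v
  ev-weaken {t} {v} {w} e = ev-call (subst (λ ρ → Ev P ρ t v) (sym shifted) e)
    where
    shifted : Vec.map (lookup (w ∷ ρ)) (tabulate suc) ≡ ρ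
    shifted = trans (sym (tabulate-∘ (lookup (w ∷ ρ)) suc)) (tabulate∘lookup ρ)

  ev-numeral : ∀ m → Ev P ρ (numeral m) (unary m)
  ev-numeral zero    = ev-null
  ev-numeral (suc m) = ev-pair ev-null (ev-numeral m)

-- Only the operands are looped over, so the product need not stay below `P`.
ev-times : ∀ {P k} {ρ : Vec Tree k} {t u a b} → a ≤ P → b ≤ P → Ev P ρ t (unary a) → Ev P ρ u (unary b) →
           Ev P ρ (times t u) (unary (a * b))
ev-times {a = a} {b} h h′ e f = ev-bind e (ev-bind (ev-weaken f) (ev-call
  (ev-≡ (cong unary (foldl-units (b +_) {_* b} (λ _ → refl) a))
    (ev-repeat unary h ev-var ev-null (λ c → ev-plus h′ ev-var ev-var)))))

foldl-suc : ∀ {A : Set} (xs : List A) → foldl (λ c _ → suc c) 0 xs ≡ length xs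
foldl-suc xs = trans (go xs 0) (+-identityʳ (length xs))
  where
  go : ∀ xs c → foldl (λ c _ → suc c) c xs ≡ length xs + c
  go []       c = refl
  go (x ∷ xs) c = trans (go xs (suc c)) (+-suc (length xs) c)

module _ {P : ℕ} where

  ev-length : ∀ xs → length xs ≤ P → Ev P (encodeList xs ∷ []) lengthP (unary (length xs))
  ev-length xs h = ev-≡ (cong unary (foldl-suc xs))
    (ev-loop id unary h (ev-≡ (cong encodeList (sym (map-id xs))) ev-var) ev-null
      (λ _ _ → ev-pair ev-null ev-var))
  encodeCountdown : ℕ → Tree
  encodeCountdown m = unary m ∙ encodeList (map unary (downFrom m))

  ev-range : ∀ xs → length xs ≤ P → Ev P (encodeList xs ∷ []) rangeP (encodeList (map unary (downFrom (length xs))))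
  ev-range xs h = ev-≡ (cong (λ m → encodeList (map unary (downFrom m))) (foldl-suc xs))
    (ev-right (ev-loop id encodeCountdown {f = λ c _ → suc c} h (ev-≡ (cong encodeList (sym (map-id xs))) ev-var)
      (ev-pair ev-null ev-null)
      (λ _ _ → ev-pair (ev-pair ev-null (ev-left ev-var)) (ev-pair (ev-left ev-var) (ev-right ev-var)))))
  units′ : ∀ m → encodeList (replicate m nil) ≡ unary m
  units′ zero    = refl
  units′ (suc m) = cong (nil ∙_) (units′ m)

  ev-range-unary : ∀ m → m ≤ P → Ev P (unary m ∷ []) rangeP (encodeList (map unary (downFrom m)))
  ev-range-unary m h = subst₂ (λ v j → Ev P (v ∷ []) rangeP (encodeList (map unary (downFrom j))))
    (units′ m) (length-replicate m)
    (ev-range (replicate m nil) (≤-trans (≤-reflexive (length-replicate m)) h))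

  -- Between digits the value is at most `K`, hence at most 2 + 2 K before it is truncated; the
  -- subtraction loops over that many units.
  ev-capped : ∀ K bs → length bs ≤ P → 2 + (K + K) ≤ P →
              Ev P (unary K ∷ encodeList (map encodeBool bs) ∷ []) cappedP (unary (capped K bs))
  ev-capped K bs hb hK = ev-loop-inv encodeBool unary (_≤ K) {xs = reverse bs}
    (≤-trans (≤-reflexive (length-reverse bs)) hb) z≤n
    (All.universal (λ b v v≤K → m∸n≤m K (K ∸ digit b v) ,
      ev-bind (ev-pair ev-null (ev-ite unary ev-var
          (ev-pair ev-null (ev-plus (≤-trans v≤K K≤P) ev-var ev-var)) (ev-plus (≤-trans v≤K K≤P) ev-var ev-var)))
        (ev-monus (≤-trans (m∸n≤m K (digit b v)) K≤P) ev-var (ev-monus (≤-trans (digit-≤ b v≤K) hK) ev-var ev-var)))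
      (reverse bs))
    (ev-loop encodeBool (λ bs → encodeList (map encodeBool bs)) {f = λ acc b → b ∷ acc} hb ev-var ev-null
      (λ _ _ → ev-pair ev-var ev-var))
    ev-null
    where
    K≤P : K ≤ P
    K≤P = ≤-trans (≤-trans (m≤m+n K K) (m≤n+m (K + K) 2)) hK

  encodePair : ℕ × ℕ → Tree
  encodePair (p , L) = unary p ∙ unary L

  ev-log : ∀ n → 2 + (n + n) ≤ P → Ev P (unary n ∷ []) logP (unary (log↑ n))
  ev-log n h = ev-right (ev-loop-inv (λ _ → nil) encodePair {f = λ s _ → double n s}
    -- A doubling happens only while p < n; the additional 1 admits the start value 1 when n = 0.
    (λ (p , _) → p ≤ suc (n + n)) (≤-trans (≤-reflexive (length-replicate n)) n≤P) (s≤s z≤n)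
    (All.universal (λ _ (p , L) p≤ → bounded p L p≤ ,
        ev-ite encodePair {x = p , L} {p + p , suc L}
          (ev-isNil (ev-monus {a = n} {p} (≤-trans p≤ (≤-trans (n≤1+n _) h)) ev-var (ev-left ev-var)))
          ev-var
          (ev-pair (ev-plus (≤-trans p≤ (≤-trans (n≤1+n _) h)) (ev-left ev-var) (ev-left ev-var))
                   (ev-pair ev-null (ev-right ev-var))))
      (replicate n tt))
    (ev-≡ (sym (units n)) ev-var) (ev-pair (ev-pair ev-null ev-null) ev-null))
    where
    n≤P : n ≤ P
    n≤P = ≤-trans (≤-trans (m≤m+n n n) (m≤n+m (n + n) 2)) h

    bounded : ∀ p L → p ≤ suc (n + n) → proj₁ (double n (p , L)) ≤ suc (n + n)
    bounded p L p≤ = if-elim (λ s → proj₁ s ≤ suc (n + n)) (isZero (n ∸ p)) (λ _ → p≤) (λ z →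
      let p<n = ≰⇒> {n} {p} (λ n≤p → case trans (sym z) (cong isZero (m≤n⇒m∸n≡0 {n} {p} n≤p)) of λ ())
      in m≤n⇒m≤1+n (+-mono-≤ {p} {n} {p} {n} (<⇒≤ p<n) (<⇒≤ p<n)))

-- Encodings

encode-vec : ∀ {A : Set} {n} (enc : A → Tree) (f : Fin n → A) →
             encodeList (map enc (toList (tabulate f))) ≡ array (enc ∘ f)
encode-vec {n = zero}  enc f = refl
encode-vec {n = suc n} enc f = cong (enc (f zero) ∙_) (encode-vec enc (f ∘ suc))

array-cong : ∀ {n} {f h : Fin n → Tree} → (∀ i → f i ≡ h i) → array f ≡ array h
array-cong e = cong encodeList (tabulate-cong e)

encode-tabulate : ∀ {n} (p : Fin n → Bool) → encodeSubset (tabulate p) ≡ array (λ x → encodeBool (p x))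
encode-tabulate = encode-vec encodeBool

encode-subset : ∀ {n} (S : Subset n) → encodeSubset S ≡ array (λ x → encodeBool (lookup S x))
encode-subset S = trans (cong encodeSubset (sym (tabulate∘lookup S))) (encode-tabulate (lookup S))

encode-graph : ∀ {n} (G : Graph n) → encodeGraph G ≡ array (λ x → array (λ y → encodeBool (Graph.adj G x y)))
encode-graph G = trans (cong encodeList (map-tabulate id (λ u → encodeSubset (Graph.neighbours G u))))
                   (array-cong (λ u → encode-tabulate (Graph.adj G u)))

encode-range : ∀ {n} → map unary (downFrom n) ≡ map index (vertices↓ {n})
encode-range {n} = sym (begin
  map index (reverse (allFin n))            ≡⟨ map-∘ (reverse (allFin n)) ⟩
  map unary (map toℕ (reverse (allFin n)))  ≡⟨ cong (map unary) (reverse-map toℕ (allFin n)) ⟩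
  map unary (reverse (map toℕ (allFin n)))  ≡⟨ cong (map unary ∘ reverse) (trans (map-tabulate id toℕ) (go n id)) ⟩
  map unary (reverse (upTo n))              ≡⟨ cong (map unary) (reverse-upTo n) ⟩
  map unary (downFrom n)                    ∎)
  where
  open ≡-Reasoning
  go : ∀ m (h : ℕ → ℕ) → List.tabulate {n = m} (h ∘ toℕ) ≡ applyUpTo h m
  go zero    h = refl
  go (suc m) h = cong (h 0 ∷_) (go m (h ∘ suc))

-- Parameters and the run on an actual input

opaque
  -- `rounds` gives M: as common multiples of 1, ..., M are at least 2^(M-1), M - 1 must exceed the
  -- exponent 3 f L that bounds the product to be avoided, hence the 2. `limit` gives s, chosen so
  -- that the factor 2 (1 + M⁴) in `result-size` cancels.
  rounds limit : ℕ → ℕ → ℕ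
  rounds f L = 2 + f * 3 * L
  limit τ M  = τ * (2 * suc (M * (M * (M * M))))

  rounds-def : ∀ f L → rounds f L ≡ 2 + f * 3 * L
  rounds-def f L = refl

  limit-def : ∀ τ M → limit τ M ≡ τ * (2 * suc (M * (M * (M * M))))
  limit-def τ M = refl

ev-rounds : ∀ {P f L} → f ≤ P → 3 ≤ P → f * 3 ≤ P → L ≤ P →
            Ev P (unary f ∷ unary L ∷ []) roundsP (unary (rounds f L))
ev-rounds {f = f} {L} hf h3 hf3 hL = ev-≡ (cong unary (sym (rounds-def f L)))
  (ev-pair ev-null (ev-pair ev-null (ev-times hf3 hL (ev-times hf h3 ev-var (ev-numeral 3)) ev-var)))

ev-limit : ∀ {P τ M} → τ ≤ P → 2 ≤ P → 2 * suc (M * (M * (M * M))) ≤ P → M * (M * M) ≤ P → M * M ≤ P → M ≤ P →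
           Ev P (unary τ ∷ unary M ∷ []) limitP (unary (limit τ M))
ev-limit {τ = τ} {M} hτ h2 large M³≤ M²≤ M≤ = ev-≡ (cong unary (sym (limit-def τ M)))
  (ev-times hτ large ev-var (ev-times h2 (≤-trans (m≤m+n _ _) large) (ev-numeral 2)
    (ev-pair ev-null (ev-times M≤ M³≤ ev-var (ev-times M≤ M²≤ ev-var (ev-times M≤ M≤ ev-var ev-var))))))

module Execution {n : ℕ} (G : Graph n) (f : ℕ) (D : Decomposition G) (τ : ℕ) where

  -- Both `f` and `τ` arrive in binary and are capped to keep the loops polynomial. The cap must
  -- exceed n for the sake of `τ`: a capped `τ` then forces `B` to be empty, see `size-bound`.
  K f′ τ′ L M s : ℕ
  K  = suc n
  f′ = K ⊓ f
  τ′ = K ⊓ τ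
  L  = log↑ n
  M  = rounds f′ L
  s  = limit τ′ M

  open Result G D M s using (result; σ; inU; lab₀; forest)
  open Components G forest

  module _ {P : ℕ} (small : 4 + 3 * (n + n) ≤ P) (large : 2 * suc (M * (M * (M * M))) ≤ P)
           (f-bits : length (bits (fromℕ f)) ≤ P) (τ-bits : length (bits (fromℕ τ)) ≤ P)
           (clusters : length (Γ D) ≤ P) where

    private
      grow : ∀ k → k ≤ M * k
      grow k = subst (λ M → k ≤ M * k) (sym (rounds-def f′ L)) (m≤m+n k _)

      M⁴≤ : M * (M * (M * M)) ≤ P
      M⁴≤ = ≤-trans (≤-trans (n≤1+n _) (m≤m+n _ _)) large
      M³≤ : M * (M * M) ≤ P
      M³≤ = ≤-trans (grow _) M⁴≤
      M²≤ : M * M ≤ P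
      M²≤ = ≤-trans (grow _) M³≤
      M≤ : M ≤ P
      M≤ = ≤-trans (grow M) M²≤

      n≤ : n ≤ P
      n≤ = ≤-trans (≤-trans (m≤m+n n n) (≤-trans (m≤m+n (n + n) _) (m≤n+m _ 4))) small

      K≤ : 2 + (K + K) ≤ P
      K≤ = ≤-trans (≤-reflexive (cong (3 +_) (+-suc n n))) (≤-trans (+-monoʳ-≤ 4 (m≤m+n (n + n) _)) small)

      K≤P : K ≤ P
      K≤P = ≤-trans (≤-trans (m≤m+n K K) (m≤n+m _ 2)) K≤

      3K≤P : K * 3 ≤ P
      3K≤P = ≤-trans (≤-trans (≤-reflexive (*-comm K 3)) (≤-trans (≤-reflexive (*-distribˡ-+ 3 1 n))
        (+-mono-≤ (n≤1+n 3) (*-monoʳ-≤ 3 (m≤m+n n n))))) small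

      f′≤ : f′ ≤ K
      f′≤ = m⊓n≤m K f
      τ′≤ : τ′ ≤ K
      τ′≤ = m⊓n≤m K τ

      open Correctness {P} {n} n≤

      ev-cappedℕ : ∀ m → length (bits (fromℕ m)) ≤ P → Ev P (unary K ∷ encodeℕ m ∷ []) cappedP (unary (K ⊓ m))
      ev-cappedℕ m h = subst₂ (λ v w → Ev P (unary K ∷ v ∷ []) cappedP (unary w))
        (sym (encode-bits (fromℕ m))) (trans (capped-bits K (fromℕ m)) (cong (K ⊓_) (toℕ-fromℕ m)))
        (ev-capped K (bits (fromℕ m)) h K≤)

      encode-cluster : ∀ γ → encodeCluster γ ≡ encodeClusterMatrix γ
      encode-cluster γ = cong (encodeSubset (vertices γ) ∙_) (encode-graph (tree γ))

      encode-output : encodeOutput σ ≡ encodeDecomposition result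
      encode-output = cong₂ _∙_ (sym (encode-tabulate (λ x → isZero (proj₂ σ x))))
        (cong encodeList (trans (reverse-foldl _ [] (allFin n)) (go (allFin n))))
        where
        l = proj₁ (proj₁ σ)
        e = proj₂ (proj₁ σ)

        encode-component : ∀ z → encodeVertices (λ x → l x == z) ∙ encodeMatrix (λ x y → e x y ∧ l x == z)
                                 ≡ encodeCluster (component z)
        encode-component z = cong₂ _∙_ (sym (encode-tabulate (λ x → l x == z)))
                               (sym (encode-graph (tree (component z))))

        go : ∀ zs → foldr (λ z acc → Bool.if l z == z
                then (encodeVertices (λ x → l x == z) ∙ encodeMatrix (λ x y → e x y ∧ l x == z)) ∷ acc else acc) [] zs
             ≡ map encodeCluster (map component (filter (λ z → l z Fin.≟ z) zs))
        go []       = refl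
        go (z ∷ zs) with l z Fin.≟ z
        ... | yes _ = cong₂ _∷_ (encode-component z) (go zs)
        ... | no _  = go zs

      ev-solve : ∀ M s → M ≤ P → Ev P
        (encodeRange ∷ encodeMatrix (Graph.adj G) ∷
         (encodeVertices inU ∙ encodeList (map encodeClusterMatrix (Γ D))) ∷ unary M ∷ unary s ∷ [])
        solveP (encodeOutput (finalState (Graph.adj G) inU (Γ D) M s))
      ev-solve M s M≤ =
        ev-bind (ev-left ev-var)
        (ev-bind (ev-right ev-var)
        (ev-bind (ev-call (ev-clusterForest (Γ D) clusters))
        (ev-bind (ev-left ev-var)
        (ev-bind (ev-pair ev-var (ev-tab n≤ ev-var (λ _ _ → ev-var)))
        (ev-bind (ev-call (ev-range-unary M M≤))
        (ev-bind (ev-call (ev-samples (Graph.adj G) inU (proj₁ (clusterForest (Γ D))) M≤ (clusterForest (Γ D) , λ _ → s)))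
        (ev-call (ev-output (finalState (Graph.adj G) inU (Γ D) M s)))))))))

      ev-main : Ev P (encodeMatrix (Graph.adj G) ∷ encodeℕ f ∷
                      (encodeVertices inU ∙ encodeList (map encodeClusterMatrix (Γ D))) ∷ encodeℕ τ ∷ [])
                  mainP (encodeOutput σ)
      ev-main =
        ev-bind (ev-call (ev-≡ (cong unary (length-tabulate rows)) (ev-length (List.tabulate rows) rows≤)))
        (ev-bind (ev-call (ev-≡ (trans (cong (λ m → encodeList (map unary (downFrom m))) (length-tabulate rows))
                                       (cong encodeList encode-range)) (ev-range (List.tabulate rows) rows≤)))
        (ev-bind (ev-pair ev-null ev-var)
        (ev-bind (ev-call (ev-cappedℕ f f-bits))
        (ev-bind (ev-call (ev-cappedℕ τ τ-bits))
        (ev-bind (ev-call (ev-log n (≤-trans (+-mono-≤ (m≤m+n 2 2) (m≤m+n (n + n) _)) small)))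
        (ev-bind (ev-call (ev-rounds (≤-trans f′≤ K≤P) (≤-trans (m≤m+n 3 _) small)
                            (≤-trans (*-monoˡ-≤ 3 f′≤) 3K≤P) (≤-trans (log↑≤n n) n≤)))
        (ev-bind (ev-call (ev-limit (≤-trans τ′≤ K≤P) (≤-trans (m≤m+n 2 _) small) large M³≤ M²≤ M≤))
        (ev-call (ev-solve M s M≤)))))))))
        where
        rows : Fin n → Tree
        rows x = array (λ y → encodeBool (Graph.adj G x y))
        rows≤ : length (List.tabulate rows) ≤ P
        rows≤ = ≤-trans (≤-reflexive (length-tabulate rows)) n≤

    ev-algorithm : Ev P (encodeInput G f D τ ∷ []) algorithm (encodeDecomposition result)
    ev-algorithm = ev-≡ encode-output (subst₂ (λ v w → Ev P ((v ∙ encodeℕ f ∙ w ∙ encodeℕ τ) ∷ []) algorithm (encodeOutput σ))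
      (sym (encode-graph G))
      (sym (cong₂ _∙_ (encode-subset (U D)) (cong encodeList (map-cong encode-cluster (Γ D)))))
      (ev-bind (ev-left ev-var) (ev-bind (ev-left (ev-right ev-var)) (ev-bind (ev-left (ev-right (ev-right ev-var)))
        (ev-bind (ev-right (ev-right (ev-right ev-var))) (ev-call ev-main))))))

-- Loop lengths in terms of the input size

length≤size : ∀ ts → suc (length ts) ≤ size (encodeList ts)
length≤size []       = ≤-refl
length≤size (t ∷ ts) = s≤s (≤-trans (length≤size ts) (m≤n+m _ (size t)))

size-left : ∀ a b → size a ≤ size (a ∙ b)
size-left a b = m≤n⇒m≤1+n (m≤m+n (size a) (size b))

size-right : ∀ a b → size b ≤ size (a ∙ b)
size-right a b = m≤n⇒m≤1+n (m≤n+m (size b) (size a))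

-- The longest loop runs 2 (1 + M⁴) times, and M ≤ 5 N² for an input of size N.
loopBound : ℕ → ℕ
loopBound N = 1252 * N ^ 8

x≤x^suc : ∀ {x} k → 1 ≤ x → x ≤ x ^ suc k
x≤x^suc {x} k h = ≤-trans (≤-reflexive (sym (*-identityʳ x))) (*-monoʳ-≤ x (^-monoʳ {b = k} h z≤n))

module Sizes {n : ℕ} (G : Graph n) (f : ℕ) (D : Decomposition G) (τ : ℕ) where

  open Execution G f D τ

  N P : ℕ
  N = size (encodeInput G f D τ)
  P = loopBound N

  private
    rest : Tree
    rest = encodeDecomposition D ∙ encodeℕ τ

    graph-size : suc n ≤ N
    graph-size = ≤-trans (subst (λ k → suc k ≤ size (encodeGraph G))
        (trans (length-map _ (allFin n)) (length-tabulate id)) (length≤size (map (λ u → encodeSubset (Graph.neighbours G u)) (allFin n))))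
      (size-left (encodeGraph G) (encodeℕ f ∙ rest))

    1≤N : 1 ≤ N
    1≤N = ≤-trans (s≤s z≤n) graph-size

    N≤P : N ≤ P
    N≤P = ≤-trans (x≤x^suc 7 1≤N) (m≤m+n (N ^ 8) _)

    rest-size : size rest ≤ N
    rest-size = ≤-trans (size-right (encodeℕ f) rest) (size-right (encodeGraph G) (encodeℕ f ∙ rest))

    bits≤ : ∀ m → size (encodeℕ m) ≤ N → length (bits (fromℕ m)) ≤ P
    bits≤ m h = ≤-trans (≤-trans (n≤1+n _) (subst₂ (λ k t → suc k ≤ size t) (length-map encodeBool (bits (fromℕ m)))
      (sym (encode-bits (fromℕ m))) (length≤size (map encodeBool (bits (fromℕ m)))))) (≤-trans h N≤P)

  f-bits : length (bits (fromℕ f)) ≤ P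
  f-bits = bits≤ f (≤-trans (size-left (encodeℕ f) rest) (size-right (encodeGraph G) (encodeℕ f ∙ rest)))

  τ-bits : length (bits (fromℕ τ)) ≤ P
  τ-bits = bits≤ τ (≤-trans (size-right (encodeDecomposition D) (encodeℕ τ)) rest-size)

  clusters : length (Γ D) ≤ P
  clusters = ≤-trans (≤-trans (n≤1+n _) (subst (λ k → suc k ≤ size (encodeList (map encodeCluster (Γ D))))
      (length-map encodeCluster (Γ D)) (length≤size (map encodeCluster (Γ D)))))
    (≤-trans (≤-trans (size-right (encodeSubset (U D)) (encodeList (map encodeCluster (Γ D))))
      (≤-trans (size-left (encodeDecomposition D) (encodeℕ τ)) rest-size)) N≤P)

  small : 4 + 3 * (n + n) ≤ P
  small = begin
    4 + 3 * (n + n)     ≤⟨ m≤n+m _ 2 ⟩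
    6 + 3 * (n + n)     ≡⟨ solve 1 (λ n → con 6 :+ con 3 :* (n :+ n) := con 6 :* (con 1 :+ n)) refl n ⟩
    6 * suc n           ≤⟨ *-monoʳ-≤ 6 graph-size ⟩
    6 * N               ≤⟨ *-mono-≤ (m≤m+n 6 1246) (x≤x^suc 7 1≤N) ⟩
    1252 * N ^ 8        ∎
    where open ≤-Reasoning

  private
    q : ℕ
    q = N * N

    M≤5q : M ≤ 5 * q
    M≤5q = begin
      M                  ≡⟨ rounds-def f′ L ⟩
      2 + f′ * 3 * L     ≤⟨ +-mono-≤ (*-monoʳ-≤ 2 (*-mono-≤ 1≤N 1≤N)) (*-mono-≤ (*-monoˡ-≤ 3
                              (≤-trans (m⊓n≤m K f) graph-size)) (≤-trans (log↑≤n n) (≤-trans (n≤1+n n) graph-size))) ⟩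
      2 * q + N * 3 * N  ≡⟨ solve 1 (λ N → con 2 :* (N :* N) :+ N :* con 3 :* N := con 5 :* (N :* N)) refl N ⟩
      5 * q              ∎
      where open ≤-Reasoning

  large : 2 * suc (M * (M * (M * M))) ≤ P
  large = begin
    2 * suc (M * (M * (M * M)))
      ≤⟨ *-monoʳ-≤ 2 (+-mono-≤ (^-monoʳ {b = 8} 1≤N z≤n) (*-mono-≤ M≤5q (*-mono-≤ M≤5q (*-mono-≤ M≤5q M≤5q)))) ⟩
    2 * (N ^ 8 + 5 * q * (5 * q * (5 * q * (5 * q))))
      ≡⟨ cong (λ z → 2 * (N ^ 8 + z)) (solve 1 (λ N → con 5 :* (N :* N) :* (con 5 :* (N :* N) :* (con 5 :* (N :* N) :* (con 5 :* (N :* N)))) :=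
           con 625 :* (N :* (N :* (N :* (N :* (N :* (N :* (N :* (N :* con 1))))))))) refl N) ⟩
    2 * (N ^ 8 + 625 * N ^ 8)
      ≡⟨ solve 1 (λ x → con 2 :* (x :+ con 625 :* x) := con 1252 :* x) refl (N ^ 8) ⟩
    1252 * N ^ 8 ∎
    where open ≤-Reasoning

-- The program

module _ (t : Tm 1) where

  -- The 9 steps put the input on an empty stack and take the result off it. The argument 1251
  -- stands for the coefficient 1252 of `loopBound`, as `poly-∘` adds 1.
  timed : PolyBounded (λ N → 9 + time t (λ _ → 0) (loopBound N))
  timed = poly-+ (poly-const 9) (poly-∘ 1251 8 (time-poly t (λ _ → 0)))

  clocked : PolyClockedProgram
  clocked = record
    { program     = record
      { extraVars = 0
      ; body      = zero ≔ `cons stack `nil ︔ compile t (λ _ → 0) ︔ zero ≔ `hd stack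
      }
    ; coefficient = proj₁ timed
    ; exponent    = proj₁ (proj₂ timed)
    }

  clocked-computes : ∀ {input output} → 1 ≤ size input → Ev (loopBound (size input)) (input ∷ []) t output →
                     PolyClockedProgram._⟶_ clocked input output
  clocked-computes {input} 1≤ e =
    let _ , r , b = Ev.run e (λ _ → 0) (input ∙ nil) λ { zero → refl }
    in _ , ([] , ⇓seq ⇓assign (⇓seq r ⇓assign)) ,
       ≤-trans (≤-trans (≤-reflexive (cong (5 +_) (+-comm (suc _) 3))) (+-monoʳ-≤ 9 b))
               (proj₂ (proj₂ timed) (size input) 1≤)

-- Size and degree bounds

module _ {n : ℕ} (G : Graph n) (f : ℕ) (D : Decomposition G) (τ : ℕ) where

  open Execution G f D τ
  open Result G D M s

  algorithm-computes : PolyClockedProgram._⟶_ (clocked algorithm) (encodeInput G f D τ) (encodeDecomposition result)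
  algorithm-computes = let open Sizes G f D τ in
    clocked-computes algorithm (s≤s z≤n) (ev-algorithm small large f-bits τ-bits clusters)

  private
    T⁴ : ℕ
    T⁴ = suc (M * (M * (M * M)))

  large-modulus : 2 + (f ⊓ suc n) * 3 * L ≤ M
  large-modulus = ≤-reflexive (trans (cong (λ k → 2 + k * 3 * L) (⊓-comm f (suc n))) (sym (rounds-def f′ L)))

  size-bound : ∣ U result ∣ * τ ≤ ∣ U D ∣
  size-bound = case ≤-total τ K of λ where
      (inj₁ τ≤K) → subst (λ k → b * k ≤ ∣ U D ∣) (m≥n⇒m⊓n≡n τ≤K) capped-bound
      -- Here `τ` was capped to n + 1, and |B| (n + 1) ≤ |U| ≤ n leaves only |B| = 0.
      (inj₂ K≤τ) → subst (λ k → k * τ ≤ ∣ U D ∣) (sym (empty b (subst (λ k → b * k ≤ ∣ U D ∣) (m≤n⇒m⊓n≡m K≤τ) capped-bound))) z≤n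
    where
    open ≤-Reasoning
    b = ∣ U result ∣
    capped-bound : b * τ′ ≤ ∣ U D ∣
    capped-bound = *-cancelˡ-≤ (2 * T⁴) (begin
      2 * T⁴ * (b * τ′)        ≡⟨ solve 3 (λ t b k → t :* (b :* k) := b :* (k :* t)) refl (2 * T⁴) b τ′ ⟩
      b * (τ′ * (2 * T⁴))      ≡⟨ cong (b *_) (sym (limit-def τ′ M)) ⟩
      b * s                    ≤⟨ result-size ⟩
      2 * (T⁴ * ∣ U D ∣)       ≡⟨ sym (*-assoc 2 T⁴ ∣ U D ∣) ⟩
      2 * T⁴ * ∣ U D ∣         ∎)
    empty : ∀ k → k * suc n ≤ ∣ U D ∣ → k ≡ 0
    empty zero    _ = refl
    empty (suc k) h = ⊥-elim (1+n≰n (≤-trans (≤-trans (m≤m+n (suc n) (k * suc n)) h) (∣p∣≤n (U D))))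

  -- For n ≤ 1 the logarithm is 0 and the right side leaves no room, but then there are no edges at
  -- all. For n ≥ 2, x ≥ 1 absorbs constants: M ≤ 2 x + 3 · 2 x = 8 x, where the inner 2 comes from
  -- `log↑≤`, and 8194 = 2 (1 + 8⁴). The fourth power of x is finally weakened to the twelfth.
  degree-bound : 1 ≤ f → Δ result ≤ Δ D + 8194 * (τ * (f * ⌈log₂ n ⌉) ^ 12)
  degree-bound 1≤f = case ≤-<-connex n 1 of λ where
      (inj₁ n≤1) → edgeless (loops-only n≤1)
      (inj₂ 2≤n) → several 2≤n
    where
    open ≤-Reasoning
    x = f * ⌈log₂ n ⌉

    edgeless : (∀ u v → ¬ Adj G u v) → Δ result ≤ Δ D + 8194 * (τ * x ^ 12)
    edgeless none = ≤-trans (Components.components-degree G forest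
      (λ u → ∣p∣≤length [] (λ {v} m → ⊥-elim (none u v (IsForest.edges forest (∈-tabulate⁻ m)))))) z≤n

    loops-only : n ≤ 1 → ∀ u v → ¬ Adj G u v
    loops-only n≤1 u v a = case trans (sym (Graph.irrefl G u)) (trans (cong (Graph.adj G u) u≡v) (T⇒≡ a)) of λ ()
      where
      toℕ≡0 : ∀ (w : Fin n) → toℕ w ≡ 0
      toℕ≡0 w = n<1⇒n≡0 (<-≤-trans (toℕ<n w) n≤1)
      u≡v : u ≡ v
      u≡v = toℕ-injective (trans (toℕ≡0 u) (sym (toℕ≡0 v)))

    several : 2 ≤ n → Δ result ≤ Δ D + 8194 * (τ * x ^ 12)
    several 2≤n = ≤-trans result-degree (+-monoʳ-≤ (Δ D) (begin
      s                                    ≡⟨ limit-def τ′ M ⟩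
      τ′ * (2 * T⁴)                        ≤⟨ *-mono-≤ (m⊓n≤n K τ) (*-monoʳ-≤ 2 (+-mono-≤ 1≤x⁴
                                                (*-mono-≤ M≤ (*-mono-≤ M≤ (*-mono-≤ M≤ M≤))))) ⟩
      τ * (2 * (x ^ 4 + 8 * x * (8 * x * (8 * x * (8 * x)))))
                                           ≡⟨ solve 2 (λ t x → t :* (con 2 :* (x :* (x :* (x :* (x :* con 1))) :+ con 8 :* x :* (con 8 :* x :* (con 8 :* x :* (con 8 :* x))))) :=
                                                con 8194 :* (t :* (x :* (x :* (x :* (x :* con 1)))))) refl τ x ⟩
      8194 * (τ * x ^ 4)                   ≤⟨ *-monoʳ-≤ 8194 (*-monoʳ-≤ τ (^-monoʳ {a = 4} {12} 1≤x (m≤m+n 4 8))) ⟩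
      8194 * (τ * x ^ 12)                  ∎))
      where
      1≤x : 1 ≤ x
      1≤x = *-mono-≤ 1≤f (⌈log₂⌉-mono-≤ {2} {n} 2≤n)
      1≤x⁴ : 1 ≤ x ^ 4
      1≤x⁴ = ^-monoʳ {b = 4} 1≤x z≤n
      M≤ : M ≤ 8 * x
      M≤ = begin
        M                               ≡⟨ rounds-def f′ L ⟩
        2 + f′ * 3 * L                  ≤⟨ +-mono-≤ (*-monoʳ-≤ 2 1≤x) (*-mono-≤ (*-monoˡ-≤ 3 (m⊓n≤n K f))
                                             (log↑≤ n 2≤n)) ⟩
        2 * x + f * 3 * (2 * ⌈log₂ n ⌉) ≡⟨ solve 2 (λ f l → con 2 :* (f :* l) :+ f :* con 3 :* (con 2 :* l) := con 8 :* (f :* l)) refl f ⌈log₂ n ⌉ ⟩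
        8 * x                           ∎

theoremB3 : Σ[ A ∈ PolyClockedProgram ] ∃[ C ]
    (∀ (n : ℕ) (G : Graph n) (f : ℕ) → 1 ≤ f →
    ∀ (UΓ : Decomposition G) (τ : ℕ) → 2 ≤ τ →
    Σ[ BΛ ∈ Decomposition G ]
    ( PolyClockedProgram._⟶_ A (encodeInput G f UΓ τ) (encodeDecomposition BΛ)
    × (∀ (Q : TripletSet n) → IsRespectingDecomposition f Q UΓ →
    Σ[ Q′ ∈ TripletSet n ]
    ( IsRespectingDecomposition f Q′ BΛ
    × (∀ s t F → Q s t F → ¬ Captured UΓ s t F →
    ∀ a b → InU UΓ s F a → InU UΓ t F b → Q′ a b F)
    × ∣ U BΛ ∣ * τ ≤ ∣ U UΓ ∣
    × Δ BΛ ≤ Δ UΓ + C * (τ * (f * ⌈log₂ n ⌉) ^ 12) )) ))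
theoremB3 = clocked algorithm , 8194 , λ n G f 1≤f D τ _ →
  let open Execution G f D τ using (M; s; L)
      open Result G D M s using (result; result-respecting)
  in result , algorithm-computes G f D τ , λ Q respecting →
       (λ a b F → ∃[ s ] ∃[ t ] (Q s t F × InU D s F a × InU D t F b))
     , result-respecting {L} (n≤2^log↑ n) (large-modulus G f D τ) Q respecting
     , (λ s t F q _ a b a∈ b∈ → s , t , q , a∈ , b∈)
     , size-bound G f D τ
     , degree-bound G f D τ 1≤f
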